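{- Let $A\in\mathbb R^{n\times d}$ with rows $a_1,\dots,a_n\in\mathbb R^d$, and let $\varepsilon>0$. There exists a subset $S\subseteq[n]$ of size $|S|=O(d\log\log d+d/\varepsilon)$, which can be computed in $\tilde O((d/\varepsilon)(\mathrm{nnz}(A)+d^2))$ time, such that $\{a_i\}_{i\in S}$ is a $(1+\varepsilon)$-approximate $\ell_2$-well-conditioned spanning set; that is, for every $i\in[n]$ there exists $x\in\mathbb R^S$ with $a_i=(A|_S)^\top x$ and $\|x\|_2\le 1+\varepsilon$.
   Context: For $S\subseteq[n]$, $A|_S$ is the matrix formed by the rows of $A$ indexed by $S$, and $\mathbb R^S$ is the set of vectors with entries indexed by $S$. $\mathrm{nnz}(A)$ is the number of nonzero entries of $A$. $\tilde O(\cdot)$ hides polylogarithmic factors. $\log\log d$ is read as at least $1$. (In the paper, $S$ is the set produced by a known algorithm for coresets of Löwner–John ellipsoids: there are nonnegative weights $u\in\mathbb R^n$ supported on $S$ with $\|u\|_\infty\le1$, $\|u\|_1=d$ and $(1+\varepsilon)\{x: x^\top(A^\top\mathrm{diag}(u)A)^{ -1}x\le1\}\supseteq\mathrm{conv}(\{\pm a_i\}_{i=1}^n)$.)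
   Formalization: The running time is proved with min(ε,1) in place of ε, i.e. Õ((d/min(ε,1))(nnz(A)+d²)); as stated the bound tends to 0 as ε→∞, which no algorithm that outputs S can meet. It is unchanged for ε ≤ 1. -}

module Defs where

open import Data.Bool.Base using (Bool; true; false; if_then_else_)
open import Data.Fin.Base using (Fin; toℕ)
open import Data.Fin.Subset using (Subset)
open import Data.Fin.Subset.Properties using (_∈?_)
open import Data.List.Base as List
  using (List; []; _∷_; allFin; applyUpTo; cartesianProduct; filter; length)
open import Data.List.Relation.Binary.Permutation.Propositional using (_↭_)
open import Data.Nat.Base as ℕ using (ℕ; zero; suc)
import Data.Nat.Properties as ℕ
open import Data.Nat.Logarithm using (⌊log₂_⌋)
open import Data.Product.Base using (Σ; ∃; ∃-syntax; _×_; _,_)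
open import Data.Vec.Functional using (Vector)
open import Level using (0ℓ)
open import Relation.Binary.Bundles using (DecTotalOrder)
open import Relation.Binary.PropositionalEquality.Core using (_≡_)
open import Relation.Binary.Structures using (IsDecTotalOrder)
open import Relation.Nullary.Decidable.Core using (does; ¬?)
open import Relation.Nullary.Negation.Core using (¬_)
open import Algebra.Bundles using (CommutativeRing)
open import Algebra.Structures using (IsCommutativeRing)
import Algebra.Construct.NaturalChoice.Min as Min
import Algebra.Properties.Semiring.Exp as Exp
import Algebra.Properties.Semiring.Mult as Mult
import Algebra.Properties.Semiring.Sum as Sum
import Relation.Binary.Construct.NonStrictToStrict as Strict

record OrderedField : Set₁ where
  infix  8 -_
  infix  9 _⁻¹
  infixl 7 _*_
  infixl 6 _+_
  infix  4 _≈_ _≤_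
  field
    Carrier           : Set
    _≈_ _≤_           : Carrier → Carrier → Set
    _+_ _*_           : Carrier → Carrier → Carrier
    -_ _⁻¹            : Carrier → Carrier
    0# 1#             : Carrier
    isCommutativeRing : IsCommutativeRing _≈_ _+_ _*_ -_ 0# 1#
    isDecTotalOrder   : IsDecTotalOrder _≈_ _≤_
    0≉1               : ¬ (0# ≈ 1#)
    *-inverseʳ        : ∀ x → ¬ (x ≈ 0#) → x * x ⁻¹ ≈ 1#
    0⁻¹≈0             : ∀ x → x ≈ 0# → x ⁻¹ ≈ 0#
    +-monoˡ-≤         : ∀ z {x y} → x ≤ y → x + z ≤ y + z
    *-nonneg          : ∀ {x y} → 0# ≤ x → 0# ≤ y → 0# ≤ x * y

  commutativeRing : CommutativeRing 0ℓ 0ℓ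
  commutativeRing = record { isCommutativeRing = isCommutativeRing }

  decTotalOrder : DecTotalOrder 0ℓ 0ℓ 0ℓ
  decTotalOrder = record { isDecTotalOrder = isDecTotalOrder }

  open CommutativeRing commutativeRing public using (_-_; semiring)
  open IsDecTotalOrder isDecTotalOrder public using (_≟_; _≤?_)
  open Strict _≈_ _≤_ public using (_<_)
  open Min (DecTotalOrder.totalOrder decTotalOrder) public using (_⊓_)
  open Exp semiring public using (_^_)
  open Sum semiring public using (sum)

  fromℕ : ℕ → Carrier
  fromℕ m = Mult._×_ semiring m 1#

  _IsUpperBoundOf_ : Carrier → (Carrier → Set) → Set
  u IsUpperBoundOf P = ∀ x → P x → x ≤ u

-- The real numbers: classically there is exactly one such structure up to
-- isomorphism.  The order is decidable, as it is classically.  `archimedean`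
-- follows classically from `supremum`; it is a field here because its witness
-- cannot be extracted constructively from the least-upper-bound property.

record CompleteOrderedField : Set₁ where
  field
    orderedField : OrderedField

  open OrderedField orderedField public

  field
    archimedean : ∀ x → ∃[ m ] x ≤ fromℕ m
    supremum    : (P : Carrier → Set) → ∃ P → (∃[ u ] u IsUpperBoundOf P) →
                  ∃[ s ] s IsUpperBoundOf P ×
                         (∀ u → u IsUpperBoundOf P → s ≤ u)

-- Real-RAM programs.  A program uses finitely many natural variables, real
-- variables, and arrays of each kind, all named by natural numbers; array
-- indices are the values of natural variables.  There is no conversion between naturals and
-- reals, and the only literals of real type are 0 and 1.  Naturals are never
-- multiplied, so after t steps their bit length has grown by at most O(t).

data Instr : Set where
  constᴺ              : (x : ℕ) (c : ℕ) → Instr       -- x ≔ c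
  addᴺ subᴺ           : (x y z : ℕ) → Instr           -- x ≔ y ∘ z (truncated −)
  loadᴺ               : (x a i : ℕ) → Instr           -- x ≔ a[i]
  storeᴺ              : (a i x : ℕ) → Instr           -- a[i] ≔ x
  zeroᴿ oneᴿ          : (x : ℕ) → Instr
  addᴿ subᴿ mulᴿ divᴿ : (x y z : ℕ) → Instr
  loadᴿ               : (x a i : ℕ) → Instr           -- i is a natural variable
  storeᴿ              : (a i x : ℕ) → Instr

data Test : Set where
  lessᴺ : (x y : ℕ) → Test                            -- x < y, on naturals
  leqᴿ  : (x y : ℕ) → Test                            -- x ≤ y, on reals

infixr 5 _︔_
infix  6 If_Then_Else_ While_Do_

data Program : Set where
  skip          : Program
  instr         : Instr → Program
  _︔_           : Program → Program → Program
  If_Then_Else_ : Test → Program → Program → Program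
  While_Do_     : Test → Program → Program

_[_≔_] : {V : Set} → (ℕ → V) → ℕ → V → (ℕ → V)
(f [ x ≔ v ]) y = if does (x ℕ.≟ y) then v else f y

module RealRAM (R : CompleteOrderedField) where
  open CompleteOrderedField R renaming (Carrier to ℝ)

  record State : Set where
    constructor state
    field
      varᴺ : ℕ → ℕ
      arrᴺ : ℕ → ℕ → ℕ
      varᴿ : ℕ → ℝ
      arrᴿ : ℕ → ℕ → ℝ

  exec : Instr → State → State
  exec I (state n a r b) with I
  ... | constᴺ x c   = state (n [ x ≔ c ]) a r b
  ... | addᴺ x y z   = state (n [ x ≔ n y ℕ.+ n z ]) a r b
  ... | subᴺ x y z   = state (n [ x ≔ n y ℕ.∸ n z ]) a r b
  ... | loadᴺ x k i  = state (n [ x ≔ a k (n i) ]) a r b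
  ... | storeᴺ k i x = state n (a [ k ≔ a k [ n i ≔ n x ] ]) r b
  ... | zeroᴿ x      = state n a (r [ x ≔ 0# ]) b
  ... | oneᴿ x       = state n a (r [ x ≔ 1# ]) b
  ... | addᴿ x y z   = state n a (r [ x ≔ r y + r z ]) b
  ... | subᴿ x y z   = state n a (r [ x ≔ r y - r z ]) b
  ... | mulᴿ x y z   = state n a (r [ x ≔ r y * r z ]) b
  ... | divᴿ x y z   = state n a (r [ x ≔ r y * r z ⁻¹ ]) b
  ... | loadᴿ x k i  = state n a (r [ x ≔ b k (n i) ]) b
  ... | storeᴿ k i x = state n a r (b [ k ≔ b k [ n i ≔ r x ] ])

  test : Test → State → Bool
  test (lessᴺ x y) σ = does (State.varᴺ σ x ℕ.<? State.varᴺ σ y)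
  test (leqᴿ x y)  σ = does (State.varᴿ σ x ≤? State.varᴿ σ y)

  -- ⟨ p , σ ⟩⇓[ t ] τ : started in σ, p halts in τ after t steps, a step
  -- being one instruction or one evaluation of a test.
  infix 4 ⟨_,_⟩⇓[_]_

  data ⟨_,_⟩⇓[_]_ : Program → State → ℕ → State → Set where
    ⇓-skip  : ∀ {σ} → ⟨ skip , σ ⟩⇓[ 0 ] σ
    ⇓-instr : ∀ {I σ} → ⟨ instr I , σ ⟩⇓[ 1 ] exec I σ
    ⇓-seq   : ∀ {p q σ τ υ s t} →
              ⟨ p , σ ⟩⇓[ s ] τ → ⟨ q , τ ⟩⇓[ t ] υ →
              ⟨ p ︔ q , σ ⟩⇓[ s ℕ.+ t ] υ
    ⇓-then  : ∀ {b p q σ τ t} → test b σ ≡ true →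
              ⟨ p , σ ⟩⇓[ t ] τ →
              ⟨ If b Then p Else q , σ ⟩⇓[ suc t ] τ
    ⇓-else  : ∀ {b p q σ τ t} → test b σ ≡ false →
              ⟨ q , σ ⟩⇓[ t ] τ →
              ⟨ If b Then p Else q , σ ⟩⇓[ suc t ] τ
    ⇓-stop  : ∀ {b p σ} → test b σ ≡ false →
              ⟨ While b Do p , σ ⟩⇓[ 1 ] σ
    ⇓-loop  : ∀ {b p σ τ υ s t} → test b σ ≡ true →
              ⟨ p , σ ⟩⇓[ s ] τ → ⟨ While b Do p , τ ⟩⇓[ t ] υ →
              ⟨ While b Do p , σ ⟩⇓[ suc (s ℕ.+ t) ] υ

-- log log d, read as at least 1.  Rounding and the choice of base 2 change
-- it by at most a bounded factor.
loglog : ℕ → ℕ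
loglog d = ⌊log₂ ⌊log₂ d ⌋ ⌋ ℕ.⊔ 1

elements : ∀ {n} → Subset n → List (Fin n)
elements {n} S = filter (_∈? S) (allFin n)

module Spanning (R : CompleteOrderedField) where
  open CompleteOrderedField R public renaming (Carrier to ℝ)
  open RealRAM R public

  Matrix : ℕ → ℕ → Set
  Matrix n d = Vector (Vector ℝ d) n

  -- The rows of A|_S and the entries of a vector in ℝ^S are indexed by the
  -- positions in the increasing list of the elements of S.
  ℝ^_ : ∀ {n} → Subset n → Set
  ℝ^ S = Vector ℝ (length (elements S))

  _∣[_] : ∀ {n d} → Matrix n d → (S : Subset n) → Matrix (length (elements S)) d
  (A ∣[ S ]) k = A (List.lookup (elements S) k)

  _ᵀ*_ : ∀ {m d} → Matrix m d → Vector ℝ m → Vector ℝ d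
  (B ᵀ* x) j = sum (λ k → B k j * x k)

  IsNorm₂ : ∀ {m} → Vector ℝ m → ℝ → Set
  IsNorm₂ x r = 0# ≤ r × r * r ≈ sum (λ k → x k * x k)

  ‖_‖₂≤_ : ∀ {m} → Vector ℝ m → ℝ → Set
  ‖ x ‖₂≤ c = ∃[ r ] IsNorm₂ x r × r ≤ c

  -- c is the whole approximation factor, so 1 + ε for the (1+ε)-approximate
  -- notion.
  IsWellConditionedSpanningSet : ∀ {n d} → Matrix n d → Subset n → ℝ → Set
  IsWellConditionedSpanningSet A S c =
    ∀ i → Σ (ℝ^ S) λ x → (∀ j → A i j ≈ ((A ∣[ S ]) ᵀ* x) j) × ‖ x ‖₂≤ c

  -- Positions of the nonzero entries, in row-major order.
  nonzeros : ∀ {n d} → Matrix n d → List (Fin n × Fin d)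
  nonzeros {n} {d} A =
    filter (λ (i , j) → ¬? (A i j ≟ 0#)) (cartesianProduct (allFin n) (allFin d))

  nnz : ∀ {n d} → Matrix n d → ℕ
  nnz A = length (nonzeros A)

  array : {V : Set} → V → List V → ℕ → V
  array v []       _       = v
  array v (w ∷ ws) zero    = w
  array v (w ∷ ws) (suc i) = array v ws i

  -- A is given in sparse coordinate form: the row indices, column indices
  -- and values of its nonzero entries, together with n, d, nnz(A) and ε.
  -- Everything else is initialised to 0.
  input : ∀ {n d} → Matrix n d → ℝ → State
  input {n} {d} A ε = record
    { varᴺ = array 0 (n ∷ d ∷ nnz A ∷ [])
    ; arrᴺ = array (λ _ → 0)
               ( array 0 (List.map (λ (i , j) → toℕ i) (nonzeros A))
               ∷ array 0 (List.map (λ (i , j) → toℕ j) (nonzeros A))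
               ∷ [])
    ; varᴿ = array 0# (ε ∷ [])
    ; arrᴿ = array (λ _ → 0#)
               (array 0# (List.map (λ (i , j) → A i j) (nonzeros A)) ∷ [])
    }

  -- Variable 0 holds |S|, and the first |S| cells of array 0 list the
  -- elements of S, without repetition and in any order.
  Outputs : ∀ {n} → State → Subset n → Set
  Outputs σ S =
    applyUpTo (State.arrᴺ σ 0) (State.varᴺ σ 0) ↭ List.map toℕ (elements S)

  -- t = Õ(f) with constant C and exponent k, i.e. t ≤ C (1 + f) (1 + log f)^k.
  -- The bound on 1 + l for all naturals l ≥ log₂ f amounts to the one at
  -- l = ⌈log₂ f⌉.  The summand 1 in 1 + f matters only where f < 1.
  _≤Õ[_,_]_ : ℕ → ℕ → ℕ → ℝ → Set
  t ≤Õ[ C , k ] f =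
    ∀ l → f ≤ fromℕ 2 ^ l → fromℕ t ≤ fromℕ C * (1# + f) * fromℕ (1 ℕ.+ l) ^ k

  -- (d/ε)(nnz(A) + d²), with ε replaced by 1 when ε > 1: otherwise the
  -- expression tends to 0 as ε → ∞ and bounds no running time.
  timeBound : ∀ {n d} → Matrix n d → ℝ → ℝ
  timeBound {_} {d} A ε =
    (fromℕ d * (ε ⊓ 1#) ⁻¹) * fromℕ (nnz A ℕ.+ d ℕ.* d)

  sizeBound : ℕ → ℝ → ℝ
  sizeBound d ε = fromℕ (d ℕ.* loglog d) + fromℕ d * ε ⁻¹

{-# OPTIONS --safe #-}
module Submission where

-- Let M be the sum of aᵢ aᵢᵀ over i ∈ S and of eₗ eₗᵀ over some unit vectors,
-- and W = M⁻¹, which is kept up to date by rank-one updates, as are the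
-- leverages ℓᵢ = aᵢᵀ W aᵢ.  If all ℓᵢ ≤ 1 and the unit vectors are independent
-- of the row space, then xₛ = aₛᵀ W aᵢ solves aᵢ = (A|_S)ᵀ x with ‖x‖² ≤ ℓᵢ ≤ 1,
-- so that no factor 1 + ε is lost.
--
-- Start from M = I.  For each k, the functional g = W eₖ vanishes on all other
-- vectors of the current basis; exchange eₖ for the row with the largest
-- |aᵢ · g|, or keep eₖ for good if g vanishes on all rows.  This takes d steps.
-- Afterwards, as long as some ℓᵢ > 1, add i to S and then remove some s ∈ S with
-- ℓₛ ≤ 1/4, if any.  As the leverages add up to d, at most 4d rows remain in S.
--
-- Adding a vector v multiplies det M by 1 + vᵀ W v, removing it by 1 − vᵀ W v; so
-- each round of the second phase gains a factor of at least 3/2.  In the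
-- triangular coordinates given by the functionals g, the k-th diagonal entry of M
-- is at most (4d + 1) πₖ, where ∏ πₖ is the value of det M after the first phase,
-- so by Hadamard's inequality det M never exceeds (4d + 1)ᵈ ∏ πₖ.  Hence there
-- are O(d log d) rounds, each of cost O(nnz(A) + d²).  Determinants are defined
-- by recursion on Schur complements, which suffices for all of this.

open import Defs
open import Data.Nat.Base using (ℕ)
open import Data.Fin.Subset using (Subset; ∣_∣)
open import Data.Product.Base using (Σ-syntax; _×_)

open import Algebra.Bundles using (CommutativeRing)
import Algebra.Properties.Ring as RingProperties
import Algebra.Properties.Semiring.Mult as SemiringMult
import Algebra.Properties.Semiring.Mult.TCOptimised as SemiringMult′
import Algebra.Properties.Semiring.Sum as SemiringSum
import Algebra.Solver.Ring as RingSolver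
open import Algebra.Solver.Ring.AlmostCommutativeRing
  using (_-Raw-AlmostCommutative⟶_; fromCommutativeRing)
open import Data.Bool.Base using (Bool; true; false; if_then_else_; not; _∧_; T)
open import Data.Empty using (⊥; ⊥-elim)
open import Data.Fin.Base as Fin using (Fin; zero; suc; toℕ; _↑ˡ_; _↑ʳ_; splitAt)
import Data.Fin.Properties as Fin
open import Data.Fin.Subset using (_∈_)
open import Data.Fin.Subset.Properties using (_∈?_)
open import Data.Integer.Base as ℤ using (ℤ; +_; -[1+_]; _⊖_)
import Data.Integer.Properties as ℤ
open import Data.List.Base as List
  using (List; []; _∷_; _++_; length; allFin; applyUpTo; cartesianProduct; filter; tabulate)
import Data.List.Membership.Propositional as List
open import Data.List.Membership.Propositional.Properties
  using (∈-filter⁺; ∈-filter⁻; ∈-map⁺; ∈-map⁻; ∈-allFin; ∈-applyUpTo⁺; ∈-applyUpTo⁻; ∈-cartesianProduct⁺)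
open import Data.List.Membership.Propositional.Properties.WithK using (unique∧set⇒bag)
open import Data.List.Relation.Binary.BagAndSetEquality using (∼bag⇒↭)
open import Data.List.Relation.Binary.Permutation.Propositional using (_↭_)
open import Data.List.Relation.Unary.All using (All; []; _∷_)
open import Data.List.Relation.Unary.Any using (here; there)
import Data.List.Relation.Unary.Unique.Propositional.Properties as Unique
open import Data.Maybe.Base using (Maybe; just; nothing)
open import Data.Nat.Base as ℕ using (zero; suc; z≤n; s≤s; _≡ᵇ_)
import Data.Nat.Properties as ℕ
open import Data.Nat.Solver using (module +-*-Solver)
open import Data.Product.Base using (∃-syntax; _,_; proj₁; proj₂)
open import Data.Sum.Base using (_⊎_; inj₁; inj₂; [_,_]′)
open import Data.Unit.Base using (⊤; tt)
import Data.Vec.Base as Vec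
open import Data.Vec.Functional using (Vector; updateAt)
open import Data.Vec.Functional.Properties using (updateAt-updates; updateAt-minimal)
import Data.Vec.Properties as Vec
open import Function.Base using (_∘_; const)
open import Function.Bundles using (mk⇔)
open import Relation.Binary.Bundles using (DecTotalOrder)
open import Relation.Binary.Definitions using (tri<; tri≈; tri>)
open import Relation.Binary.PropositionalEquality.Core as ≡ using (_≡_; _≢_)
import Relation.Binary.Reasoning.PartialOrder as PartialOrderReasoning
import Relation.Binary.Reasoning.Setoid as SetoidReasoning
open import Relation.Binary.Structures using (IsDecTotalOrder)
open import Relation.Nullary using (¬_; yes; no; does; Dec; ¬?)
open import Relation.Nullary.Decidable using (dec-true; dec-false)

-- The rank of `A` is unknown and `M` has to stay invertible, so unit vectors complete the rows to a
-- basis. That the present vectors form a basis is expressed by counting: leverages of members are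
-- at most 1 and add up to `d`, so if there are `d` members, all have leverage 1, and a member of
-- leverage 1 is orthogonal to the others in the inner product given by `W`. This is why `g`
-- vanishes on the rest of the basis. The number of rounds must not depend on the magnitudes of the
-- entries of `A`. The choice of the largest value ensures this: the square of the functional on
-- every row is bounded by the very factor that the exchange contributes to the determinant, so
-- these factors cancel when the final determinant is compared with the initial one. The threshold
-- 1/4 serves two ends: 2 (1 - 1/4) exceeds 1, and its inverse is the constant in `4d`. The time
-- bound does not contain `n`. Hence rows are reached only through their nonzero entries, and
-- scratch arrays indexed by rows are restored cell by cell instead of being cleared.

module SpanningSubset (R : CompleteOrderedField) where

  -- Ordered fields

  open CompleteOrderedField R renaming (Carrier to ℝ) public
  open CommutativeRing commutativeRing public
    using (+-cong; *-cong; +-comm; *-comm; +-assoc; *-assoc; -‿cong; setoid;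
           +-congˡ; +-congʳ; *-congˡ; *-congʳ; +-identityˡ; +-identityʳ; *-identityˡ; *-identityʳ;
           zeroˡ; zeroʳ; -‿inverseʳ; refl; sym; trans; reflexive)
  open IsDecTotalOrder isDecTotalOrder public using (total; antisym)
    renaming (refl to ≤-refl; reflexive to ≤-reflexive; trans to ≤-trans)
  open SemiringMult′ semiring using (×-homo-+; ×1-homo-*; 1+×) renaming (_×_ to _×′_)

  -- Unlike fromℕ 1, fromℕ′ 1 reduces to 1#, as the constants of the solver require.
  fromℕ′ : ℕ → ℝ
  fromℕ′ n = n ×′ 1#

  private module RP = RingProperties (CommutativeRing.ring commutativeRing)

  -- Integer coefficients for the ring solver

  fromℤ : ℤ → ℝ
  fromℤ (+ n)     = fromℕ′ n
  fromℤ -[1+ n ]  = - fromℕ′ (suc n)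

  private
    cancel₁ : ∀ x y z → x + y - (x + z) ≈ y - z
    cancel₁ x y z = begin
      x + y - (x + z)        ≈⟨ +-congˡ (RP.-‿+-comm x z) ⟨
      x + y + (- x + - z)    ≈⟨ +-congʳ (+-comm x y) ⟩
      y + x + (- x + - z)    ≈⟨ +-assoc y x _ ⟩
      y + (x + (- x + - z))  ≈⟨ +-congˡ (+-assoc x (- x) (- z)) ⟨
      y + ((x - x) + - z)    ≈⟨ +-congˡ (+-congʳ (-‿inverseʳ x)) ⟩
      y + (0# + - z)         ≈⟨ +-congˡ (+-identityˡ _) ⟩
      y - z                  ∎
      where open SetoidReasoning setoid

    fromℤ-⊖ : ∀ m n → fromℤ (m ⊖ n) ≈ fromℕ′ m - fromℕ′ n
    fromℤ-⊖ zero zero = sym (-‿inverseʳ 0#)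
    fromℤ-⊖ zero (suc n) = sym (+-identityˡ _)
    fromℤ-⊖ (suc m) zero = sym (trans (+-congˡ RP.-0#≈0#) (+-identityʳ _))
    fromℤ-⊖ (suc m) (suc n) = begin
      fromℤ (suc m ⊖ suc n)       ≡⟨ ≡.cong fromℤ (ℤ.[1+m]⊖[1+n]≡m⊖n m n) ⟩
      fromℤ (m ⊖ n)               ≈⟨ fromℤ-⊖ m n ⟩
      fromℕ′ m - fromℕ′ n           ≈⟨ cancel₁ 1# _ _ ⟨
      1# + fromℕ′ m - (1# + fromℕ′ n)   ≈⟨ +-cong (1+× m 1#) (-‿cong (1+× n 1#)) ⟨
      fromℕ′ (suc m) - fromℕ′ (suc n) ∎
      where open SetoidReasoning setoid

    fromℤ-neg : ∀ i → fromℤ (ℤ.- i) ≈ - fromℤ i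
    fromℤ-neg (+ zero) = sym RP.-0#≈0#
    fromℤ-neg (+ suc n) = refl
    fromℤ-neg -[1+ n ] = sym (RP.-‿involutive _)

    fromℤ-+ : ∀ i j → fromℤ (i ℤ.+ j) ≈ fromℤ i + fromℤ j
    fromℤ-+ (+ m) (+ n) = ×-homo-+ 1# m n
    fromℤ-+ (+ m) -[1+ n ] = fromℤ-⊖ m (suc n)
    fromℤ-+ -[1+ m ] (+ n) = trans (fromℤ-⊖ n (suc m)) (+-comm _ _)
    fromℤ-+ -[1+ m ] -[1+ n ] = begin
      - fromℕ′ (suc (suc (m ℕ.+ n)))       ≡⟨ ≡.cong (λ k → - fromℕ′ (suc k)) (≡.sym (ℕ.+-suc m n)) ⟩
      - fromℕ′ (suc m ℕ.+ suc n)           ≈⟨ -‿cong (×-homo-+ 1# (suc m) (suc n)) ⟩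
      - (fromℕ′ (suc m) + fromℕ′ (suc n))   ≈⟨ RP.-‿+-comm _ _ ⟨
      - fromℕ′ (suc m) - fromℕ′ (suc n)     ∎
      where open SetoidReasoning setoid

    fromℤ-* : ∀ i j → fromℤ (i ℤ.* j) ≈ fromℤ i * fromℤ j
    fromℤ-* (+ m) (+ n) = trans (reflexive (≡.cong fromℤ (≡.sym (ℤ.pos-* m n)))) (×1-homo-* m n)
    fromℤ-* (+ m) -[1+ n ] = begin
      fromℤ (+ m ℤ.* -[1+ n ])         ≡⟨ ≡.cong fromℤ (≡.trans (≡.sym (ℤ.neg-distribʳ-* (+ m) (+ suc n)))
        (≡.cong ℤ.-_ (≡.sym (ℤ.pos-* m (suc n))))) ⟩
      fromℤ (ℤ.- (+ (m ℕ.* suc n)))    ≈⟨ fromℤ-neg (+ (m ℕ.* suc n)) ⟩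
      - fromℕ′ (m ℕ.* suc n)            ≈⟨ -‿cong (×1-homo-* m (suc n)) ⟩
      - (fromℕ′ m * fromℕ′ (suc n))      ≈⟨ RP.-‿distribʳ-* _ _ ⟩
      fromℕ′ m * - fromℕ′ (suc n)        ∎
      where open SetoidReasoning setoid
    fromℤ-* -[1+ m ] (+ n) = begin
      fromℤ (-[1+ m ] ℤ.* + n)         ≡⟨ ≡.cong fromℤ (≡.trans (≡.sym (ℤ.neg-distribˡ-* (+ suc m) (+ n)))
        (≡.cong ℤ.-_ (≡.sym (ℤ.pos-* (suc m) n)))) ⟩
      fromℤ (ℤ.- (+ (suc m ℕ.* n)))    ≈⟨ fromℤ-neg (+ (suc m ℕ.* n)) ⟩
      - fromℕ′ (suc m ℕ.* n)            ≈⟨ -‿cong (×1-homo-* (suc m) n) ⟩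
      - (fromℕ′ (suc m) * fromℕ′ n)      ≈⟨ RP.-‿distribˡ-* _ _ ⟩
      - fromℕ′ (suc m) * fromℕ′ n        ∎
      where open SetoidReasoning setoid
    fromℤ-* -[1+ m ] -[1+ n ] = begin
      fromℕ′ (suc m ℕ.* suc n)              ≈⟨ ×1-homo-* (suc m) (suc n) ⟩
      fromℕ′ (suc m) * fromℕ′ (suc n)        ≈⟨ RP.-‿involutive _ ⟨
      - (- (fromℕ′ (suc m) * fromℕ′ (suc n))) ≈⟨ -‿cong (RP.-‿distribʳ-* _ _) ⟩
      - (fromℕ′ (suc m) * - fromℕ′ (suc n))   ≈⟨ RP.-‿distribˡ-* _ _ ⟩
      - fromℕ′ (suc m) * - fromℕ′ (suc n)     ∎
      where open SetoidReasoning setoid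

    fromℤ-morphism : ℤ.+-*-rawRing -Raw-AlmostCommutative⟶ fromCommutativeRing commutativeRing
    fromℤ-morphism = record
      { ⟦_⟧    = fromℤ
      ; +-homo = fromℤ-+
      ; *-homo = fromℤ-*
      ; -‿homo = fromℤ-neg
      ; 0-homo = refl
      ; 1-homo = refl
      }

    fromℤ-≟ : ∀ i j → Maybe (fromℤ i ≈ fromℤ j)
    fromℤ-≟ i j with i ℤ.≟ j
    ... | yes eq = just (reflexive (≡.cong fromℤ eq))
    ... | no _ = nothing

  open RingSolver ℤ.+-*-rawRing (fromCommutativeRing commutativeRing) fromℤ-morphism fromℤ-≟ public
    using (Polynomial; solve; con; _:=_; _:+_; _:*_; _:-_; :-_)

  :0 :1 :4 : ∀ {n} → Polynomial n
  :0 = con (+ 0)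
  :1 = con (+ 1)
  :4 = :1 :+ :1 :+ (:1 :+ :1)


  -- The order of the field

  module ≤-Reasoning = PartialOrderReasoning (DecTotalOrder.poset decTotalOrder)
  open IsDecTotalOrder isDecTotalOrder public using (≤-respˡ-≈; ≤-respʳ-≈)

  +-monoʳ-≤ : ∀ z {x y} → x ≤ y → z + x ≤ z + y
  +-monoʳ-≤ z {x} {y} x≤y = ≤-respˡ-≈ (+-comm x z) (≤-respʳ-≈ (+-comm y z) (+-monoˡ-≤ z x≤y))

  +-mono-≤ : ∀ {x y u v} → x ≤ y → u ≤ v → x + u ≤ y + v
  +-mono-≤ {y = y} {u} x≤y u≤v = ≤-trans (+-monoˡ-≤ u x≤y) (+-monoʳ-≤ y u≤v)

  x≤y⇒0≤y-x : ∀ {x y} → x ≤ y → 0# ≤ y - x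
  x≤y⇒0≤y-x {x} x≤y = ≤-respˡ-≈ (-‿inverseʳ x) (+-monoˡ-≤ (- x) x≤y)

  -- Reduces an inequality to a ring identity: the difference is written as an expression of known
  -- sign, and the solver checks the identity. Most inequalities below are proved in this way.
  ≤-by : ∀ {x y e} → 0# ≤ e → y - x ≈ e → x ≤ y
  ≤-by {x} {y} {e} 0≤e eq = ≤-respˡ-≈ (+-identityˡ x)
    (≤-respʳ-≈ (trans (+-congʳ (sym eq)) (solve 2 (λ x y → y :- x :+ x := y) refl x y)) (+-monoˡ-≤ x 0≤e))

  <⇒≱ : ∀ {x y} → x < y → ¬ (y ≤ x)
  <⇒≱ (x≤y , x≉y) y≤x = x≉y (antisym x≤y y≤x)

  ≰⇒> : ∀ {x y} → ¬ (x ≤ y) → y < x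
  ≰⇒> {x} {y} x≰y with total x y
  ... | inj₁ x≤y = ⊥-elim (x≰y x≤y)
  ... | inj₂ y≤x = y≤x , λ y≈x → x≰y (≤-reflexive (sym y≈x))

  <⇒≉ : ∀ {x} → 0# < x → ¬ (x ≈ 0#)
  <⇒≉ (_ , 0≉x) x≈0 = 0≉x (sym x≈0)

  <-≤-trans : ∀ {x y z} → x < y → y ≤ z → x < z
  <-≤-trans x<y y≤z = ≰⇒> λ z≤x → <⇒≱ x<y (≤-trans y≤z z≤x)

  ≤-<-trans : ∀ {x y z} → x ≤ y → y < z → x < z
  ≤-<-trans x≤y y<z = ≰⇒> λ z≤x → <⇒≱ y<z (≤-trans z≤x x≤y)

  <-respʳ-≈ : ∀ {x y z} → y ≈ z → x < y → x < z
  <-respʳ-≈ y≈z x<y = <-≤-trans x<y (≤-reflexive y≈z)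

  <-by : ∀ {x y e} → 0# < e → y - x ≈ e → x < y
  <-by {x} {y} (0≤e , 0≉e) eq = ≤-by 0≤e eq ,
    λ x≈y → 0≉e (trans (trans (sym (-‿inverseʳ x)) (+-congʳ x≈y)) eq)

  x<y⇒0<y-x : ∀ {x y} → x < y → 0# < y - x
  x<y⇒0<y-x {x} {y} x<y = ≰⇒> λ y-x≤0 → <⇒≱ x<y
    (≤-by (x≤y⇒0≤y-x y-x≤0) (solve 2 (λ x y → x :- y := :0 :- (y :- x)) refl x y))

  0≤x²  : ∀ x → 0# ≤ x * x
  0≤x² x with total 0# x
  ... | inj₁ 0≤x = *-nonneg 0≤x 0≤x
  ... | inj₂ x≤0 = ≤-respʳ-≈ (solve 1 (λ x → (:0 :- x) :* (:0 :- x) := x :* x) refl x)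
                     (*-nonneg (x≤y⇒0≤y-x x≤0) (x≤y⇒0≤y-x x≤0))

  +-nonneg : ∀ {x y} → 0# ≤ x → 0# ≤ y → 0# ≤ x + y
  +-nonneg 0≤x 0≤y = ≤-respˡ-≈ (+-identityˡ 0#) (+-mono-≤ 0≤x 0≤y)

  +-pos-nonneg : ∀ {x y} → 0# < x → 0# ≤ y → 0# < x + y
  +-pos-nonneg {x} 0<x 0≤y = <-≤-trans 0<x (≤-respˡ-≈ (+-identityʳ x) (+-monoʳ-≤ x 0≤y))

  0<1 : 0# < 1#
  0<1 = ≤-respʳ-≈ (*-identityˡ 1#) (0≤x² 1#) , 0≉1

  x*y≈0⇒y≈0 : ∀ {x y} → ¬ (x ≈ 0#) → x * y ≈ 0# → y ≈ 0#
  x*y≈0⇒y≈0 {x} {y} x≉0 xy≈0 = begin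
    y              ≈⟨ *-identityˡ y ⟨
    1# * y         ≈⟨ *-congʳ (*-inverseʳ x x≉0) ⟨
    x * x ⁻¹ * y   ≈⟨ solve 3 (λ x z y → x :* z :* y := z :* (x :* y)) refl x (x ⁻¹) y ⟩
    x ⁻¹ * (x * y) ≈⟨ *-congˡ xy≈0 ⟩
    x ⁻¹ * 0#      ≈⟨ zeroʳ _ ⟩
    0#             ∎
    where open SetoidReasoning setoid

  x²≈0⇒x≈0 : ∀ {x} → x * x ≈ 0# → x ≈ 0#
  x²≈0⇒x≈0 {x} x²≈0 with x ≟ 0#
  ... | yes x≈0 = x≈0
  ... | no x≉0 = x*y≈0⇒y≈0 x≉0 x²≈0

  0<x² : ∀ {x} → ¬ (x ≈ 0#) → 0# < x * x
  0<x² x≉0 = 0≤x² _ , λ eq → x≉0 (x²≈0⇒x≈0 (sym eq))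

  *-pos : ∀ {x y} → 0# < x → 0# < y → 0# < x * y
  *-pos 0<x 0<y = *-nonneg (proj₁ 0<x) (proj₁ 0<y) ,
    λ eq → <⇒≉ 0<y (x*y≈0⇒y≈0 (<⇒≉ 0<x) (sym eq))

  *-pos-cancelˡ : ∀ {x y} → 0# < x → 0# < x * y → 0# < y
  *-pos-cancelˡ {x} {y} 0<x 0<xy = ≰⇒> λ y≤0 → <⇒≱ 0<xy
    (≤-by (*-nonneg (proj₁ 0<x) (x≤y⇒0≤y-x y≤0)) (solve 2 (λ x y → :0 :- x :* y := x :* (:0 :- y)) refl x y))

  *-monoˡ-≤ : ∀ {z x y} → 0# ≤ z → x ≤ y → z * x ≤ z * y
  *-monoˡ-≤ {z} {x} {y} 0≤z x≤y = ≤-by (*-nonneg 0≤z (x≤y⇒0≤y-x x≤y))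
    (solve 3 (λ x y z → z :* y :- z :* x := z :* (y :- x)) refl x y z)

  *-monoʳ-≤ : ∀ {z x y} → 0# ≤ z → x ≤ y → x * z ≤ y * z
  *-monoʳ-≤ {z} {x} {y} 0≤z x≤y = ≤-respˡ-≈ (*-comm z x) (≤-respʳ-≈ (*-comm z y) (*-monoˡ-≤ 0≤z x≤y))

  *-mono-≤ : ∀ {x y u v} → 0# ≤ x → 0# ≤ u → x ≤ y → u ≤ v → x * u ≤ y * v
  *-mono-≤ 0≤x 0≤u x≤y u≤v = ≤-trans (*-monoˡ-≤ 0≤x u≤v) (*-monoʳ-≤ (≤-trans 0≤u u≤v) x≤y)

  *-cancelˡ-≤ : ∀ {z x y} → 0# < z → z * x ≤ z * y → x ≤ y
  *-cancelˡ-≤ {z} {x} {y} 0<z zx≤zy with x ≤? y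
  ... | yes x≤y = x≤y
  ... | no x≰y = ⊥-elim (<⇒≱ (<-by (*-pos 0<z (x<y⇒0<y-x (≰⇒> x≰y)))
                   (solve 3 (λ x y z → z :* x :- z :* y := z :* (x :- y)) refl x y z)) zx≤zy)

  x⁻¹-pos : ∀ {x} → 0# < x → 0# < x ⁻¹
  x⁻¹-pos {x} 0<x = *-pos-cancelˡ 0<x (<-respʳ-≈ (sym (*-inverseʳ x (<⇒≉ 0<x))) 0<1)

  fromℕ-nonneg : ∀ n → 0# ≤ fromℕ n
  fromℕ-nonneg zero = ≤-refl
  fromℕ-nonneg (suc n) = +-nonneg (proj₁ 0<1) (fromℕ-nonneg n)

  fromℕ-mono-≤ : ∀ {m n} → m ℕ.≤ n → fromℕ m ≤ fromℕ n
  fromℕ-mono-≤ {n = n} z≤n = fromℕ-nonneg n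
  fromℕ-mono-≤ (s≤s m≤n) = +-monoʳ-≤ 1# (fromℕ-mono-≤ m≤n)

  fromℕ-cancel-≤ : ∀ {m n} → fromℕ m ≤ fromℕ n → m ℕ.≤ n
  fromℕ-cancel-≤ {m} {n} le with m ℕ.≤? n
  ... | yes m≤n = m≤n
  ... | no m≰n = ⊥-elim (<⇒≱ (+-pos-nonneg 0<1 ≤-refl) (≤-by (x≤y⇒0≤y-x (≤-trans (fromℕ-mono-≤ (ℕ.≰⇒> m≰n)) le))
            (solve 1 (λ x → :0 :- (:1 :+ :0) := x :- (:1 :+ x)) refl (fromℕ n))))

  fromℕ-* : ∀ m n → fromℕ (m ℕ.* n) ≈ fromℕ m * fromℕ n
  fromℕ-* = SemiringMult.×1-homo-* semiring

  -- Sums and products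

  open SemiringSum semiring using
    (sum-cong-≋; ∑-distrib-+; *-distribˡ-sum; *-distribʳ-sum; ∑-comm; sum-replicate-zero)

  sum-cong : ∀ {n} {f g : Vector ℝ n} → (∀ i → f i ≈ g i) → sum f ≈ sum g
  sum-cong {n} = sum-cong-≋ {n}

  sum-1 : ∀ n → sum {n} (λ _ → 1#) ≈ fromℕ n
  sum-1 zero = refl
  sum-1 (suc n) = +-congˡ (sum-1 n)

  sum-zero : ∀ {n} {f : Vector ℝ n} → (∀ i → f i ≈ 0#) → sum f ≈ 0#
  sum-zero {n} f≈0 = trans (sum-cong f≈0) (sum-replicate-zero n)

  sum-nonneg : ∀ {n} {f : Vector ℝ n} → (∀ i → 0# ≤ f i) → 0# ≤ sum f
  sum-nonneg {zero} _ = ≤-refl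
  sum-nonneg {suc n} 0≤f = +-nonneg (0≤f zero) (sum-nonneg (0≤f ∘ suc))

  sum-mono-≤ : ∀ {n} {f g : Vector ℝ n} → (∀ i → f i ≤ g i) → sum f ≤ sum g
  sum-mono-≤ {zero} _ = ≤-refl
  sum-mono-≤ {suc n} f≤g = +-mono-≤ (f≤g zero) (sum-mono-≤ (f≤g ∘ suc))

  sum-+-* : ∀ {n} (f g : Vector ℝ n) c → sum (λ i → f i + c * g i) ≈ sum f + c * sum g
  sum-+-* f g c = trans (∑-distrib-+ f (λ i → c * g i)) (+-congˡ (sym (*-distribˡ-sum c g)))

  sum-single : ∀ {n} {f : Vector ℝ n} k → (∀ i → i ≢ k → f i ≈ 0#) → sum f ≈ f k
  sum-single {f = f} zero f≈0 = trans (+-congˡ (sum-zero (λ i → f≈0 (suc i) λ ()))) (+-identityʳ (f zero))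
  sum-single {f = f} (suc k) f≈0 = trans (+-cong (f≈0 zero λ ())
    (sum-single {f = f ∘ suc} k (λ i i≢k → f≈0 (suc i) (i≢k ∘ Fin.suc-injective)))) (+-identityˡ _)

  term≤sum : ∀ {n} {f : Vector ℝ n} → (∀ i → 0# ≤ f i) → ∀ k → f k ≤ sum f
  term≤sum 0≤f zero = ≤-by (sum-nonneg (0≤f ∘ suc)) (solve 2 (λ a b → a :+ b :- a := b) refl _ _)
  term≤sum 0≤f (suc k) = ≤-trans (term≤sum (0≤f ∘ suc) k) (≤-by (0≤f zero) (solve 2 (λ a b → a :+ b :- b := a)
    refl _ _))

  sum≈0⇒term≈0 : ∀ {n} {f : Vector ℝ n} → (∀ i → 0# ≤ f i) → sum f ≤ 0# → ∀ k → f k ≈ 0#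
  sum≈0⇒term≈0 0≤f le k = antisym (≤-trans (term≤sum 0≤f k) le) (0≤f k)

  δ : ∀ {n} → Fin n → Fin n → ℝ
  δ i j = if does (i Fin.≟ j) then 1# else 0#

  δ-refl : ∀ {n} (i : Fin n) → δ i i ≈ 1#
  δ-refl i with i Fin.≟ i
  ... | yes _ = refl
  ... | no i≢i = ⊥-elim (i≢i ≡.refl)

  δ-≢ : ∀ {n} {i j : Fin n} → i ≢ j → δ i j ≈ 0#
  δ-≢ {i = i} {j} i≢j with i Fin.≟ j
  ... | yes i≡j = ⊥-elim (i≢j i≡j)
  ... | no _ = refl

  -- Scalar products, square matrices and quadratic forms

  infixl 7 _∙_
  _∙_ : ∀ {n} → Vector ℝ n → Vector ℝ n → ℝ
  a ∙ b = sum (λ i → a i * b i)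

  ∙-cong : ∀ {n} {a a′ b b′ : Vector ℝ n} → (∀ i → a i ≈ a′ i) → (∀ i → b i ≈ b′ i) → a ∙ b ≈ a′ ∙ b′
  ∙-cong a≈ b≈ = sum-cong (λ i → *-cong (a≈ i) (b≈ i))

  ∙-comm : ∀ {n} (a b : Vector ℝ n) → a ∙ b ≈ b ∙ a
  ∙-comm a b = sum-cong (λ i → *-comm (a i) (b i))

  ∙-+-*ʳ : ∀ {n} (a b c : Vector ℝ n) x → a ∙ (λ i → b i + x * c i) ≈ a ∙ b + x * (a ∙ c)
  ∙-+-*ʳ a b c x = trans
    (sum-cong (λ i → solve 4 (λ a b c x → a :* (b :+ x :* c) := a :* b :+ x :* (a :* c)) refl (a i) (b i) (c i) x))
    (sum-+-* (λ i → a i * b i) (λ i → a i * c i) x)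

  δ-∙ : ∀ {n} (k : Fin n) (z : Vector ℝ n) → δ k ∙ z ≈ z k
  δ-∙ k z = trans (sum-single k (λ i i≢k → trans (*-congʳ (δ-≢ (i≢k ∘ ≡.sym))) (zeroˡ _)))
                  (trans (*-congʳ (δ-refl k)) (*-identityˡ _))

  Square : ℕ → Set
  Square d = Vector (Vector ℝ d) d

  infixr 8 _$$_
  _$$_ : ∀ {d} → Square d → Vector ℝ d → Vector ℝ d
  (M $$ z) i = M i ∙ z

  Symmetric : ∀ {d} → Square d → Set
  Symmetric M = ∀ i j → M i j ≈ M j i

  quad : ∀ {d} → Square d → Vector ℝ d → ℝ
  quad M z = z ∙ (M $$ z)

  -- A matrix moves to the other factor of a scalar product as its transpose. The matrix is
  -- rectangular so that the lemma also applies to the family of vectors behind a Gram matrix.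
  sum-swap : ∀ {m n} (a : Vector ℝ m) (b : Vector ℝ n) (M : Fin m → Fin n → ℝ) →
    sum (λ i → a i * sum (λ j → M i j * b j)) ≈ sum (λ j → b j * sum (λ i → M i j * a i))
  sum-swap a b M = begin
    sum (λ i → a i * sum (λ j → M i j * b j))       ≈⟨ sum-cong (λ i → *-distribˡ-sum (a i) (λ j → M i j * b j)) ⟩
    sum (λ i → sum (λ j → a i * (M i j * b j)))     ≈⟨ ∑-comm (λ i j → a i * (M i j * b j)) ⟩
    sum (λ j → sum (λ i → a i * (M i j * b j)))     ≈⟨ sum-cong (λ j → sum-cong (λ i → solve 3 (λ a m b → a :*
      (m :* b) := b :* (m :* a)) refl (a i) (M i j) (b j))) ⟩
    sum (λ j → sum (λ i → b j * (M i j * a i)))     ≈⟨ sum-cong (λ j → *-distribˡ-sum (b j) (λ i → M i j * a i)) ⟨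
    sum (λ j → b j * sum (λ i → M i j * a i))       ∎
    where open SetoidReasoning setoid

  $$-symm : ∀ {d} {M : Square d} → Symmetric M → ∀ a b → a ∙ (M $$ b) ≈ b ∙ (M $$ a)
  $$-symm {M = M} symm a b = trans (sum-swap a b M) (sum-cong (λ j → *-congˡ (sum-cong (λ i → *-congʳ (symm i j)))))

  $$-cong : ∀ {d} (M : Square d) {a b : Vector ℝ d} → (∀ i → a i ≈ b i) → ∀ i → (M $$ a) i ≈ (M $$ b) i
  $$-cong M a≈b i = ∙-cong {a = M i} (λ _ → refl) a≈b

  ∏ : ∀ {d} → Vector ℝ d → ℝ
  ∏ {zero} _ = 1#
  ∏ {suc d} f = f zero * ∏ (f ∘ suc)

  ∏-nonneg : ∀ {d} {f : Vector ℝ d} → (∀ i → 0# ≤ f i) → 0# ≤ ∏ f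
  ∏-nonneg {zero} _ = proj₁ 0<1
  ∏-nonneg {suc d} 0≤f = *-nonneg (0≤f zero) (∏-nonneg (0≤f ∘ suc))

  ∏-pos : ∀ {d} {f : Vector ℝ d} → (∀ i → 0# < f i) → 0# < ∏ f
  ∏-pos {zero} _ = 0<1
  ∏-pos {suc d} 0<f = *-pos (0<f zero) (∏-pos (0<f ∘ suc))

  ∏-cong : ∀ {d} {f g : Vector ℝ d} → (∀ i → f i ≈ g i) → ∏ f ≈ ∏ g
  ∏-cong {zero} _ = refl
  ∏-cong {suc d} f≈g = *-cong (f≈g zero) (∏-cong (f≈g ∘ suc))

  ∏-scale : ∀ {d} x (f : Vector ℝ d) → ∏ (λ i → x * f i) ≈ x ^ d * ∏ f
  ∏-scale {zero} x f = sym (*-identityˡ 1#)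
  ∏-scale {suc d} x f = trans (*-congˡ (∏-scale x (f ∘ suc)))
    (solve 4 (λ x f p q → x :* f :* (p :* q) := x :* p :* (f :* q)) refl x (f zero) (x ^ d) _)

  ∏-change : ∀ {d} {f g : Vector ℝ d} k {x} → (∀ i → i ≢ k → g i ≈ f i) → g k ≈ x * f k → ∏ g ≈ x * ∏ f
  ∏-change {f = f} zero {x} same gk = trans (*-cong gk (∏-cong (λ i → same (suc i) λ ()))) (*-assoc x (f zero) _)
  ∏-change {f = f} (suc k) {x} same gk = trans
    (*-cong (same zero λ ()) (∏-change {f = f ∘ suc} k (λ i i≢k → same (suc i) (i≢k ∘ Fin.suc-injective)) gk))
    (solve 3 (λ a x p → a :* (x :* p) := x :* (a :* p)) refl (f zero) x _)

  -- Positive definite matrices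

  -- The Schur complement of the upper left entry of a symmetric matrix; row zero stands in for
  -- column zero.
  schur : ∀ {d} → Square (suc d) → Square d
  schur M i j = M (suc i) (suc j) - M zero (suc i) * M zero (suc j) * M zero zero ⁻¹

  -- All pivots of symmetric Gaussian elimination are positive, which for a symmetric matrix is
  -- positive definiteness. Accordingly `det` is the product of the pivots.
  PosDef : ∀ {d} → Square d → Set
  PosDef {zero}  M = ⊤
  PosDef {suc d} M = 0# < M zero zero × PosDef (schur M)

  det : ∀ {d} → Square d → ℝ
  det {zero}  M = 1#
  det {suc d} M = M zero zero * det (schur M)

  -- The right-hand side of a linear system after elimination of the first unknown.
  reduce : ∀ {d} → Square (suc d) → Vector ℝ (suc d) → Vector ℝ d
  reduce M a i = a (suc i) - a zero * M zero (suc i) * M zero zero ⁻¹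

  -- The value of the inverse quadratic form, a ∙ M⁻¹ a.
  invQuad : ∀ {d} → Square d → Vector ℝ d → ℝ
  invQuad {zero}  M a = 0#
  invQuad {suc d} M a = a zero * a zero * M zero zero ⁻¹ + invQuad (schur M) (reduce M a)

  det-pos : ∀ {d} {M : Square d} → PosDef M → 0# < det M
  det-pos {zero} _ = 0<1
  det-pos {suc d} (0<m , pd) = *-pos 0<m (det-pos pd)

  invQuad-nonneg : ∀ {d} {M : Square d} → PosDef M → ∀ a → 0# ≤ invQuad M a
  invQuad-nonneg {zero} _ a = ≤-refl
  invQuad-nonneg {suc d} {M} (0<m , pd) a =
    +-nonneg (*-nonneg (0≤x² (a zero)) (proj₁ (x⁻¹-pos 0<m))) (invQuad-nonneg pd (reduce M a))

  schur-symm : ∀ {d} {M : Square (suc d)} → Symmetric M → Symmetric (schur M)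
  schur-symm symm i j = +-cong (symm (suc i) (suc j)) (-‿cong (*-congʳ (*-comm _ _)))

  private
    -- The solver knows nothing of inverses. An identity that holds modulo `s ≈ 1#` and `t ≈ 1#` is
    -- made polynomial by the cofactors `A` and `B` of these two relations.
    eliminate : ∀ {x y s t} A B → s ≈ 1# → t ≈ 1# → x ≈ y + (1# - s) * A + (t - 1#) * B → x ≈ y
    eliminate {x} {y} {s} {t} A B s≈1 t≈1 eq = begin
      x                                      ≈⟨ eq ⟩
      y + (1# - s) * A + (t - 1#) * B        ≈⟨ +-cong (+-congˡ (*-congʳ (+-congˡ (-‿cong s≈1))))
        (*-congʳ (+-congʳ t≈1)) ⟩
      y + (1# - 1#) * A + (1# - 1#) * B      ≈⟨ solve 3 (λ y a b → y :+ (:1 :- :1) :* a :+ (:1 :- :1) :* b := y)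
        refl y A B ⟩
      y                                      ∎
      where open SetoidReasoning setoid

    -- For nonnegative `w` every term is nonnegative; for negative `w` leaving out `y` can only
    -- increase the value.
    pivot-pos : ∀ {w x y} → 0# ≤ x → 0# ≤ y → 0# < 1# + w * (x + y) → 0# < 1# + w * x
    pivot-pos {w} {x} {y} 0≤x 0≤y pos with total 0# w
    ... | inj₁ 0≤w = +-pos-nonneg 0<1 (*-nonneg 0≤w 0≤x)
    ... | inj₂ w≤0 = <-≤-trans pos (≤-by (*-nonneg (x≤y⇒0≤y-x w≤0) 0≤y)
      (solve 3 (λ w x y → :1 :+ w :* x :- (:1 :+ w :* (x :+ y)) := (:0 :- w) :* y) refl w x y))

  -- Elimination of the first coordinate turns a rank-one update of weight w
  -- into one of the Schur complement, of weight w m / m′.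
  rank-one : ∀ {d} {M M′ : Square d} w a → (∀ i j → M′ i j ≈ M i j + w * (a i * a j)) →
    PosDef M → 0# < 1# + w * invQuad M a → PosDef M′ × det M′ ≈ det M * (1# + w * invQuad M a)
  rank-one {zero} w a _ _ _ = tt , solve 1 (λ w → :1 := :1 :* (:1 :+ w :* :0)) refl w
  rank-one {suc d} {M} {M′} w a eq (0<m , pd) pos = (0<m′ , proj₁ rec) , det-eq
    where
    open SetoidReasoning setoid
    m = M zero zero
    m′ = M′ zero zero
    μ = m ⁻¹
    μ′ = m′ ⁻¹
    α = a zero
    w′ = w * m * μ′
    q = invQuad (schur M) (reduce M a)
    mμ≈1 : m * μ ≈ 1#
    mμ≈1 = *-inverseʳ m (<⇒≉ 0<m)
    m′≈ : m′ ≈ m + w * (α * α)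
    m′≈ = eq zero zero
    0<m′ : 0# < m′
    0<m′ = <-respʳ-≈
      (trans (eliminate {s = 1#} 0# (w * α * α) refl mμ≈1
                (solve 4 (λ m μ w α → m :* (:1 :+ w :* (α :* α :* μ)) :=
                  m :+ w :* (α :* α) :+ (:1 :- :1) :* :0 :+ (m :* μ :- :1) :* (w :* α :* α)) refl m μ w α))
             (sym m′≈))
      (*-pos 0<m (pivot-pos (*-nonneg (0≤x² α) (proj₁ (x⁻¹-pos 0<m))) (invQuad-nonneg pd (reduce M a)) pos))
    s≈1 : (m + w * (α * α)) * μ′ ≈ 1#
    s≈1 = trans (*-congʳ (sym m′≈)) (*-inverseʳ m′ (<⇒≉ 0<m′))
    schur-eq : ∀ i j → schur M′ i j ≈ schur M i j + w′ * (reduce M a i * reduce M a j)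
    schur-eq i j = trans
      (+-cong (eq (suc i) (suc j)) (-‿cong (*-congʳ (*-cong (eq zero (suc i)) (eq zero (suc j))))))
      (eliminate (w * b * e + p * r * μ) (w * μ′ * α * (b * r + p * e) + p * r * μ′ * (1# - w * μ * α * α)) s≈1 mμ≈1
        (solve 10 (λ n w b e p r m μ μ′ α →
          n :+ w :* (b :* e) :- (p :+ w :* (α :* b)) :* (r :+ w :* (α :* e)) :* μ′ :=
          n :- p :* r :* μ :+ w :* m :* μ′ :* ((b :- α :* p :* μ) :* (e :- α :* r :* μ))
          :+ (:1 :- (m :+ w :* (α :* α)) :* μ′) :* (w :* b :* e :+ p :* r :* μ)
          :+ (m :* μ :- :1) :* (w :* μ′ :* α :* (b :* r :+ p :* e) :+ p :* r :* μ′ :* (:1 :- w :* μ :* α :* α)))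
          refl (M (suc i) (suc j)) w b e p r m μ μ′ α))
      where
      b = a (suc i)
      e = a (suc j)
      p = M zero (suc i)
      r = M zero (suc j)
    -- This identity passes both the positivity hypothesis and the determinant formula on to the
    -- Schur complements.
    factor : m′ * (1# + w′ * q) ≈ m * (1# + w * (α * α * μ + q))
    factor = trans (*-congʳ m′≈) (eliminate (- (w * m * q)) (- (w * (α * α))) s≈1 mμ≈1
      (solve 6 (λ w m μ μ′ α q →
        (m :+ w :* (α :* α)) :* (:1 :+ w :* m :* μ′ :* q) :=
        m :* (:1 :+ w :* (α :* α :* μ :+ q))
        :+ (:1 :- (m :+ w :* (α :* α)) :* μ′) :* (:- (w :* m :* q))
        :+ (m :* μ :- :1) :* (:- (w :* (α :* α)))) refl w m μ μ′ α q))
    pos′ : 0# < 1# + w′ * q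
    pos′ = *-pos-cancelˡ 0<m′ (<-respʳ-≈ (sym factor) (*-pos 0<m pos))
    rec = rank-one w′ (reduce M a) schur-eq pd pos′
    det-eq : m′ * det (schur M′) ≈ m * det (schur M) * (1# + w * (α * α * μ + q))
    det-eq = begin
      m′ * det (schur M′)                        ≈⟨ *-congˡ (proj₂ rec) ⟩
      m′ * (det (schur M) * (1# + w′ * q))       ≈⟨ solve 3 (λ m d f → m :* (d :* f) := d :* (m :* f)) refl m′ _ _ ⟩
      det (schur M) * (m′ * (1# + w′ * q))       ≈⟨ *-congˡ factor ⟩
      det (schur M) * (m * (1# + w * (α * α * μ + q))) ≈⟨ solve 3 (λ m d f → d :* (m :* f) := m :* d :* f) refl
        m _ _ ⟩
      m * det (schur M) * (1# + w * (α * α * μ + q)) ∎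

  -- Stated for any matrix with the entries of `δ`, because the Schur complement of `δ` agrees with
  -- `δ` only entrywise.
  identity-posDef : ∀ {d} {M : Square d} → (∀ i j → M i j ≈ δ i j) → PosDef M × det M ≈ 1#
  identity-posDef {zero} _ = tt , refl
  identity-posDef {suc d} {M} eq = (<-respʳ-≈ (sym (eq zero zero)) 0<1 , proj₁ rec) ,
      trans (*-cong (eq zero zero) (proj₂ rec)) (*-identityˡ 1#)
    where
    rec = identity-posDef {M = schur M} λ i j → trans
      (+-cong (eq (suc i) (suc j)) (-‿cong (*-congʳ (*-cong (eq zero (suc i)) (eq zero (suc j))))))
      (solve 2 (λ x y → x :- :0 :* :0 :* y := x) refl (δ i j) (M zero zero ⁻¹))

  schur-$$ : ∀ {d} (M : Square (suc d)) y i →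
    (schur M $$ y) i ≈ (λ j → M (suc i) (suc j)) ∙ y + (- (M zero (suc i) * M zero zero ⁻¹)) * ((M zero ∘ suc) ∙ y)
  schur-$$ M y i = trans (sum-cong (λ j →
      solve 5 (λ n p r μ y → (n :- p :* r :* μ) :* y := n :* y :+ (:- (p :* μ)) :* (r :* y))
        refl (M (suc i) (suc j)) (M zero (suc i)) (M zero (suc j)) (M zero zero ⁻¹) (y j)))
    (sum-+-* (λ j → M (suc i) (suc j) * y j) (λ j → M zero (suc j) * y j) _)

  -- Identifies the recursive `invQuad` by means of any solution of `M z = a`. Elimination turns
  -- this system into one with matrix `schur M`, solution `z ∘ suc` and right-hand side
  -- `reduce M a`.
  invQuad-$$ : ∀ {d} {M : Square d} → Symmetric M → PosDef M → ∀ a z → (∀ i → a i ≈ (M $$ z) i) →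
    invQuad M a ≈ z ∙ a
  invQuad-$$ {zero} _ _ a z _ = refl
  invQuad-$$ {suc d} {M} symm (0<m , pd) a z eq = begin
    α * α * μ + invQuad (schur M) (reduce M a)     ≈⟨ +-congˡ (invQuad-$$ (schur-symm symm) pd (reduce M a) y
      reduce≈) ⟩
    α * α * μ + y ∙ reduce M a                     ≈⟨ +-congˡ y∙reduce ⟩
    α * α * μ + (y ∙ b + (- (α * μ)) * (y ∙ v))    ≈⟨ solve 4 (λ α μ yb yv → α :* α :* μ :+ (yb :+ (:- (α :* μ))
      :* yv) := α :* μ :* (α :- yv) :+ yb) refl α μ (y ∙ b) (y ∙ v) ⟩
    α * μ * (α - y ∙ v) + y ∙ b                    ≈⟨ +-congʳ (*-congˡ (+-congʳ α≈)) ⟩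
    α * μ * (m * ζ + y ∙ v - y ∙ v) + y ∙ b        ≈⟨ solve 6 (λ α μ m ζ yv yb → α :* μ :* (m :* ζ :+ yv :- yv)
      :+ yb := (m :* μ) :* (ζ :* α) :+ yb) refl α μ m ζ (y ∙ v) (y ∙ b) ⟩
    m * μ * (ζ * α) + y ∙ b                        ≈⟨ +-congʳ (trans (*-congʳ mμ≈1) (*-identityˡ _)) ⟩
    ζ * α + y ∙ b                                  ∎
    where
    open SetoidReasoning setoid
    m = M zero zero
    μ = m ⁻¹
    α = a zero
    ζ = z zero
    y = z ∘ suc
    b = a ∘ suc
    v = M zero ∘ suc
    mμ≈1 : m * μ ≈ 1#
    mμ≈1 = *-inverseʳ m (<⇒≉ 0<m)
    α≈ : α ≈ m * ζ + y ∙ v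
    α≈ = trans (eq zero) (+-congˡ (∙-comm v y))
    reduce≈ : ∀ i → reduce M a i ≈ (schur M $$ y) i
    reduce≈ i = begin
      a (suc i) - α * v i * μ
        ≈⟨ +-cong (trans (eq (suc i)) (+-congʳ (*-congʳ (symm (suc i) zero))))
          (-‿cong (*-congʳ (*-congʳ (eq zero)))) ⟩
      v i * ζ + N - (m * ζ + v ∙ y) * v i * μ
        ≈⟨ solve 6 (λ v ζ n m vy μ → v :* ζ :+ n :- (m :* ζ :+ vy) :* v :* μ :=
              v :* ζ :* (:1 :- m :* μ) :+ (n :+ (:- (v :* μ)) :* vy)) refl (v i) ζ N m (v ∙ y) μ ⟩
      v i * ζ * (1# - m * μ) + (N + (- (v i * μ)) * (v ∙ y))
        ≈⟨ +-congʳ (*-congˡ (+-congˡ (-‿cong mμ≈1))) ⟩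
      v i * ζ * (1# - 1#) + (N + (- (v i * μ)) * (v ∙ y))
        ≈⟨ solve 2 (λ x y → x :* (:1 :- :1) :+ y := y) refl (v i * ζ) _ ⟩
      N + (- (v i * μ)) * (v ∙ y) ≈⟨ schur-$$ M y i ⟨
      (schur M $$ y) i ∎
      where N = (λ j → M (suc i) (suc j)) ∙ y
    y∙reduce : y ∙ reduce M a ≈ y ∙ b + (- (α * μ)) * (y ∙ v)
    y∙reduce = trans (∙-cong {a = y} (λ _ → refl) (λ i →
        solve 4 (λ b α v μ → b :- α :* v :* μ := b :+ (:- (α :* μ)) :* v) refl (b i) α (v i) μ))
      (∙-+-*ʳ y b v _)

  -- Completing the square in the first coordinate: the difference of the two sides is `m` times a
  -- square.
  quad-schur : ∀ {d} {M : Square (suc d)} → Symmetric M → 0# < M zero zero → ∀ u →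
    quad (schur M) (u ∘ suc) ≤ quad M u
  quad-schur {M = M} symm 0<m u = ≤-by (*-nonneg (proj₁ 0<m) (0≤x² (ζ + vy * μ))) (begin
    quad M u - quad (schur M) y
      ≈⟨ +-cong (+-congˡ quad-tail) (-‿cong quad-schur≈) ⟩
    ζ * (m * ζ + vy) + (Nyy + ζ * vy) - (Nyy + (- μ) * (vy * vy))
      ≈⟨ solve 5 (λ ζ m vy n μ → ζ :* (m :* ζ :+ vy) :+ (n :+ ζ :* vy) :- (n :+ (:- μ) :* (vy :* vy)) :=
           m :* ((ζ :+ vy :* μ) :* (ζ :+ vy :* μ)) :+ (:1 :- m :* μ) :* (vy :* ζ :+ vy :* ζ :+ vy :* vy :* μ))
             refl ζ m vy Nyy μ ⟩
    m * ((ζ + vy * μ) * (ζ + vy * μ)) + (1# - m * μ) * (vy * ζ + vy * ζ + vy * vy * μ)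
      ≈⟨ +-congˡ (*-congʳ (trans (+-congˡ (-‿cong (*-inverseʳ m (<⇒≉ 0<m)))) (-‿inverseʳ 1#))) ⟩
    m * ((ζ + vy * μ) * (ζ + vy * μ)) + 0# * (vy * ζ + vy * ζ + vy * vy * μ)
      ≈⟨ solve 2 (λ x y → x :+ :0 :* y := x) refl _ _ ⟩
    m * ((ζ + vy * μ) * (ζ + vy * μ)) ∎)
    where
    open SetoidReasoning setoid
    m = M zero zero
    μ = m ⁻¹
    ζ = u zero
    y = u ∘ suc
    v = M zero ∘ suc
    vy = v ∙ y
    N : Square _
    N i j = M (suc i) (suc j)
    Nyy = quad N y
    quad-tail : sum (λ i → y i * (M (suc i) zero * ζ + N i ∙ y)) ≈ Nyy + ζ * vy
    quad-tail = trans (sum-cong (λ i → trans (*-congˡ (+-congʳ (*-congʳ (symm (suc i) zero))))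
        (solve 4 (λ y v ζ n → y :* (v :* ζ :+ n) := y :* n :+ ζ :* (v :* y)) refl (y i) (v i) ζ (N i ∙ y))))
      (sum-+-* (λ i → y i * (N i ∙ y)) (λ i → v i * y i) ζ)
    quad-schur≈ : quad (schur M) y ≈ Nyy + (- μ) * (vy * vy)
    quad-schur≈ = begin
      sum (λ i → y i * (schur M $$ y) i)
        ≈⟨ sum-cong (λ i → trans (*-congˡ (schur-$$ M y i))
             (solve 5 (λ y n v μ vy → y :* (n :+ (:- (v :* μ)) :* vy) := y :* n :+ (:- μ :* vy) :* (v :* y))
               refl (y i) (N i ∙ y) (v i) μ vy)) ⟩
      sum (λ i → y i * (N i ∙ y) + (- μ * vy) * (v i * y i))
        ≈⟨ sum-+-* (λ i → y i * (N i ∙ y)) (λ i → v i * y i) (- μ * vy) ⟩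
      Nyy + (- μ * vy) * vy    ≈⟨ +-congˡ (*-assoc (- μ) vy vy) ⟩
      Nyy + (- μ) * (vy * vy)  ∎

  -- Let `G` also denote the matrix with rows `G l`. It is unit lower triangular, so `G M Gᵀ` has
  -- the determinant of `M` and the diagonal entries `quad M (G l)`; this is Hadamard's inequality
  -- for it. The induction forms no product of matrices: `G zero` is the first unit vector, so
  -- `B zero` bounds the first pivot, and by `quad-schur` the other bounds survive in the Schur
  -- complement.
  hadamard : ∀ {d} {M : Square d} → Symmetric M → PosDef M → (G : Fin d → Vector ℝ d) (B : Vector ℝ d) →
    (∀ l → G l l ≈ 1#) → (∀ l j → l Fin.< j → G l j ≈ 0#) → (∀ l → quad M (G l) ≤ B l) → det M ≤ ∏ B
  hadamard {zero} _ _ _ _ _ _ _ = ≤-refl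
  hadamard {suc d} {M} symm (0<m , pd) G B diag tri le = *-mono-≤ (proj₁ 0<m) (proj₁ (det-pos pd))
    (≤-trans (≤-reflexive (sym quad₀)) (le zero))
    (hadamard (schur-symm symm) pd (λ l → G (suc l) ∘ suc) (B ∘ suc) (diag ∘ suc)
      (λ l j l<j → tri (suc l) (suc j) (s≤s l<j)) (λ l → ≤-trans (quad-schur symm 0<m (G (suc l))) (le (suc l))))
    where
    G₀≈ : ∀ i → G zero i ≈ δ zero i
    G₀≈ zero = diag zero
    G₀≈ (suc i) = tri zero (suc i) (s≤s z≤n)
    quad₀ : quad M (G zero) ≈ M zero zero
    quad₀ = trans (∙-cong {b = M $$ G zero} G₀≈ (λ _ → refl)) (trans (δ-∙ zero (M $$ G zero))
      (trans (∙-comm (M zero) (G zero)) (trans (∙-cong {b = M zero} G₀≈ (λ _ → refl)) (δ-∙ zero (M zero)))))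

  -- Gram matrices and leverage scores

  weight : Bool → ℝ
  weight b = if b then 1# else 0#

  weight-nonneg : ∀ b → 0# ≤ weight b
  weight-nonneg true = proj₁ 0<1
  weight-nonneg false = ≤-refl

  gram : ∀ {N d} → (Fin N → Vector ℝ d) → (Fin N → Bool) → Square d
  gram V χ i j = sum (λ k → weight (χ k) * (V k i * V k j))

  sum-change : ∀ {n} {f g : Vector ℝ n} k x → (∀ i → i ≢ k → g i ≈ f i) → g k ≈ f k + x → sum g ≈ sum f + x
  sum-change {f = f} {g} k x same gk = begin
    sum g                                  ≈⟨ sum-cong (λ i → solve 2 (λ a b → a := b :+ :1 :* (a :- b)) refl
      (g i) (f i)) ⟩
    sum (λ i → f i + 1# * (g i - f i))     ≈⟨ sum-+-* f (λ i → g i - f i) 1# ⟩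
    sum f + 1# * sum (λ i → g i - f i)     ≈⟨ +-congˡ (trans (*-identityˡ _) (trans (sum-single k λ i i≢k →
      trans (+-congʳ (same i i≢k)) (-‿inverseʳ _))
                                              (trans (+-congʳ gk) (solve 2 (λ a b → a :+ b :- a := b) refl (f k)
                                                x)))) ⟩
    sum f + x                              ∎
    where open SetoidReasoning setoid

  two-terms≤sum : ∀ {n} {f : Vector ℝ n} → (∀ i → 0# ≤ f i) → ∀ {j k} → j ≢ k → f j + f k ≤ sum f
  two-terms≤sum {f = f} 0≤f {j} {k} j≢k = ≤-trans (≤-reflexive (+-cong fj (sym (δ-∙ k f))))
     (≤-trans (+-monoˡ-≤ _ (term≤sum g≥0 j)) (≤-reflexive (trans (sym (∑-distrib-+ g (λ i → δ k i * f i)))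
       (sum-cong λ i → solve 2 (λ a b → a :- b :+ b := a) refl (f i) (δ k i * f i)))))
    where
    -- `f` with its `k`-th term replaced by zero.
    g : Vector ℝ _
    g i = f i - δ k i * f i
    fj : f j ≈ g j
    fj = trans (solve 1 (λ a → a := a :- :0 :* a) refl (f j)) (+-congˡ (-‿cong (*-congʳ (sym (δ-≢ (j≢k ∘ ≡.sym))))))
    g≥0 : ∀ i → 0# ≤ g i
    g≥0 i with k Fin.≟ i
    ... | yes _ = ≤-reflexive (solve 1 (λ a → :0 := a :- :1 :* a) refl (f i))
    ... | no _ = ≤-respʳ-≈ (solve 1 (λ a → a := a :- :0 :* a) refl (f i)) (0≤f i)

  -- The Sherman-Morrison formula: the inverse of `M + w v vᵀ`, where `W` is the symmetric inverse
  -- of `M`.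
  rankOne : ∀ {d} → Square d → ℝ → Vector ℝ d → Square d
  rankOne W w v i j = W i j - w * (1# + w * quad W v) ⁻¹ * ((W $$ v) i * (W $$ v) j)

  rankOne-$$ : ∀ {d} (W : Square d) w v z i →
    (rankOne W w v $$ z) i ≈ (W $$ z) i + (- (w * (1# + w * quad W v) ⁻¹ * ((W $$ v) ∙ z))) * (W $$ v) i
  rankOne-$$ W w v z i = trans
    (sum-cong λ j → solve 5 (λ a c p q z → (a :- c :* (p :* q)) :* z := a :* z :+ (:- (c :* p)) :* (q :* z))
      refl (W i j) c (u i) (u j) (z j))
    (trans (sum-+-* (λ j → W i j * z j) (λ j → u j * z j) _)
      (+-congˡ (solve 3 (λ c p x → (:- (c :* p)) :* x := (:- (c :* x)) :* p) refl c (u i) (u ∙ z))))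
    where
    u = W $$ v
    c = w * (1# + w * quad W v) ⁻¹

  -- The rule by which leverages are maintained: each of them changes by a multiple of the square of
  -- one scalar product with `W $$ v`.
  quad-rankOne : ∀ {d} (W : Square d) → Symmetric W → ∀ w v z → quad (rankOne W w v) z ≈
    quad W z - w * (1# + w * quad W v) ⁻¹ * ((z ∙ (W $$ v)) * (z ∙ (W $$ v)))
  quad-rankOne W symm w v z = begin
    z ∙ (rankOne W w v $$ z)                            ≈⟨ ∙-cong {a = z} (λ _ → refl) (rankOne-$$ W w v z) ⟩
    z ∙ (λ i → (W $$ z) i + (- (c * (u ∙ z))) * u i)    ≈⟨ ∙-+-*ʳ z (W $$ z) u _ ⟩
    quad W z + (- (c * (u ∙ z))) * (z ∙ u)              ≈⟨ +-congˡ (*-congʳ (-‿cong (*-congˡ (∙-comm u z)))) ⟩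
    quad W z + (- (c * (z ∙ u))) * (z ∙ u)              ≈⟨ solve 3 (λ q c x → q :+ (:- (c :* x)) :* x := q :- c
      :* (x :* x)) refl (quad W z) c (z ∙ u) ⟩
    quad W z - c * ((z ∙ u) * (z ∙ u))                  ∎
    where
    open SetoidReasoning setoid
    u = W $$ v
    c = w * (1# + w * quad W v) ⁻¹

  module _ {N d : ℕ} (V : Fin N → Vector ℝ d) where

    gram-symm : ∀ χ → Symmetric (gram V χ)
    gram-symm χ i j = sum-cong {N} (λ k → *-congˡ (*-comm (V k i) (V k j)))

    gram-$$ : ∀ χ z i → (gram V χ $$ z) i ≈ sum (λ k → V k i * (weight (χ k) * (V k ∙ z)))
    gram-$$ χ z i = begin
      sum (λ j → sum (λ k → weight (χ k) * (V k i * V k j)) * z j)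
        ≈⟨ sum-cong (λ j → trans (*-comm _ _) (*-congˡ (sum-cong {N} (λ k → solve 3 (λ w a b → w :* (a :* b)
          := b :* (w :* a)) refl (weight (χ k)) (V k i) (V k j))))) ⟩
      sum (λ j → z j * sum (λ k → V k j * (weight (χ k) * V k i)))
        ≈⟨ sum-swap z (λ k → weight (χ k) * V k i) (λ j k → V k j) ⟩
      sum (λ k → weight (χ k) * V k i * (V k ∙ z))
        ≈⟨ sum-cong (λ k → solve 3 (λ w a b → w :* a :* b := a :* (w :* b)) refl (weight (χ k)) (V k i) (V k ∙ z)) ⟩
      sum (λ k → V k i * (weight (χ k) * (V k ∙ z))) ∎
      where open SetoidReasoning setoid

    quad-gram : ∀ χ z → quad (gram V χ) z ≈ sum (λ k → weight (χ k) * ((V k ∙ z) * (V k ∙ z)))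
    quad-gram χ z = begin
      z ∙ (gram V χ $$ z)
        ≈⟨ ∙-cong {a = z} (λ _ → refl) (gram-$$ χ z) ⟩
      sum (λ i → z i * sum (λ k → V k i * (weight (χ k) * (V k ∙ z))))
        ≈⟨ sum-swap z (λ k → weight (χ k) * (V k ∙ z)) (λ i k → V k i) ⟩
      sum (λ k → weight (χ k) * (V k ∙ z) * (V k ∙ z))
        ≈⟨ sum-cong {N} (λ k → *-assoc (weight (χ k)) (V k ∙ z) (V k ∙ z)) ⟩
      sum (λ k → weight (χ k) * ((V k ∙ z) * (V k ∙ z))) ∎
      where open SetoidReasoning setoid

    gram-update : ∀ χ k b i j →
      gram V (updateAt χ k (const b)) i j ≈ gram V χ i j + (weight b - weight (χ k)) * (V k i * V k j)
    gram-update χ k b i j = sum-change k _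
      (λ l l≢k → *-congʳ (reflexive (≡.cong weight (updateAt-minimal l k χ l≢k))))
      (trans (*-congʳ (reflexive (≡.cong weight (updateAt-updates k χ))))
        (solve 3 (λ a b c → a :* c := b :* c :+ (a :- b) :* c) refl (weight b) (weight (χ k)) (V k i * V k j)))

    -- Since `W` and the Gram matrix are symmetric, a right inverse is two-sided. Positive
    -- definiteness is carried along for the determinant formula `rank-one`.
    record Inverse (χ : Fin N → Bool) (W : Square d) : Set where
      field
        symm    : Symmetric W
        inverse : ∀ z i → (gram V χ $$ (W $$ z)) i ≈ z i
        posDef  : PosDef (gram V χ)

      -- As `M W z = z`, the left side is the quadratic form of `M` at `W z`. The bound on
      -- leverages, orthogonality and the norm bound of the solution are all read off this sum of
      -- squares.
      quad≈sum : ∀ z → quad W z ≈ sum (λ k → weight (χ k) * ((V k ∙ (W $$ z)) * (V k ∙ (W $$ z))))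
      quad≈sum z = trans (∙-comm z (W $$ z)) (trans
        (∙-cong {a = W $$ z} (λ _ → refl) (λ i → sym (inverse z i))) (quad-gram χ (W $$ z)))

      private
        term-nonneg : ∀ z k → 0# ≤ weight (χ k) * ((V k ∙ (W $$ z)) * (V k ∙ (W $$ z)))
        term-nonneg z k = *-nonneg (weight-nonneg (χ k)) (0≤x² _)

      quad-nonneg : ∀ z → 0# ≤ quad W z
      quad-nonneg z = ≤-respʳ-≈ (sym (quad≈sum z)) (sum-nonneg (term-nonneg z))

      -- In `quad≈sum` at `V k`, the `k`-th term is the square of the leverage itself, so ℓ² ≤ ℓ.
      member-≤1 : ∀ {k} → χ k ≡ true → quad W (V k) ≤ 1#
      member-≤1 {k} χk with quad W (V k) ≤? 1#
      ... | yes ≤1 = ≤1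
      ... | no ≰1 = ⊥-elim (<⇒≱ (<-by (*-pos (≤-<-trans (proj₁ 0<1) (≰⇒> ≰1)) (x<y⇒0<y-x (≰⇒> ≰1)))
                      (solve 1 (λ x → x :* x :- x := x :* (x :- :1)) refl (quad W (V k))))
                    (≤-trans (≤-respˡ-≈ (trans (*-congʳ (reflexive (≡.cong weight χk))) (*-identityˡ _))
                      (term≤sum (term-nonneg (V k)) k))
                      (≤-reflexive (sym (quad≈sum (V k))))))

      -- If the leverage is 1, the `k`-th term of `quad≈sum` already exhausts the sum, and all
      -- others vanish.
      orthogonal : ∀ {j k} → χ j ≡ true → χ k ≡ true → j ≢ k → quad W (V k) ≈ 1# → V j ∙ (W $$ V k) ≈ 0#
      orthogonal {j} {k} χj χk j≢k eq = x²≈0⇒x≈0 (antisym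
        (≤-by (x≤y⇒0≤y-x (≤-trans (two-terms≤sum (term-nonneg (V k)) j≢k)
          (≤-reflexive (trans (sym (quad≈sum (V k))) eq))))
          (trans (solve 1 (λ x → :0 :- x := :1 :- (:1 :* x :+ :1 :* (:1 :* :1))) refl _)
            (+-congˡ (-‿cong (+-cong (*-congʳ (reflexive (≡.cong weight (≡.sym χj))))
              (*-cong (reflexive (≡.cong weight (≡.sym χk))) (*-cong (sym eq) (sym eq))))))))
        (0≤x² _))

      -- The left side is the trace of the product of the Gram matrix and its inverse.
      trace : sum (λ k → weight (χ k) * quad W (V k)) ≈ fromℕ d
      trace = begin
        sum (λ k → weight (χ k) * quad W (V k))
          ≈⟨ sum-cong {N} (λ k → *-distribˡ-sum (weight (χ k)) (λ i → V k i * (W i ∙ V k))) ⟩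
        sum (λ k → sum (λ i → weight (χ k) * (V k i * (W i ∙ V k))))
          ≈⟨ ∑-comm (λ k i → weight (χ k) * (V k i * (W i ∙ V k))) ⟩
        sum (λ i → sum (λ k → weight (χ k) * (V k i * (W i ∙ V k))))
          ≈⟨ sum-cong {d} (λ i → trans (sum-cong {N} (λ k →
               trans (solve 3 (λ w a b → w :* (a :* b) := a :* (w :* b)) refl (weight (χ k)) (V k i) (W i ∙ V k))
                     (*-congˡ (*-congˡ (∙-comm (W i) (V k))))))
               (trans (sym (gram-$$ χ (W i) i)) (diag i))) ⟩
        sum {d} (λ i → 1#)
          ≈⟨ sum-1 d ⟩
        fromℕ d ∎
        where
        open SetoidReasoning setoid
        -- By symmetry, row `i` of `W` is `W` applied to the `i`-th unit vector.
        diag : ∀ i → (gram V χ $$ W i) i ≈ 1#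
        diag i = trans ($$-cong (gram V χ) (λ j → trans (symm i j) (trans (sym (δ-∙ i (W j)))
          (∙-comm (δ i) (W j)))) i)
                   (trans (inverse (δ i) i) (δ-refl i))

      -- There are `d` members with leverages at most 1 that add up to `d`, so the total slack is
      -- zero.
      members-≈1 : sum (weight ∘ χ) ≈ fromℕ d → ∀ {k} → χ k ≡ true → quad W (V k) ≈ 1#
      members-≈1 card {k} χk = sym (begin
        1#                     ≈⟨ solve 1 (λ x → :1 := :1 :* (:1 :- x) :+ x) refl (quad W (V k)) ⟩
        1# * (1# - quad W (V k)) + quad W (V k)  ≈⟨ +-congʳ
          (trans (*-congʳ (reflexive (≡.cong weight (≡.sym χk)))) (sum≈0⇒term≈0 slack≥0 (≤-reflexive slack) k)) ⟩
        0# + quad W (V k)      ≈⟨ +-identityˡ _ ⟩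
        quad W (V k)           ∎)
        where
        open SetoidReasoning setoid
        slack≥0 : ∀ k → 0# ≤ weight (χ k) * (1# - quad W (V k))
        slack≥0 k with χ k in eq
        ... | true = *-nonneg (proj₁ 0<1) (x≤y⇒0≤y-x (member-≤1 eq))
        ... | false = ≤-reflexive (sym (zeroˡ _))
        slack : sum (λ k → weight (χ k) * (1# - quad W (V k))) ≈ 0#
        slack = begin
          sum (λ k → weight (χ k) * (1# - quad W (V k)))
            ≈⟨ sum-cong (λ k → solve 2 (λ w q → w :* (:1 :- q) := w :+ (:- :1) :* (w :* q)) refl (weight (χ k)) _) ⟩
          sum (λ k → weight (χ k) + (- 1#) * (weight (χ k) * quad W (V k)))
            ≈⟨ sum-+-* (weight ∘ χ) _ (- 1#) ⟩
          sum (weight ∘ χ) + (- 1#) * sum (λ k → weight (χ k) * quad W (V k))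
            ≈⟨ +-cong card (*-congˡ trace) ⟩
          fromℕ d + (- 1#) * fromℕ d
            ≈⟨ solve 1 (λ x → x :+ (:- :1) :* x := :0) refl (fromℕ d) ⟩
          0# ∎

    open Inverse

    -- Covers insertion (`w` is 1) and removal (`w` is -1). The weight, the vector and the new
    -- inverse are given only up to equality: the program computes -1 as 0 - 1, and `V k` is a case
    -- distinction that reduces to a row or a unit vector only propositionally.
    exchange : ∀ {χ W W′} k b {w v} → V k ≡ v → weight b - weight (χ k) ≈ w → Inverse χ W →
      0# < 1# + w * quad W v → (∀ i j → W′ i j ≈ rankOne W w v i j) →
      Inverse (updateAt χ k (const b)) W′
      × det (gram V (updateAt χ k (const b))) ≈ det (gram V χ) * (1# + w * quad W v)
    exchange {χ} {W} {W′} k b {w} {v} ≡.refl w≈ I pos W′≈ =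
      record { symm = symm′ ; inverse = inverse′ ; posDef = proj₁ updated } ,
      trans (proj₂ updated) (*-congˡ (+-congˡ (*-congˡ invQuad≈)))
      where
      open SetoidReasoning setoid
      M = gram V χ
      M′ = gram V (updateAt χ k (const b))
      u = W $$ v
      c = w * (1# + w * quad W v) ⁻¹
      gram-update′ : ∀ i j → M′ i j ≈ M i j + w * (v i * v j)
      gram-update′ i j = trans (gram-update χ k b i j) (+-congˡ (*-congʳ w≈))
      invQuad≈ : invQuad M v ≈ quad W v
      invQuad≈ = trans (invQuad-$$ (gram-symm χ) (posDef I) v u (λ i → sym (inverse I v i))) (∙-comm u v)
      updated = rank-one w v gram-update′ (posDef I) (<-respʳ-≈ (+-congˡ (*-congˡ (sym invQuad≈))) pos)
      symm′ : Symmetric W′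
      symm′ i j = trans (W′≈ i j) (trans (+-cong (symm I i j) (-‿cong (*-congˡ (*-comm _ _)))) (sym (W′≈ j i)))
      M′-$$ : ∀ y i → (M′ $$ y) i ≈ (M $$ y) i + (w * v i) * (v ∙ y)
      M′-$$ y i = trans (sum-cong λ j → trans (*-congʳ (gram-update′ i j))
          (solve 5 (λ m w a b y → (m :+ w :* (a :* b)) :* y := m :* y :+ w :* a :* (b :* y)) refl (M i j) w
            (v i) (v j) (y j)))
        (sum-+-* (λ j → M i j * y j) (λ j → v j * y j) _)
      inverse′ : ∀ z i → (M′ $$ (W′ $$ z)) i ≈ z i
      inverse′ z i = begin
        (M′ $$ (W′ $$ z)) i
          ≈⟨ $$-cong M′ (λ j → trans (∙-cong {b = z} (W′≈ j) (λ _ → refl)) (rankOne-$$ W w v z j)) i ⟩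
        (M′ $$ y) i
          ≈⟨ M′-$$ y i ⟩
        (M $$ y) i + (w * v i) * (v ∙ y)
          ≈⟨ +-cong (∙-+-*ʳ (M i) (W $$ z) u _) (*-congˡ (∙-+-*ʳ v (W $$ z) u _)) ⟩
        (M $$ (W $$ z)) i + (- (c * (u ∙ z))) * (M $$ u) i + (w * v i) * (v ∙ (W $$ z) + (- (c * (u ∙ z))) *
          (v ∙ u))
          ≈⟨ +-cong (+-cong (inverse I z i) (*-congˡ (inverse I v i)))
                    (*-congˡ (+-congʳ (trans ($$-symm {M = W} (symm I) v z) (∙-comm z u)))) ⟩
        z i + (- (c * (u ∙ z))) * v i + (w * v i) * (u ∙ z + (- (c * (u ∙ z))) * (v ∙ u))
          ≈⟨ solve 6 (λ z w g s v q → z :+ (:- (w :* g :* s)) :* v :+ w :* v :* (s :+ (:- (w :* g :* s)) :* q)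
               := z :+ w :* s :* v :* (:1 :- (:1 :+ w :* q) :* g)) refl (z i) w _ (u ∙ z) (v i) (quad W v) ⟩
        z i + w * (u ∙ z) * v i * (1# - (1# + w * quad W v) * (1# + w * quad W v) ⁻¹)
          ≈⟨ +-congˡ (*-congˡ (+-congˡ (-‿cong (*-inverseʳ _ (<⇒≉ pos))))) ⟩
        z i + w * (u ∙ z) * v i * (1# - 1#)
          ≈⟨ solve 2 (λ z x → z :+ x :* (:1 :- :1) := z) refl (z i) _ ⟩
        z i ∎
        where
        y : Vector ℝ d
        y j = (W $$ z) j + (- (c * (u ∙ z))) * u j

  -- The two phases of the exchange algorithm

  -- Written exactly as the program evaluates it, a division of 1 by (1 + 1) + (1 + 1).
  ¼ : ℝ
  ¼ = 1# * (1# + 1# + (1# + 1#)) ⁻¹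

  0<4 : 0# < 1# + 1# + (1# + 1#)
  0<4 = +-pos-nonneg (+-pos-nonneg 0<1 (proj₁ 0<1)) (+-nonneg (proj₁ 0<1) (proj₁ 0<1))

  4*¼≈1 : (1# + 1# + (1# + 1#)) * ¼ ≈ 1#
  4*¼≈1 = trans (*-congˡ (*-identityˡ _)) (*-inverseʳ _ (<⇒≉ 0<4))

  0<¼ : 0# < ¼
  0<¼ = *-pos 0<1 (x⁻¹-pos 0<4)

  -- 3/2 as 2 (1 - 1/4): inserting a row of leverage above 1 more than doubles the determinant, and
  -- removing one of leverage at most 1/4 keeps at least three quarters of it.
  ρ : ℝ
  ρ = 1# + (¼ + ¼)

  0≤ρ : 0# ≤ ρ
  0≤ρ = +-nonneg (proj₁ 0<1) (+-nonneg (proj₁ 0<¼) (proj₁ 0<¼))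

  ρ^-nonneg : ∀ j → 0# ≤ ρ ^ j
  ρ^-nonneg zero = proj₁ 0<1
  ρ^-nonneg (suc j) = *-nonneg 0≤ρ (ρ^-nonneg j)

  -- Two rounds double the determinant, so that rounds can be counted by powers of two.
  2≤ρ² : 1# + 1# ≤ ρ * ρ
  2≤ρ² = ≤-by (0≤x² (¼ + ¼)) (trans
    (solve 1 (λ q → (:1 :+ (q :+ q)) :* (:1 :+ (q :+ q)) :- (:1 :+ :1) :=
       (q :+ q) :* (q :+ q) :+ (:4 :* q :- :1)) refl ¼)
    (trans (+-congˡ (trans (+-congʳ 4*¼≈1) (-‿inverseʳ 1#))) (+-identityʳ _)))

  quad-cong : ∀ {d} {W W′ : Square d} → (∀ i j → W i j ≈ W′ i j) → ∀ z → quad W z ≈ quad W′ z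
  quad-cong W≈ z = ∙-cong {a = z} (λ _ → refl) (λ i → ∙-cong {b = z} (W≈ i) (λ _ → refl))

  sum-split : ∀ n {d} (f : Fin (n ℕ.+ d) → ℝ) → sum f ≈ sum (λ r → f (r ↑ˡ d)) + sum (λ l → f (n ↑ʳ l))
  sum-split zero f = sym (+-identityˡ _)
  sum-split (suc n) f = trans (+-congˡ (sum-split n (f ∘ suc))) (sym (+-assoc _ _ _))

  module Stages {n d : ℕ} (A : Fin n → Vector ℝ d) where

    row : Fin n → Fin (n ℕ.+ d)
    row r = r ↑ˡ d

    unit : Fin d → Fin (n ℕ.+ d)
    unit l = n ↑ʳ l

    V : Fin (n ℕ.+ d) → Vector ℝ d
    V k = [ A , δ ]′ (splitAt n k)

    V-row : ∀ r → V (row r) ≡ A r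
    V-row r = ≡.cong [ A , δ ]′ (Fin.splitAt-↑ˡ n r d)

    V-unit : ∀ l → V (unit l) ≡ δ l
    V-unit l = ≡.cong [ A , δ ]′ (Fin.splitAt-↑ʳ n d l)

    row≢unit : ∀ {r l} → row r ≢ unit l
    row≢unit {r} {l} eq = ℕ.<⇒≱ (Fin.toℕ<n r) (ℕ.≤-trans (ℕ.m≤m+n n (toℕ l)) (ℕ.≤-reflexive
      (≡.trans (≡.sym (Fin.toℕ-↑ʳ n l)) (≡.trans (≡.cong toℕ (≡.sym eq)) (Fin.toℕ-↑ˡ r d)))))

    row-injective : ∀ {r r′} → row r ≡ row r′ → r ≡ r′
    row-injective = Fin.↑ˡ-injective d _ _

    unit-injective : ∀ {l l′} → unit l ≡ unit l′ → l ≡ l′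
    unit-injective = Fin.↑ʳ-injective n _ _

    -- G l is the functional by which the l-th pivot was chosen, and π l the
    -- square of its largest value on a row (1 if it vanishes on all rows, in
    -- which case the l-th unit vector is never removed).
    record Pivots (χ : Fin (n ℕ.+ d) → Bool) (K : ℕ) (G : Fin d → Vector ℝ d) (π : Vector ℝ d) : Set where
      field
        diagonal : ∀ {l} → toℕ l ℕ.< K → G l l ≈ 1#
        above    : ∀ {l j} → toℕ l ℕ.< K → l Fin.< j → G l j ≈ 0#
        units    : ∀ {l j} → toℕ l ℕ.< K → χ (unit j) ≡ true → j ≢ l → G l j ≈ 0#
        bounded  : ∀ {l} → toℕ l ℕ.< K → ∀ r → (A r ∙ G l) * (A r ∙ G l) ≤ π l
        dead     : ∀ {l} → toℕ l ℕ.< K → χ (unit l) ≡ true → π l ≈ 1# × (∀ r → A r ∙ G l ≈ 0#)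
        positive : ∀ l → 0# < π l
        -- Indices not yet reached contribute the factor 1, so `∏ π` can equal the determinant
        -- throughout the first phase.
        future   : ∀ {l} → K ℕ.≤ toℕ l → π l ≈ 1# × χ (unit l) ≡ true

    open Inverse

    -- By `card` there are as many vectors as dimensions; with invertibility they form a basis, and
    -- `members-≈1` applies.
    record Initial (K : ℕ) (χ : Fin (n ℕ.+ d) → Bool) (W : Square d) : Set where
      field
        inv    : Inverse V χ W
        card   : sum (weight ∘ χ) ≈ fromℕ d
        G      : Fin d → Vector ℝ d
        π      : Vector ℝ d
        pivots : Pivots χ K G π
        det≈   : det (gram V χ) ≈ ∏ π

    χ₀ : Fin (n ℕ.+ d) → Bool
    χ₀ k = [ const false , const true ]′ (splitAt n k)

    χ₀-row : ∀ r → χ₀ (row r) ≡ false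
    χ₀-row r = ≡.cong [ const false , const true ]′ (Fin.splitAt-↑ˡ n r d)

    χ₀-unit : ∀ l → χ₀ (unit l) ≡ true
    χ₀-unit l = ≡.cong [ const false , const true ]′ (Fin.splitAt-↑ʳ n d l)

    private
      ≡true×≡false : ∀ {b} → b ≡ true → b ≡ false → ⊥
      ≡true×≡false ≡.refl ()

      w-cong : ∀ {b c} → b ≡ c → weight b ≈ weight c
      w-cong eq = reflexive (≡.cong weight eq)

      gram₀ : ∀ i j → gram V χ₀ i j ≈ δ i j
      gram₀ i j = begin
        gram V χ₀ i j
          ≈⟨ sum-split n (λ k → weight (χ₀ k) * (V k i * V k j)) ⟩
        sum (λ r → weight (χ₀ (row r)) * (V (row r) i * V (row r) j)) + sum (λ l → weight (χ₀ (unit l)) *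
          (V (unit l) i * V (unit l) j))
          ≈⟨ +-cong (sum-zero {n} λ r → trans (*-congʳ (w-cong (χ₀-row r))) (zeroˡ _))
                    (sum-cong {d} λ l → trans (*-cong (w-cong (χ₀-unit l)) (reflexive (≡.cong (λ v → v i * v j)
                      (V-unit l)))) (*-identityˡ _)) ⟩
        0# + sum (λ l → δ l i * δ l j)
          ≈⟨ +-identityˡ _ ⟩
        sum (λ l → δ l i * δ l j)
          ≈⟨ sum-single i (λ l l≢i → trans (*-congʳ (δ-≢ l≢i)) (zeroˡ _)) ⟩
        δ i i * δ i j
          ≈⟨ trans (*-congʳ (δ-refl i)) (*-identityˡ _) ⟩
        δ i j ∎
        where open SetoidReasoning setoid

    δ-sym : ∀ {d} (i j : Fin d) → δ i j ≈ δ j i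
    δ-sym i j with i Fin.≟ j
    ... | yes ≡.refl = sym (δ-refl i)
    ... | no i≢j = sym (δ-≢ (i≢j ∘ ≡.sym))

    initial : ∀ {W} → (∀ i j → W i j ≈ δ i j) → Initial 0 χ₀ W
    initial {W} W≈ = record
      { inv = record
          { symm = λ i j → trans (W≈ i j) (trans (δ-sym i j) (sym (W≈ j i)))
          ; inverse = λ z i → trans ($$-cong (gram V χ₀) (λ j → trans (∙-cong {b = z} (W≈ j) (λ _ → refl))
            (δ-∙ j z)) i)
                        (trans (∙-cong {b = z} (gram₀ i) (λ _ → refl)) (δ-∙ i z))
          ; posDef = proj₁ id-facts }
      ; card = trans (sum-split n (weight ∘ χ₀)) (trans (+-cong (sum-zero {n} (λ r → w-cong (χ₀-row r)))
        (sum-cong {d} (λ l → w-cong (χ₀-unit l))))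
                 (trans (+-identityˡ _) (sum-1 d)))
      ; G = δ
      ; π = const 1#
      ; pivots = record { diagonal = λ () ; above = λ () ; units = λ () ; bounded = λ () ; dead = λ ()
                        ; positive = λ _ → 0<1 ; future = λ {l} _ → refl , χ₀-unit l }
      ; det≈ = trans (proj₂ id-facts) (sym (∏-one d)) }
      where
      id-facts = identity-posDef gram₀
      ∏-one : ∀ d → ∏ {d} (const 1#) ≈ 1#
      ∏-one zero = refl
      ∏-one (suc d) = trans (*-identityˡ _) (∏-one d)

    module _ {χ : Fin (n ℕ.+ d) → Bool} {W : Square d} (k : Fin d) (I : Initial (toℕ k) χ W) where
      open Initial I
      open Pivots pivots

      private
        g = W $$ δ k

        χk : χ (unit k) ≡ true
        χk = proj₂ (future ℕ.≤-refl)

        one : quad W (V (unit k)) ≈ 1#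
        one = members-≈1 inv card χk

        one′ : quad W (δ k) ≈ 1#
        one′ = trans (reflexive (≡.cong (quad W) (≡.sym (V-unit k)))) one

        orth : ∀ {j} → χ j ≡ true → j ≢ unit k → V j ∙ g ≈ 0#
        orth {j} χj j≢k = trans (reflexive (≡.cong (λ v → V j ∙ (W $$ v)) (≡.sym (V-unit k)))) (orthogonal inv
          χj χk j≢k one)

        g-k : g k ≈ 1#
        g-k = trans (sym (δ-∙ k g)) one′

        g-unit : ∀ {j} → χ (unit j) ≡ true → j ≢ k → g j ≈ 0#
        g-unit {j} χj j≢k = trans (sym (δ-∙ j g)) (trans (reflexive (≡.cong (_∙ g) (≡.sym (V-unit j))))
          (orth χj (j≢k ∘ unit-injective)))

        G′ : Fin d → Vector ℝ d
        G′ = updateAt G k (const g)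

        <-cases : ∀ {l} {P : Set} → toℕ l ℕ.< suc (toℕ k) → (toℕ l ℕ.< toℕ k → l ≢ k → P) → (l ≡ k → P) → P
        <-cases {l} lt f h with l Fin.≟ k
        ... | yes l≡k = h l≡k
        ... | no l≢k = f (ℕ.≤∧≢⇒< (ℕ.≤-pred lt) (l≢k ∘ Fin.toℕ-injective)) l≢k

        pivots′ : ∀ {χ′ π′} → (∀ {j} → χ′ (unit j) ≡ true → χ (unit j) ≡ true) →
          (∀ {j} → j ≢ k → χ′ (unit j) ≡ χ (unit j)) → (∀ {l} → l ≢ k → π′ l ≈ π l) → 0# < π′ k →
          (∀ r → (A r ∙ g) * (A r ∙ g) ≤ π′ k) → (χ′ (unit k) ≡ true → π′ k ≈ 1# × (∀ r → A r ∙ g ≈ 0#)) →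
          Pivots χ′ (suc (toℕ k)) G′ π′
        pivots′ {χ′} {π′} mono same same-π pos bnd ded = record
          { diagonal = λ {l} lt → <-cases lt
              (λ lt′ l≢k → trans (reflexive (≡.cong (λ v → v l) (old l≢k))) (diagonal lt′))
              (λ { ≡.refl → trans (reflexive (≡.cong (λ v → v k) new)) g-k })
          -- The unit vectors beyond `k` are all still present, and `g` vanishes on them. This is
          -- where the triangular shape comes from.
          ; above = λ {l} {j} lt l<j → <-cases lt
              (λ lt′ l≢k → trans (reflexive (≡.cong (λ v → v j) (old l≢k))) (above lt′ l<j))
              (λ { ≡.refl → trans (reflexive (≡.cong (λ v → v j) new))
                     (g-unit (proj₂ (future (ℕ.<⇒≤ l<j))) (λ { ≡.refl → ℕ.<-irrefl ≡.refl l<j })) })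
          ; units = λ {l} {j} lt χj j≢l → <-cases lt
              (λ lt′ l≢k → trans (reflexive (≡.cong (λ v → v j) (old l≢k))) (units lt′ (mono χj) j≢l))
              (λ { ≡.refl → trans (reflexive (≡.cong (λ v → v j) new)) (g-unit (mono χj) j≢l) })
          ; bounded = λ {l} lt r → <-cases lt
              (λ lt′ l≢k → ≤-trans (≤-reflexive (reflexive (≡.cong (λ v → (A r ∙ v) * (A r ∙ v)) (old l≢k))))
                 (≤-trans (bounded lt′ r) (≤-reflexive (sym (same-π l≢k)))))
              (λ { ≡.refl → ≤-trans (≤-reflexive (reflexive (≡.cong (λ v → (A r ∙ v) * (A r ∙ v)) new))) (bnd r) })
          ; dead = λ {l} lt χl → <-cases lt
              (λ lt′ l≢k → trans (same-π l≢k) (proj₁ (dead lt′ (mono χl))) ,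
                λ r → trans (reflexive (≡.cong (A r ∙_) (old l≢k))) (proj₂ (dead lt′ (mono χl)) r))
              (λ { ≡.refl → proj₁ (ded χl) , λ r → trans (reflexive (≡.cong (A r ∙_) new)) (proj₂ (ded χl) r) })
          ; positive = pos′
          ; future = λ {l} le → let l≢k = λ { ≡.refl → ℕ.<-irrefl ≡.refl le } in
              trans (same-π l≢k) (proj₁ (future (ℕ.<⇒≤ le))) , ≡.trans (same l≢k) (proj₂ (future (ℕ.<⇒≤ le)))
          }
          where
          old : ∀ {l} → l ≢ k → G′ l ≡ G l
          old {l} l≢k = updateAt-minimal l k G l≢k
          new : G′ k ≡ g
          new = updateAt-updates k G
          pos′ : ∀ l → 0# < π′ l
          pos′ l with l Fin.≟ k
          ... | yes ≡.refl = pos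
          ... | no l≢k = <-respʳ-≈ (sym (same-π l≢k)) (positive l)

      skip-unit : (∀ r → A r ∙ g ≈ 0#) → Initial (suc (toℕ k)) χ W
      skip-unit zeros = record
        { inv = inv ; card = card ; G = G′ ; π = π ; det≈ = det≈
        ; pivots = pivots′ (λ χj → χj) (λ _ → ≡.refl) (λ _ → refl) (positive k)
            (λ r → ≤-trans (≤-reflexive (trans (*-congʳ (zeros r)) (zeroˡ _))) (proj₁ (positive k)))
            (λ _ → proj₁ (future ℕ.≤-refl) , zeros) }

      module _ {W₁ W₂ : Square d} {w : ℝ} (r : Fin n) (nonzero : ¬ (A r ∙ g ≈ 0#))
               (largest : ∀ r′ → (A r′ ∙ g) * (A r′ ∙ g) ≤ (A r ∙ g) * (A r ∙ g)) where

        private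
          t = A r ∙ g
          λᵣ = quad W (A r)
          χ₁ = updateAt χ (row r) (const true)
          χ₂ = updateAt χ₁ (unit k) (const false)
          π′ = updateAt π k (const (t * t))

        -- `g` vanishes on every row that is present.
        fresh : χ (row r) ≡ false
        fresh with χ (row r) in eq
        ... | false = ≡.refl
        ... | true = ⊥-elim (nonzero (trans (reflexive (≡.cong (_∙ g) (≡.sym (V-row r)))) (orth eq row≢unit)))

        swap-unit : (∀ i j → W₁ i j ≈ rankOne W 1# (A r) i j) → w ≈ - 1# →
          (∀ i j → W₂ i j ≈ rankOne W₁ w (δ k) i j) → Initial (suc (toℕ k)) χ₂ W₂
        swap-unit W₁≈ w≈ W₂≈ = record
          { inv = proj₁ ex₂
          ; card = card₂
          ; G = G′
          ; π = π′
          ; pivots = pivots′ mono same (λ l≢k → reflexive (updateAt-minimal _ k π l≢k))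
              (<-respʳ-≈ (sym π′k) (0<x² nonzero))
              (λ r′ → ≤-trans (largest r′) (≤-reflexive (sym π′k)))
              (λ χk → ⊥-elim (≡true×≡false χk χ₂k))
          ; det≈ = begin
              det (gram V χ₂)                          ≈⟨ proj₂ ex₂ ⟩
              det (gram V χ₁) * (1# + w * quad W₁ (δ k)) ≈⟨ *-cong (proj₂ ex₁) gap ⟩
              det (gram V χ) * s * (s ⁻¹ * (t * t))    ≈⟨ solve 4 (λ d s i t → d :* s :* (i :* t) := s :* i :*
                (t :* d)) refl (det (gram V χ)) s (s ⁻¹) (t * t) ⟩
              s * s ⁻¹ * (t * t * det (gram V χ))      ≈⟨ *-congʳ (*-inverseʳ s (<⇒≉ s-pos)) ⟩
              1# * (t * t * det (gram V χ))            ≈⟨ *-identityˡ _ ⟩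
              t * t * det (gram V χ)                   ≈⟨ *-congˡ det≈ ⟩
              t * t * ∏ π                              ≈⟨ ∏-change k (λ i i≢k → reflexive (updateAt-minimal i k
                π i≢k))
                                                          (trans π′k (trans (sym (*-identityʳ _))
                                                            (*-congˡ (sym (proj₁ (future ℕ.≤-refl)))))) ⟨
              ∏ π′                                     ∎
          }
          where
          open SetoidReasoning setoid
          s = 1# + 1# * λᵣ
          s-pos : 0# < s
          s-pos = +-pos-nonneg 0<1 (*-nonneg (proj₁ 0<1) (quad-nonneg inv (A r)))
          ex₁ = exchange V (row r) true (V-row r) (trans (+-congˡ (-‿cong (w-cong fresh)))
            (solve 0 (:1 :- :0 := :1) refl)) inv s-pos W₁≈
          χ₁k : χ₁ (unit k) ≡ true
          χ₁k = ≡.trans (updateAt-minimal (unit k) (row r) χ (row≢unit ∘ ≡.sym)) χk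
          χ₂k : χ₂ (unit k) ≡ false
          χ₂k = updateAt-updates (unit k) χ₁
          -- The leverage of `δ k` drops from 1 to 1 - t²/s when the row is inserted. So its removal
          -- contributes t²/s, and with the factor s of the insertion the determinant gains exactly
          -- t², the new value of `π k`.
          gap : 1# + w * quad W₁ (δ k) ≈ s ⁻¹ * (t * t)
          gap = begin
            1# + w * quad W₁ (δ k)
              ≈⟨ +-congˡ (*-cong w≈ (trans (quad-cong W₁≈ (δ k)) (quad-rankOne W (symm inv) 1# (A r) (δ k)))) ⟩
            1# + (- 1#) * (quad W (δ k) - 1# * s ⁻¹ * ((δ k ∙ (W $$ A r)) * (δ k ∙ (W $$ A r))))
              ≈⟨ +-congˡ (*-congˡ (+-cong one′ (-‿cong (*-congˡ (*-cong entry entry))))) ⟩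
            1# + (- 1#) * (1# - 1# * s ⁻¹ * (t * t))
              ≈⟨ solve 2 (λ i t → :1 :+ (:- :1) :* (:1 :- :1 :* i :* t) := i :* t) refl (s ⁻¹) (t * t) ⟩
            s ⁻¹ * (t * t) ∎
            where
            entry : δ k ∙ (W $$ A r) ≈ t
            entry = $$-symm {M = W} (symm inv) (δ k) (A r)
          ex₂ = exchange V (unit k) false (V-unit k) (trans (+-congˡ (-‿cong (w-cong χ₁k)))
            (trans (solve 0 (:0 :- :1 := :- :1) refl) (sym w≈))) (proj₁ ex₁)
                  (<-respʳ-≈ (sym gap) (*-pos (x⁻¹-pos s-pos) (0<x² nonzero))) W₂≈
          π′k : π′ k ≈ t * t
          π′k = reflexive (updateAt-updates k π)
          same : ∀ {j} → j ≢ k → χ₂ (unit j) ≡ χ (unit j)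
          same {j} j≢k = ≡.trans (updateAt-minimal (unit j) (unit k) χ₁ (j≢k ∘ unit-injective))
            (updateAt-minimal (unit j) (row r) χ (row≢unit ∘ ≡.sym))
          mono : ∀ {j} → χ₂ (unit j) ≡ true → χ (unit j) ≡ true
          mono {j} χj with j Fin.≟ k
          ... | yes ≡.refl = χk
          ... | no j≢k = ≡.trans (≡.sym (same j≢k)) χj
          card₂ : sum (weight ∘ χ₂) ≈ fromℕ d
          card₂ = begin
            sum (weight ∘ χ₂)
              ≈⟨ sum-change (unit k) (- 1#) (λ i i≢ → w-cong (updateAt-minimal i (unit k) χ₁ i≢))
                   (trans (w-cong χ₂k) (trans (solve 0 (:0 := :1 :- :1) refl) (+-congʳ (w-cong (≡.sym χ₁k))))) ⟩
            sum (weight ∘ χ₁) + - 1#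
              ≈⟨ +-congʳ (sum-change (row r) 1# (λ i i≢ → w-cong (updateAt-minimal i (row r) χ i≢))
                   (trans (w-cong (updateAt-updates (row r) χ)) (trans (sym (+-identityˡ 1#))
                     (+-congʳ (w-cong (≡.sym fresh)))))) ⟩
            sum (weight ∘ χ) + 1# + - 1#
              ≈⟨ solve 1 (λ x → x :+ :1 :+ :- :1 := x) refl _ ⟩
            sum (weight ∘ χ)
              ≈⟨ card ⟩
            fromℕ d ∎

    -- `G` and `π` stay those found in the first phase: from now on only the flags of rows change.
    -- The index `j` counts the rounds.
    record Main (j : ℕ) (χ : Fin (n ℕ.+ d) → Bool) (W : Square d) : Set where
      field
        inv       : Inverse V χ W
        size      : sum (λ r → weight (χ (row r))) ≤ fromℕ (4 ℕ.* d)
        G         : Fin d → Vector ℝ d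
        π         : Vector ℝ d
        pivots    : Pivots χ d G π
        potential : ρ ^ j * ∏ π ≤ det (gram V χ)

    main₀ : ∀ {χ W} → Initial d χ W → Main 0 χ W
    main₀ {χ} I = record
      { inv = inv ; G = G ; π = π ; pivots = pivots
      ; size = ≤-trans (≤-by (sum-nonneg {d} (λ l → weight-nonneg (χ (unit l))))
                 (trans (+-congʳ (sum-split n (weight ∘ χ))) (solve 2 (λ a b → a :+ b :- a := b) refl _ _)))
                 (≤-trans (≤-reflexive card) (fromℕ-mono-≤ (ℕ.m≤n*m d 4)))
      ; potential = ≤-reflexive (trans (*-identityˡ _) (sym det≈)) }
      where open Initial I

    module _ {j : ℕ} {χ : Fin (n ℕ.+ d) → Bool} {W : Square d} (I : Main j χ W) where
      open Main I
      open Pivots pivots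

      potential-bound : ρ ^ j ≤ fromℕ (suc (4 ℕ.* d)) ^ d
      potential-bound = *-cancelˡ-≤ (∏-pos positive) (≤-respˡ-≈ (*-comm _ _) (≤-respʳ-≈ (trans (∏-scale _ π)
        (*-comm _ _))
        (≤-trans potential (hadamard (gram-symm V χ) (posDef inv) G (λ l → fromℕ (suc (4 ℕ.* d)) * π l)
          (λ l → diagonal (Fin.toℕ<n l)) (λ l j → above (Fin.toℕ<n l)) quad≤))))
        where
        -- Among the unit vectors only the `l`-th can contribute, and if it is present then `π l` is
        -- 1. This accounts for the 1 in `4d + 1`; the rows account for the rest.
        units≤ : ∀ l → sum (λ j → weight (χ (unit j)) * ((V (unit j) ∙ G l) * (V (unit j) ∙ G l))) ≤ π l
        units≤ l = ≤-trans (≤-reflexive (sum-single l off)) on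
          where
          V∙ : ∀ j → V (unit j) ∙ G l ≈ G l j
          V∙ j = trans (reflexive (≡.cong (_∙ G l) (V-unit j))) (δ-∙ j (G l))
          off : ∀ j → j ≢ l → weight (χ (unit j)) * ((V (unit j) ∙ G l) * (V (unit j) ∙ G l)) ≈ 0#
          off j j≢l with χ (unit j) in eq
          ... | false = zeroˡ _
          ... | true = trans (*-identityˡ _) (trans (*-congˡ (trans (V∙ j) (units (Fin.toℕ<n l) eq j≢l))) (zeroʳ _))
          on : weight (χ (unit l)) * ((V (unit l) ∙ G l) * (V (unit l) ∙ G l)) ≤ π l
          on with χ (unit l) in eq
          ... | false = ≤-trans (≤-reflexive (zeroˡ _)) (proj₁ (positive l))
          ... | true = ≤-reflexive (trans (*-identityˡ _) (trans (*-cong Vl Vl) (trans (*-identityˡ 1#)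
            (sym (proj₁ (dead (Fin.toℕ<n l) eq))))))
            where Vl = trans (V∙ l) (diagonal (Fin.toℕ<n l))
        quad≤ : ∀ l → quad (gram V χ) (G l) ≤ fromℕ (suc (4 ℕ.* d)) * π l
        quad≤ l = begin
          quad (gram V χ) (G l)
            ≈⟨ trans (quad-gram V χ (G l)) (sum-split n (λ k → weight (χ k) * ((V k ∙ G l) * (V k ∙ G l)))) ⟩
          sum (λ r → weight (χ (row r)) * ((V (row r) ∙ G l) * (V (row r) ∙ G l))) + sum
            (λ j → weight (χ (unit j)) * ((V (unit j) ∙ G l) * (V (unit j) ∙ G l)))
            ≤⟨ +-mono-≤ (sum-mono-≤ {n} λ r → *-monoˡ-≤ (weight-nonneg (χ (row r)))
                 (≤-trans (≤-reflexive (reflexive (≡.cong (λ v → (v ∙ G l) * (v ∙ G l)) (V-row r))))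
                   (bounded (Fin.toℕ<n l) r))) (units≤ l) ⟩
          sum (λ r → weight (χ (row r)) * π l) + π l
            ≈⟨ +-congʳ (*-distribʳ-sum (π l) (λ r → weight (χ (row r)))) ⟨
          sum (λ r → weight (χ (row r))) * π l + π l
            ≤⟨ +-monoˡ-≤ (π l) (*-monoʳ-≤ (proj₁ (positive l)) size) ⟩
          fromℕ (4 ℕ.* d) * π l + π l
            ≈⟨ solve 2 (λ a p → a :* p :+ p := (:1 :+ a) :* p) refl (fromℕ (4 ℕ.* d)) (π l) ⟩
          fromℕ (suc (4 ℕ.* d)) * π l ∎
          where open ≤-Reasoning

      -- `M y = A i` writes the row as a combination of all present vectors. A surviving unit vector
      -- `l` has the coefficient `y l`, which equals `A i ∙ G l` and hence is zero. The norm bound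
      -- is `quad≈sum` without the terms of the unit vectors.
      combination : ∀ i → let y = W $$ A i in
        (∀ j → A i j ≈ sum (λ r → weight (χ (row r)) * (A r j * (A r ∙ y))))
        × sum (λ r → weight (χ (row r)) * ((A r ∙ y) * (A r ∙ y))) ≤ quad W (A i)
      combination i = comb , (begin
        sum (λ r → weight (χ (row r)) * ((A r ∙ y) * (A r ∙ y)))
          ≈⟨ sum-cong {n} (λ r → *-congˡ (reflexive (≡.cong (λ v → (v ∙ y) * (v ∙ y)) (V-row r)))) ⟨
        sum (λ r → weight (χ (row r)) * ((V (row r) ∙ y) * (V (row r) ∙ y)))
          ≤⟨ ≤-by (sum-nonneg {d} (λ l → *-nonneg (weight-nonneg (χ (unit l))) (0≤x² (V (unit l) ∙ y))))
               (solve 2 (λ a b → a :+ b :- a := b) refl _ _) ⟩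
        sum (λ r → weight (χ (row r)) * ((V (row r) ∙ y) * (V (row r) ∙ y))) + sum (λ j → weight (χ (unit j)) *
          ((V (unit j) ∙ y) * (V (unit j) ∙ y)))
          ≈⟨ sum-split n (λ k → weight (χ k) * ((V k ∙ y) * (V k ∙ y))) ⟨
        sum (λ k → weight (χ k) * ((V k ∙ y) * (V k ∙ y)))
          ≈⟨ quad≈sum inv (A i) ⟨
        quad W (A i) ∎)
        where
        open ≤-Reasoning
        y = W $$ A i
        M = gram V χ
        M-sym : Symmetric M
        M-sym = gram-symm V χ
        -- Since G l is orthogonal to all rows and to the other unit vectors
        -- that remain, M (G l) = δ l.
        MG : ∀ l → χ (unit l) ≡ true → ∀ z → (M $$ z) ∙ G l ≈ z l
        MG l χl z = trans (∙-comm (M $$ z) (G l)) (trans ($$-symm {M = M} M-sym (G l) z)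
          (trans (∙-cong {a = z} (λ _ → refl) MGl) (trans (∙-comm z (δ l)) (δ-∙ l z))))
          where
          MGl : ∀ i → (M $$ G l) i ≈ δ l i
          MGl i = trans (gram-$$ V χ (G l) i) (trans (sum-split n (λ k → V k i * (weight (χ k) * (V k ∙ G l))))
            (trans (+-cong (sum-zero {n} λ r → trans
              (*-congˡ (trans (*-congˡ (trans (reflexive (≡.cong (_∙ G l) (V-row r)))
              (proj₂ (dead (Fin.toℕ<n l) χl) r))) (zeroʳ _))) (zeroʳ _))
                           (sum-single l off))
            (trans (+-identityˡ _) (trans (*-cong (reflexive (≡.cong (λ v → v i) (V-unit l)))
              (trans (*-cong (w-cong χl) (trans (V∙ l) (diagonal (Fin.toℕ<n l)))) (*-identityˡ 1#)))
              (*-identityʳ _)))))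
            where
            V∙ : ∀ j → V (unit j) ∙ G l ≈ G l j
            V∙ j = trans (reflexive (≡.cong (_∙ G l) (V-unit j))) (δ-∙ j (G l))
            off : ∀ j → j ≢ l → V (unit j) i * (weight (χ (unit j)) * (V (unit j) ∙ G l)) ≈ 0#
            off j j≢l with χ (unit j) in eq
            ... | false = trans (*-congˡ (zeroˡ _)) (zeroʳ _)
            ... | true = trans (*-congˡ (trans (*-identityˡ _) (trans (V∙ j) (units (Fin.toℕ<n l) eq j≢l))))
              (zeroʳ _)
        y-dead : ∀ l → χ (unit l) ≡ true → y l ≈ 0#
        y-dead l χl = trans (sym (MG l χl y)) (trans (∙-cong {b = G l} (inverse inv (A i)) (λ _ → refl))
          (proj₂ (dead (Fin.toℕ<n l) χl) i))
        comb : ∀ j → A i j ≈ sum (λ r → weight (χ (row r)) * (A r j * (A r ∙ y)))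
        comb j = trans (sym (inverse inv (A i) j)) (trans (gram-$$ V χ y j)
          (trans (sum-split n (λ k → V k j * (weight (χ k) * (V k ∙ y))))
          (trans (+-cong (sum-cong {n} λ r → trans (solve 3 (λ a w b → a :* (w :* b) := w :* (a :* b)) refl
            (V (row r) j) (weight (χ (row r))) (V (row r) ∙ y))
                             (*-congˡ (reflexive (≡.cong (λ v → v j * (v ∙ y)) (V-row r)))))
                         (sum-zero {d} zeros)) (+-identityʳ _))))
          where
          zeros : ∀ l → V (unit l) j * (weight (χ (unit l)) * (V (unit l) ∙ y)) ≈ 0#
          zeros l with χ (unit l) in eq
          ... | false = trans (*-congˡ (zeroˡ _)) (zeroʳ _)
          ... | true = trans (*-congˡ (trans (*-identityˡ _) (trans (reflexive (≡.cong (_∙ y) (V-unit l)))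
            (trans (δ-∙ l y) (y-dead l eq))))) (zeroʳ _)

      module _ {W₁ : Square d} (r : Fin n) (1<λ : 1# < quad W (A r)) (W₁≈ : ∀ i j → W₁ i j ≈ rankOne W 1# (A r) i j) where

        private
          χ₁ = updateAt χ (row r) (const true)
          λᵣ = quad W (A r)

        -- Members have leverage at most 1.
        absent : χ (row r) ≡ false
        absent with χ (row r) in eq
        ... | false = ≡.refl
        ... | true = ⊥-elim (<⇒≱ 1<λ (≤-trans (≤-reflexive (reflexive (≡.cong (quad W) (≡.sym (V-row r)))))
          (member-≤1 inv eq)))

        private
          s-pos : 0# < 1# + 1# * λᵣ
          s-pos = +-pos-nonneg 0<1 (*-nonneg (proj₁ 0<1) (quad-nonneg inv (A r)))
          ex₁ = exchange V (row r) true (V-row r) (trans (+-congˡ (-‿cong (w-cong absent)))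
            (solve 0 (:1 :- :0 := :1) refl)) inv s-pos W₁≈

          pivots″ : ∀ {χ′} → (∀ l → χ′ (unit l) ≡ χ (unit l)) → Pivots χ′ d G π
          pivots″ same = record
            { diagonal = diagonal ; above = above ; bounded = bounded ; positive = positive
            ; units = λ {l} {j} lt χj → units lt (≡.trans (≡.sym (same j)) χj)
            ; dead = λ {l} lt χl → dead lt (≡.trans (≡.sym (same l)) χl)
            ; future = λ {l} le → ⊥-elim (ℕ.<⇒≱ (Fin.toℕ<n l) le) }

          same₁ : ∀ l → χ₁ (unit l) ≡ χ (unit l)
          same₁ l = updateAt-minimal (unit l) (row r) χ (row≢unit ∘ ≡.sym)

          P-nonneg : 0# ≤ ρ ^ j * ∏ π
          P-nonneg = *-nonneg (ρ^-nonneg j) (∏-nonneg (proj₁ ∘ positive))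

          doubled : (1# + 1#) * (ρ ^ j * ∏ π) ≤ det (gram V χ₁)
          doubled = ≤-trans (*-mono-≤ (+-nonneg (proj₁ 0<1) (proj₁ 0<1)) P-nonneg
              (+-monoʳ-≤ 1# (≤-trans (proj₁ 1<λ) (≤-reflexive (sym (*-identityˡ _))))) potential)
            (≤-reflexive (trans (*-comm _ _) (sym (proj₂ ex₁))))

          ρ≈ : (1# + 1#) * (1# - ¼) ≈ ρ
          ρ≈ = trans (solve 1 (λ q → (:1 :+ :1) :* (:1 :- q) := :1 :+ (q :+ q) :+ (:1 :- :4 :* q)) refl ¼)
                 (trans (+-congˡ (trans (+-congˡ (-‿cong 4*¼≈1)) (-‿inverseʳ 1#))) (+-identityʳ _))

          inner-size : sum (λ r → weight (χ₁ (row r))) ≈ sum (λ r → weight (χ (row r))) + 1#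
          inner-size = sum-change r 1# (λ i i≢r → w-cong (updateAt-minimal (row i) (row r) χ (i≢r ∘ row-injective)))
            (trans (w-cong (updateAt-updates (row r) χ)) (trans (sym (+-identityˡ 1#))
              (+-congʳ (w-cong (≡.sym absent)))))

        -- The size bound is re-derived from the trace, not inherited; the gain of 2 is more than
        -- `ρ`.
        keep : (∀ r′ → χ₁ (row r′) ≡ true → ¼ ≤ quad W₁ (A r′)) → Main (suc j) χ₁ W₁
        keep all≥ = record
          { inv = proj₁ ex₁ ; G = G ; π = π ; pivots = pivots″ same₁
          ; size = *-cancelˡ-≤ 0<¼ (begin
              ¼ * sum (λ r′ → weight (χ₁ (row r′)))
                ≈⟨ *-distribˡ-sum ¼ (λ r′ → weight (χ₁ (row r′))) ⟩
              sum (λ r′ → ¼ * weight (χ₁ (row r′)))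
                ≤⟨ sum-mono-≤ {n} lev≥ ⟩
              sum (λ r′ → weight (χ₁ (row r′)) * quad W₁ (V (row r′)))
                ≤⟨ ≤-by (sum-nonneg {d} λ l → *-nonneg (weight-nonneg (χ₁ (unit l))) (quad-nonneg (proj₁ ex₁)
                  (V (unit l))))
                     (trans (+-congʳ (sum-split n (λ k → weight (χ₁ k) * quad W₁ (V k))))
                       (solve 2 (λ a b → a :+ b :- a := b) refl _ _)) ⟩
              sum (λ k → weight (χ₁ k) * quad W₁ (V k))
                ≈⟨ trace (proj₁ ex₁) ⟩
              fromℕ d
                ≈⟨ trans (sym (*-identityˡ _)) (*-congʳ (sym 4*¼≈1)) ⟩
              (1# + 1# + (1# + 1#)) * ¼ * fromℕ d
                ≈⟨ solve 2 (λ q d → :4 :* q :* d :=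
                     q :* ((:1 :+ (:1 :+ (:1 :+ (:1 :+ :0)))) :* d)) refl ¼ (fromℕ d) ⟩
              ¼ * (fromℕ 4 * fromℕ d)
                ≈⟨ *-congˡ (fromℕ-* 4 d) ⟨
              ¼ * fromℕ (4 ℕ.* d) ∎)
          ; potential = ≤-trans (≤-trans (≤-reflexive (*-assoc _ _ _)) (*-monoʳ-≤ P-nonneg
              (≤-by (proj₁ (*-pos 0<¼ (+-pos-nonneg 0<1 (proj₁ 0<1)))) (trans (+-congˡ (-‿cong (sym ρ≈)))
                 (solve 1 (λ q → (:1 :+ :1) :- (:1 :+ :1) :* (:1 :- q) := q :* (:1 :+ :1)) refl ¼))))) doubled }
          where
          open ≤-Reasoning
          lev≥ : ∀ r′ → ¼ * weight (χ₁ (row r′)) ≤ weight (χ₁ (row r′)) * quad W₁ (V (row r′))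
          lev≥ r′ with χ₁ (row r′) in eq
          ... | false = ≤-reflexive (trans (zeroʳ _) (sym (zeroˡ _)))
          ... | true = ≤-trans (≤-reflexive (*-identityʳ _)) (≤-trans (all≥ r′ eq)
                         (≤-reflexive (trans (reflexive (≡.cong (quad W₁) (≡.sym (V-row r′))))
                           (sym (*-identityˡ _)))))

        -- One row enters and one leaves, so the size bound is inherited.
        drop : ∀ {W₂ w} r′ → χ₁ (row r′) ≡ true → quad W₁ (A r′) ≤ ¼ → w ≈ - 1# →
          (∀ i j → W₂ i j ≈ rankOne W₁ w (A r′) i j) → Main (suc j) (updateAt χ₁ (row r′) (const false)) W₂
        drop {W₂} {w} r′ χr′ small w≈ W₂≈ = record
          { inv = proj₁ ex₂ ; G = G ; π = π
          ; pivots = pivots″ (λ l → ≡.trans (updateAt-minimal (unit l) (row r′) χ₁ (row≢unit ∘ ≡.sym)) (same₁ l))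
          ; size = ≤-trans (≤-reflexive (begin-equality
              sum (λ r → weight (χ₂ (row r)))
                ≈⟨ sum-change r′ (- 1#) (λ i i≢r → w-cong (updateAt-minimal (row i) (row r′) χ₁
                  (i≢r ∘ row-injective)))
                   (trans (w-cong (updateAt-updates (row r′) χ₁)) (trans (solve 0 (:0 := :1 :- :1) refl)
                     (+-congʳ (w-cong (≡.sym χr′))))) ⟩
              sum (λ r → weight (χ₁ (row r))) + - 1#  ≈⟨ +-congʳ inner-size ⟩
              sum (λ r → weight (χ (row r))) + 1# + - 1# ≈⟨ solve 1 (λ x → x :+ :1 :+ :- :1 := x) refl _ ⟩
              sum (λ r → weight (χ (row r))) ∎)) size
          ; potential = begin
              ρ * ρ ^ j * ∏ π                           ≈⟨ *-assoc _ _ _ ⟩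
              ρ * (ρ ^ j * ∏ π)                         ≈⟨ *-congʳ ρ≈ ⟨
              (1# + 1#) * (1# - ¼) * (ρ ^ j * ∏ π)      ≈⟨ solve 3 (λ a b c → a :* b :* c := a :* c :* b) refl
                (1# + 1#) (1# - ¼) _ ⟩
              (1# + 1#) * (ρ ^ j * ∏ π) * (1# - ¼)      ≤⟨ *-mono-≤ (*-nonneg (+-nonneg (proj₁ 0<1) (proj₁ 0<1))
                P-nonneg) (proj₁ 0<1-¼) doubled gap ⟩
              det (gram V χ₁) * (1# + w * quad W₁ (A r′)) ≈⟨ proj₂ ex₂ ⟨
              det (gram V χ₂) ∎ }
          where
          open ≤-Reasoning
          χ₂ = updateAt χ₁ (row r′) (const false)
          0<1-¼ : 0# < 1# - ¼
          0<1-¼ = <-respʳ-≈ (trans (solve 1 (λ q → q :+ (q :+ q) := :4 :* q :- q) refl ¼) (+-congʳ 4*¼≈1))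
                    (+-pos-nonneg 0<¼ (+-nonneg (proj₁ 0<¼) (proj₁ 0<¼)))
          gap : 1# - ¼ ≤ 1# + w * quad W₁ (A r′)
          gap = ≤-by (x≤y⇒0≤y-x small) (trans (+-congʳ (+-congˡ (*-congʳ w≈)))
                  (solve 2 (λ q x → :1 :+ (:- :1) :* x :- (:1 :- q) := q :- x) refl ¼ _))
          ex₂ = exchange V (row r′) false (V-row r′) (trans (+-congˡ (-‿cong (w-cong χr′)))
            (trans (solve 0 (:0 :- :1 := :- :1) refl) (sym w≈)))
                  (proj₁ ex₁) (<-≤-trans 0<1-¼ gap) W₂≈

  -- Reasoning about real-RAM programs

  open RealRAM R
  open State

  does-true : ∀ {P : Set} (P? : Dec P) → does P? ≡ true → P
  does-true (yes p) _ = p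

  does-false : ∀ {P : Set} (P? : Dec P) → does P? ≡ false → ¬ P
  does-false (no ¬p) _ = ¬p

  ≔-here : ∀ {X : Set} (f : ℕ → X) x y v → x ≡ y → (f [ x ≔ v ]) y ≡ v
  ≔-here f x y v x≡y = ≡.cong (λ b → if b then v else f y) (dec-true (x ℕ.≟ y) x≡y)

  ≔-there : ∀ {X : Set} (f : ℕ → X) x y v → x ≢ y → (f [ x ≔ v ]) y ≡ f y
  ≔-there f x y v x≢y = ≡.cong (λ b → if b then v else f y) (dec-false (x ℕ.≟ y) x≢y)

  -- Memory locations and frame conditions

  data Loc : Set where
    nv na rv ra : ℕ → Loc

  Contents : Loc → Set
  Contents (nv _) = ℕ
  Contents (na _) = ℕ → ℕ
  Contents (rv _) = ℝ
  Contents (ra _) = ℕ → ℝ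

  get : (l : Loc) → State → Contents l
  get (nv x) σ = varᴺ σ x
  get (na x) σ = arrᴺ σ x
  get (rv x) σ = varᴿ σ x
  get (ra x) σ = arrᴿ σ x

  target : Instr → Loc
  target (constᴺ x _)   = nv x
  target (addᴺ x _ _)   = nv x
  target (subᴺ x _ _)   = nv x
  target (loadᴺ x _ _)  = nv x
  target (storeᴺ a _ _) = na a
  target (zeroᴿ x)      = rv x
  target (oneᴿ x)       = rv x
  target (addᴿ x _ _)   = rv x
  target (subᴿ x _ _)   = rv x
  target (mulᴿ x _ _)   = rv x
  target (divᴿ x _ _)   = rv x
  target (loadᴿ x _ _)  = rv x
  target (storeᴿ a _ _) = ra a

  same : Loc → Loc → Bool
  same (nv x) (nv y) = x ≡ᵇ y
  same (na x) (na y) = x ≡ᵇ y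
  same (rv x) (rv y) = x ≡ᵇ y
  same (ra x) (ra y) = x ≡ᵇ y
  same _      _      = false

  -- A syntactic Boolean test, so that for a concrete program and location the frame condition is
  -- discharged by `≡.refl`. Arrays are treated as a whole.
  avoids : Loc → Program → Bool
  avoids l skip = true
  avoids l (instr I) = not (same (target I) l)
  avoids l (p ︔ q) = avoids l p ∧ avoids l q
  avoids l (If _ Then p Else q) = avoids l p ∧ avoids l q
  avoids l (While _ Do p) = avoids l p

  Frame : Program → State → State → Set
  Frame p σ τ = ∀ l → avoids l p ≡ true → get l τ ≡ get l σ

  private
    ≔-avoids : ∀ {X : Set} (f : ℕ → X) x v y → not (x ≡ᵇ y) ≡ true → (f [ x ≔ v ]) y ≡ f y
    ≔-avoids f x v y h with x ≡ᵇ y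
    ... | false = ≡.refl

    ∧-true : ∀ {a b} → a ∧ b ≡ true → a ≡ true × b ≡ true
    ∧-true {true} {true} _ = ≡.refl , ≡.refl

  exec-frame : ∀ I σ → Frame (instr I) σ (exec I σ)
  exec-frame (constᴺ x c) σ (nv w) h = ≔-avoids (varᴺ σ) x c w h
  exec-frame (constᴺ x c) σ (na w) h = ≡.refl
  exec-frame (constᴺ x c) σ (rv w) h = ≡.refl
  exec-frame (constᴺ x c) σ (ra w) h = ≡.refl
  exec-frame (addᴺ x y z) σ (nv w) h = ≔-avoids (varᴺ σ) x (varᴺ σ y ℕ.+ varᴺ σ z) w h
  exec-frame (addᴺ x y z) σ (na w) h = ≡.refl
  exec-frame (addᴺ x y z) σ (rv w) h = ≡.refl
  exec-frame (addᴺ x y z) σ (ra w) h = ≡.refl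
  exec-frame (subᴺ x y z) σ (nv w) h = ≔-avoids (varᴺ σ) x (varᴺ σ y ℕ.∸ varᴺ σ z) w h
  exec-frame (subᴺ x y z) σ (na w) h = ≡.refl
  exec-frame (subᴺ x y z) σ (rv w) h = ≡.refl
  exec-frame (subᴺ x y z) σ (ra w) h = ≡.refl
  exec-frame (loadᴺ x k i) σ (nv w) h = ≔-avoids (varᴺ σ) x (arrᴺ σ k (varᴺ σ i)) w h
  exec-frame (loadᴺ x k i) σ (na w) h = ≡.refl
  exec-frame (loadᴺ x k i) σ (rv w) h = ≡.refl
  exec-frame (loadᴺ x k i) σ (ra w) h = ≡.refl
  exec-frame (storeᴺ x i y) σ (nv w) h = ≡.refl
  exec-frame (storeᴺ x i y) σ (na w) h = ≔-avoids (arrᴺ σ) x (arrᴺ σ x [ varᴺ σ i ≔ varᴺ σ y ]) w h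
  exec-frame (storeᴺ x i y) σ (rv w) h = ≡.refl
  exec-frame (storeᴺ x i y) σ (ra w) h = ≡.refl
  exec-frame (zeroᴿ x) σ (nv w) h = ≡.refl
  exec-frame (zeroᴿ x) σ (na w) h = ≡.refl
  exec-frame (zeroᴿ x) σ (rv w) h = ≔-avoids (varᴿ σ) x 0# w h
  exec-frame (zeroᴿ x) σ (ra w) h = ≡.refl
  exec-frame (oneᴿ x) σ (nv w) h = ≡.refl
  exec-frame (oneᴿ x) σ (na w) h = ≡.refl
  exec-frame (oneᴿ x) σ (rv w) h = ≔-avoids (varᴿ σ) x 1# w h
  exec-frame (oneᴿ x) σ (ra w) h = ≡.refl
  exec-frame (addᴿ x y z) σ (nv w) h = ≡.refl
  exec-frame (addᴿ x y z) σ (na w) h = ≡.refl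
  exec-frame (addᴿ x y z) σ (rv w) h = ≔-avoids (varᴿ σ) x (varᴿ σ y + varᴿ σ z) w h
  exec-frame (addᴿ x y z) σ (ra w) h = ≡.refl
  exec-frame (subᴿ x y z) σ (nv w) h = ≡.refl
  exec-frame (subᴿ x y z) σ (na w) h = ≡.refl
  exec-frame (subᴿ x y z) σ (rv w) h = ≔-avoids (varᴿ σ) x (varᴿ σ y - varᴿ σ z) w h
  exec-frame (subᴿ x y z) σ (ra w) h = ≡.refl
  exec-frame (mulᴿ x y z) σ (nv w) h = ≡.refl
  exec-frame (mulᴿ x y z) σ (na w) h = ≡.refl
  exec-frame (mulᴿ x y z) σ (rv w) h = ≔-avoids (varᴿ σ) x (varᴿ σ y * varᴿ σ z) w h
  exec-frame (mulᴿ x y z) σ (ra w) h = ≡.refl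
  exec-frame (divᴿ x y z) σ (nv w) h = ≡.refl
  exec-frame (divᴿ x y z) σ (na w) h = ≡.refl
  exec-frame (divᴿ x y z) σ (rv w) h = ≔-avoids (varᴿ σ) x (varᴿ σ y * varᴿ σ z ⁻¹) w h
  exec-frame (divᴿ x y z) σ (ra w) h = ≡.refl
  exec-frame (loadᴿ x k i) σ (nv w) h = ≡.refl
  exec-frame (loadᴿ x k i) σ (na w) h = ≡.refl
  exec-frame (loadᴿ x k i) σ (rv w) h = ≔-avoids (varᴿ σ) x (arrᴿ σ k (varᴺ σ i)) w h
  exec-frame (loadᴿ x k i) σ (ra w) h = ≡.refl
  exec-frame (storeᴿ x i y) σ (nv w) h = ≡.refl
  exec-frame (storeᴿ x i y) σ (na w) h = ≡.refl
  exec-frame (storeᴿ x i y) σ (rv w) h = ≡.refl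
  exec-frame (storeᴿ x i y) σ (ra w) h = ≔-avoids (arrᴿ σ) x (arrᴿ σ x [ varᴺ σ i ≔ varᴿ σ y ]) w h

  frame : ∀ {p σ t τ} → ⟨ p , σ ⟩⇓[ t ] τ → Frame p σ τ
  frame ⇓-skip l _ = ≡.refl
  frame (⇓-instr {I} {σ}) l h = exec-frame I σ l h
  frame (⇓-seq r s) l h = ≡.trans (frame s l (proj₂ (∧-true h))) (frame r l (proj₁ (∧-true h)))
  frame (⇓-then _ r) l h = frame r l (proj₁ (∧-true h))
  frame (⇓-else {p = p} _ r) l h = frame r l (proj₂ (∧-true {avoids l p} h))
  frame (⇓-stop _) l _ = ≡.refl
  frame (⇓-loop _ r s) l h = ≡.trans (frame s l h) (frame r l h)

  -- Total correctness with a time bound. The initial state is a parameter, so preconditions are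
  -- ordinary hypotheses about it.
  record Run (p : Program) (σ : State) (t : ℕ) (Q : State → Set) : Set where
    constructor run
    field
      {time}  : ℕ
      {final} : State
      halts   : ⟨ p , σ ⟩⇓[ time ] final
      time≤   : time ℕ.≤ t
      post    : Q final

  run-weaken : ∀ {p σ s t Q} → s ℕ.≤ t → Run p σ s Q → Run p σ t Q
  run-weaken s≤t (run h le q) = run h (ℕ.≤-trans le s≤t) q

  run-map : ∀ {p σ t Q Q′} → (∀ {τ} → Frame p σ τ → Q τ → Q′ τ) → Run p σ t Q → Run p σ t Q′
  run-map f (run h le q) = run h le (f (frame h) q)

  run-skip : ∀ {σ t Q} → Q σ → Run skip σ t Q
  run-skip q = run ⇓-skip z≤n q

  -- The continuation receives the frame of the first program besides its postcondition;
  -- postconditions therefore mention only what changes.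
  run-seq : ∀ {p q σ s t Q Q′} → Run p σ s Q → (∀ {τ} → Frame p σ τ → Q τ → Run q τ t Q′) → Run (p ︔ q) σ
    (s ℕ.+ t) Q′
  run-seq (run h le q) f with f (frame h) q
  ... | run h′ le′ q′ = run (⇓-seq h h′) (ℕ.+-mono-≤ le le′) q′

  run-if : ∀ {b p q σ t Q} → (test b σ ≡ true → Run p σ t Q) → (test b σ ≡ false → Run q σ t Q) →
    Run (If b Then p Else q) σ (suc t) Q
  run-if {b} {σ = σ} f g with test b σ in eq
  run-if f g | true with f ≡.refl
  ... | run h le q = run (⇓-then eq h) (s≤s le) q
  run-if f g | false with g ≡.refl
  ... | run h le q = run (⇓-else eq h) (s≤s le) q

  block : List Instr → Program
  block [] = skip
  block (I ∷ Is) = instr I ︔ block Is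

  execs : List Instr → State → State
  execs [] σ = σ
  execs (I ∷ Is) σ = execs Is (exec I σ)

  run-block : ∀ Is {σ Q} → Q (execs Is σ) → Run (block Is) σ (length Is) Q
  run-block [] q = run-skip q
  run-block (I ∷ Is) q = run-seq {Q = _≡ exec I _} (run ⇓-instr ℕ.≤-refl ≡.refl) λ { _ ≡.refl → run-block Is q }

  -- Variable 3 holds 1.
  For : (counter bound : ℕ) → Program → Program
  For c b p = instr (constᴺ c 0) ︔ While lessᴺ c b Do (p ︔ instr (addᴺ c c 3))

  -- The invariant is indexed by the number of completed iterations and re-established after the
  -- increment of the counter. An iteration pays for its test and the increment, the whole loop for
  -- the initial assignment and the last test; these are the two summands 2.
  run-for : ∀ {c b p σ₀ N K} (I : ℕ → State → Set) →
    avoids (nv c) p ≡ true → avoids (nv b) (For c b p) ≡ true → avoids (nv 3) (For c b p) ≡ true →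
    varᴺ σ₀ b ≡ N → varᴺ σ₀ 3 ≡ 1 → I 0 (exec (constᴺ c 0) σ₀) →
    (∀ {i σ} → i ℕ.< N → varᴺ σ c ≡ i → Frame (For c b p) σ₀ σ → I i σ →
       Run p σ K (λ τ → I (suc i) (exec (addᴺ c c 3) τ))) →
    Run (For c b p) σ₀ (2 ℕ.+ N ℕ.* (2 ℕ.+ K)) (I N)
  run-for {c} {b} {p} {σ₀} {N} {K} I avc avb av3 eqb eq3 start step =
    run-seq {s = 1} {Q = _≡ exec (constᴺ c 0) σ₀} (run ⇓-instr ℕ.≤-refl ≡.refl)
      λ { f ≡.refl → loop N 0 ≡.refl (≔-here (varᴺ σ₀) c c 0 ≡.refl) (λ l h → exec-frame (constᴺ c 0) σ₀ l
        (proj₁ (∧-true h))) start }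
    where
    loop : ∀ k i {σ} → i ℕ.+ k ≡ N → varᴺ σ c ≡ i → Frame (For c b p) σ₀ σ → I i σ →
      Run (While lessᴺ c b Do (p ︔ instr (addᴺ c c 3))) σ (suc (k ℕ.* (2 ℕ.+ K))) (I N)
    loop zero i {σ} i+0≡N eqc fr inv = run (⇓-stop stop) ℕ.≤-refl (≡.subst (λ i → I i σ) i≡N inv)
      where
      i≡N = ≡.trans (≡.sym (ℕ.+-identityʳ i)) i+0≡N
      stop : does (varᴺ σ c ℕ.<? varᴺ σ b) ≡ false
      stop = dec-false (varᴺ σ c ℕ.<? varᴺ σ b)
        (ℕ.<-irrefl (≡.trans eqc (≡.trans i≡N (≡.trans (≡.sym eqb) (≡.sym (fr (nv b) avb))))))
    loop (suc k) i {σ} i+k≡N eqc fr inv with step i<N eqc fr inv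
      where
      i<N : i ℕ.< N
      i<N = ℕ.≤-trans (ℕ.m≤m+n (suc i) k) (ℕ.≤-reflexive (≡.trans (≡.sym (ℕ.+-suc i k)) i+k≡N))
    ... | run {t} {τ} h le q with loop k (suc i) {exec (addᴺ c c 3) τ} (≡.trans (≡.sym (ℕ.+-suc i k)) i+k≡N)
              (≡.trans (≔-here (varᴺ τ) c c _ ≡.refl) (≡.trans (≡.cong₂ ℕ._+_ (≡.trans (frame h (nv c) avc) eqc)
                 (≡.trans (≡.trans (frame h (nv 3) (proj₁ (∧-true (proj₂ (∧-true {not (c ≡ᵇ 3)} av3)))))
                   (fr (nv 3) av3)) eq3)) (ℕ.+-comm i 1)))
              (λ l a → ≡.trans (frame (⇓-seq h (⇓-instr {addᴺ c c 3})) l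
                (proj₂ (∧-true {avoids l (instr (constᴺ c 0))} a))) (fr l a))
              q
    ... | run h′ le′ q′ = run (⇓-loop go (⇓-seq h ⇓-instr) h′)
            (s≤s (ℕ.≤-trans (ℕ.+-mono-≤ (ℕ.≤-trans (ℕ.+-monoˡ-≤ 1 le) (ℕ.≤-reflexive (ℕ.+-comm K 1))) le′)
               (ℕ.≤-reflexive (ℕ.+-suc (suc K) (k ℕ.* (2 ℕ.+ K)))))) q′
      where
      go : does (varᴺ σ c ℕ.<? varᴺ σ b) ≡ true
      go = dec-true (varᴺ σ c ℕ.<? varᴺ σ b) (≡.subst₂ ℕ._<_ (≡.sym eqc) (≡.sym (≡.trans (fr (nv b) avb) eqb))
              (ℕ.≤-trans (ℕ.m≤m+n (suc i) k) (ℕ.≤-reflexive (≡.trans (≡.sym (ℕ.+-suc i k)) i+k≡N))))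

  run-block-then : ∀ Is {q σ t Q} → Run q (execs Is σ) t Q → Run (block Is ︔ q) σ (length Is ℕ.+ t) Q
  run-block-then Is {σ = σ} r = run-seq {Q = _≡ execs Is σ} (run-block Is ≡.refl) λ { _ ≡.refl → r }

  block-frame : ∀ Is σ → Frame (block Is) σ (execs Is σ)
  block-frame Is σ l a with run-block Is {σ} {_≡ execs Is σ} ≡.refl
  ... | run h _ ≡.refl = frame h l a

  frame-seq : ∀ {p q σ τ υ} → Frame p σ τ → Frame q τ υ → Frame (p ︔ q) σ υ
  frame-seq {p} f g l a = ≡.trans (g l (proj₂ (∧-true {avoids l p} a))) (f l (proj₁ (∧-true a)))

  -- Termination comes from the index of the invariant, which grows in each iteration and always
  -- stays below `T`; `k` is the fuel left.
  run-while : ∀ {b p T K Q} (I : ℕ → State → Set) → (∀ {j σ} → I j σ → j ℕ.< T) →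
    (∀ {j σ} → I j σ → test b σ ≡ false × Q σ ⊎ test b σ ≡ true × Run p σ K (I (suc j))) →
    ∀ k {j σ} → T ℕ.≤ j ℕ.+ k → I j σ → Run (While b Do p) σ (suc (k ℕ.* suc K)) Q
  run-while I bounded step zero {j} T≤ inv =
    ⊥-elim (ℕ.<⇒≱ (bounded inv) (ℕ.≤-trans T≤ (ℕ.≤-reflexive (ℕ.+-identityʳ j))))
  run-while {K = K} I bounded step (suc k) {j} T≤ inv with step inv
  ... | inj₁ (stop , q) = run (⇓-stop stop) (s≤s z≤n) q
  ... | inj₂ (go , run h le inv′) with run-while I bounded step k (ℕ.≤-trans T≤ (ℕ.≤-reflexive (ℕ.+-suc j k))) inv′
  ...   | run h′ le′ q = run (⇓-loop go h h′)
          (s≤s (ℕ.≤-trans (ℕ.+-mono-≤ le le′) (ℕ.≤-reflexive (ℕ.+-suc K (k ℕ.* suc K))))) q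

  -- Loops

  ∑ : ℕ → (ℕ → ℝ) → ℝ
  ∑ zero f = 0#
  ∑ (suc n) f = ∑ n f + f n

  -- The effect on cell `k` of adding `x` to cell `r`. The outcome of a scatter loop is a sum of
  -- these.
  hit : ℕ → ℕ → ℝ → ℝ
  hit r k x = if does (r ℕ.≟ k) then x else 0#

  private
    accumulate : ∀ {y₀ : ℕ → ℝ} {row : ℕ → ℕ} {g : ℕ → ℝ} {i : ℕ} (y : ℕ → ℝ) r z → (∀ k → y k ≈ y₀ k + ∑ i
      (λ e → hit (row e) k (g e))) →
      r ≡ row i → z ≈ y r + g i → ∀ k → (y [ r ≔ z ]) k ≈ y₀ k + ∑ (suc i) (λ e → hit (row e) k (g e))
    accumulate {y₀} {row} {g} {i} y r z inv ≡.refl z≈ k with r ℕ.≡ᵇ k in eq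
    ... | false = trans (inv k) (sym (trans (sym (+-assoc _ _ _)) (+-identityʳ _)))
    ... | true with ℕ.≡ᵇ⇒≡ r k (≡.subst T (≡.sym eq) _)
    ...   | ≡.refl = trans z≈ (trans (+-congʳ (inv r)) (+-assoc _ _ _))

    infixl 9 _⟨$⟩_
    _⟨$⟩_ : ∀ {X Y : Set} {f g : X → Y} {x y} → f ≡ g → x ≡ y → f x ≡ g y
    ≡.refl ⟨$⟩ ≡.refl = ≡.refl

    ≡⇒≈ : ∀ {x y : ℝ} → x ≡ y → x ≈ y
    ≡⇒≈ = reflexive

    upd : ∀ {X : Set} {P : X → Set} (f : ℕ → X) r z k → (r ≡ k → P z) → (r ≢ k → P (f k)) → P ((f [ r ≔ z ]) k)
    upd {P = P} f r z k new old with r ℕ.≟ k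
    ... | yes r≡k = ≡.subst P (≡.sym (≔-here f r k z r≡k)) (new r≡k)
    ... | no r≢k = ≡.subst P (≡.sym (≔-there f r k z r≢k)) (old r≢k)

  <-suc-cases : ∀ {i e} {P : Set} → e ℕ.< suc i → (e ℕ.< i → P) → (e ≡ i → P) → P
  <-suc-cases {i} {e} e<1+i f g with e ℕ.≟ i
  ... | yes e≡i = g e≡i
  ... | no e≢i = f (ℕ.≤∧≢⇒< (ℕ.≤-pred e<1+i) e≢i)

  -- Natural variables: 1 is d, 2 is nnz(A), 3 is the constant 1, 4 and 6 are
  -- counters, 5 is d², 7 is a selected row and 8 tells whether there is one,
  -- 9 and 10 are scratch, 12 is the constant 0.  Natural arrays: 0 and 1 are the
  -- rows and columns of the entries of A, 2 and 3 those of W, 4 marks S.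
  -- Real variables: 1 is the constant 1, 2 is 1/4, 3 is the weight of an update
  -- and 8 its coefficient, 4 is an accumulator, 5 and 6 are scratch.  Real
  -- arrays: 0 and 1 are the entries of A and W, 3 is the vector v of an update,
  -- 2 is u = W v, 4 holds the aᵢ ∙ u (zero between updates), 5 the leverages,
  -- 6 marks the row being loaded (zero otherwise).
  clear : (bound array : ℕ) → Program
  clear b a = For 4 b (block (zeroᴿ 5 ∷ storeᴿ a 4 5 ∷ []))

  clear-spec : ∀ {σ N} b a → avoids (nv b) (clear b a) ≡ true → varᴺ σ b ≡ N → varᴺ σ 3 ≡ 1 →
    Run (clear b a) σ (2 ℕ.+ N ℕ.* 4) (λ τ → ∀ i → i ℕ.< N → arrᴿ τ a i ≡ 0#)
  clear-spec b a avb eqb eq3 = run-for (λ i τ → ∀ k → k ℕ.< i → arrᴿ τ a k ≡ 0#) ≡.refl avb ≡.refl eqb eq3 (λ k ())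
    λ {i} {σ} i<N eqc fr inv → run-block _ λ k k<1+i →
      ≡.trans (≡.cong (λ f → f k) (≔-here (arrᴿ σ) a a _ ≡.refl))
        (upd {P = _≡ 0#} (arrᴿ σ a) (varᴺ σ 4) 0# k (λ _ → ≡.refl)
          (λ c≢k → inv k (ℕ.≤∧≢⇒< (ℕ.≤-pred k<1+i) λ { ≡.refl → c≢k eqc })))

  -- Adds to `y` the product of a matrix in coordinate form with the vector `x`. It serves for
  -- `W v`, for the products of all rows of `A` with `u`, and, with the index arrays exchanged, for
  -- products with the transpose of `A`.
  scatter : (bound row col val x y : ℕ) → Program
  scatter b rows cols vals x y = For 4 b (block
    ( loadᴺ 9 rows 4 ∷ loadᴺ 10 cols 4 ∷ loadᴿ 5 vals 4 ∷ loadᴿ 6 x 10 ∷ mulᴿ 5 5 6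
    ∷ loadᴿ 6 y 9 ∷ addᴿ 5 6 5 ∷ storeᴿ y 9 5 ∷ []))

  scatter-spec : ∀ {σ N} b rows cols vals x y → let p = scatter b rows cols vals x y in
    avoids (nv b) p ≡ true → avoids (ra vals) p ≡ true → avoids (ra x) p ≡ true → varᴺ σ b ≡ N → varᴺ σ 3 ≡ 1 →
    Run p σ (2 ℕ.+ N ℕ.* 10) (λ τ → ∀ k → arrᴿ τ y k ≈ arrᴿ σ y k +
      ∑ N (λ e → hit (arrᴺ σ rows e) k (arrᴿ σ vals e * arrᴿ σ x (arrᴺ σ cols e))))
  scatter-spec {σ₀} b rows cols vals x y avb avv avx eqb eq3 =
    run-for (λ i τ → ∀ k → arrᴿ τ y k ≈ arrᴿ σ₀ y k +
      ∑ i (λ e → hit (arrᴺ σ₀ rows e) k (arrᴿ σ₀ vals e * arrᴿ σ₀ x (arrᴺ σ₀ cols e))))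
      ≡.refl avb ≡.refl eqb eq3 (λ k → sym (+-identityʳ _))
      λ {i} {σ} i<N eqc fr inv → run-block _ λ k →
        trans (≡⇒≈ (≡.cong (λ f → f k) (≔-here (arrᴿ σ) y y _ ≡.refl)))
          (accumulate {row = arrᴺ σ₀ rows} {g = λ e → arrᴿ σ₀ vals e * arrᴿ σ₀ x (arrᴺ σ₀ cols e)} (arrᴿ σ y)
            (arrᴺ σ rows (varᴺ σ 4)) _ inv
            (fr (na rows) ≡.refl ⟨$⟩ eqc)
            (+-congˡ (≡⇒≈ (≡.cong₂ _*_ (fr (ra vals) avv ⟨$⟩ eqc) (fr (ra x) avx ⟨$⟩ (fr (na cols) ≡.refl ⟨$⟩
              eqc))))) k)

  -- The leverages for the initial `W`, the identity matrix.
  squares : Program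
  squares = For 4 2 (block (loadᴺ 9 0 4 ∷ loadᴿ 5 0 4 ∷ mulᴿ 5 5 5 ∷ loadᴿ 6 5 9 ∷ addᴿ 6 6 5 ∷ storeᴿ 5 9 6 ∷ []))

  squares-spec : ∀ {σ N} → varᴺ σ 2 ≡ N → varᴺ σ 3 ≡ 1 → Run squares σ (2 ℕ.+ N ℕ.* 8) (λ τ → ∀ k →
    arrᴿ τ 5 k ≈ arrᴿ σ 5 k + ∑ N (λ e → hit (arrᴺ σ 0 e) k (arrᴿ σ 0 e * arrᴿ σ 0 e)))
  squares-spec {σ₀} eqb eq3 =
    run-for (λ i τ → ∀ k → arrᴿ τ 5 k ≈ arrᴿ σ₀ 5 k + ∑ i (λ e → hit (arrᴺ σ₀ 0 e) k (arrᴿ σ₀ 0 e * arrᴿ σ₀ 0 e)))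
      ≡.refl ≡.refl ≡.refl eqb eq3 (λ k → sym (+-identityʳ _))
      λ {i} {σ} i<N eqc fr inv → run-block _
        (accumulate {row = arrᴺ σ₀ 0} {g = λ e → arrᴿ σ₀ 0 e * arrᴿ σ₀ 0 e} (arrᴿ σ 5) (arrᴺ σ 0 (varᴺ σ 4)) _ inv
          (fr (na 0) ≡.refl ⟨$⟩ eqc) (+-congˡ (≡⇒≈ (≡.cong₂ _*_ (fr (ra 0) ≡.refl ⟨$⟩ eqc) (fr (ra 0) ≡.refl ⟨$⟩
            eqc)))))

  dot : Program
  dot = For 4 1 (block (loadᴿ 5 3 4 ∷ loadᴿ 6 2 4 ∷ mulᴿ 5 5 6 ∷ addᴿ 4 4 5 ∷ []))

  dot-spec : ∀ {σ N} → varᴺ σ 1 ≡ N → varᴺ σ 3 ≡ 1 → Run dot σ (2 ℕ.+ N ℕ.* 6) (λ τ →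
    varᴿ τ 4 ≈ varᴿ σ 4 + ∑ N (λ i → arrᴿ σ 3 i * arrᴿ σ 2 i))
  dot-spec {σ₀} eqb eq3 = run-for (λ i τ → varᴿ τ 4 ≈ varᴿ σ₀ 4 + ∑ i (λ i → arrᴿ σ₀ 3 i * arrᴿ σ₀ 2 i))
    ≡.refl ≡.refl ≡.refl eqb eq3 (sym (+-identityʳ _))
    λ {i} {σ} i<N eqc fr inv → run-block _
      (trans (+-cong inv (≡⇒≈ (≡.cong₂ _*_ (fr (ra 3) ≡.refl ⟨$⟩ eqc) (fr (ra 2) ≡.refl ⟨$⟩ eqc)))) (+-assoc _ _ _))

  -- Clearing an entry of array 4 at its first visit makes further visits of
  -- the same row harmless.
  leverages : Program
  leverages = For 4 2 (block
    ( loadᴺ 9 0 4 ∷ loadᴿ 5 4 9 ∷ mulᴿ 5 5 5 ∷ mulᴿ 5 8 5 ∷ loadᴿ 6 5 9 ∷ subᴿ 6 6 5 ∷ storeᴿ 5 9 6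
    ∷ zeroᴿ 5 ∷ storeᴿ 4 9 5 ∷ []))

  -- A visit lowers ℓ by c s² and sets s to 0, so ℓ - c s² is conserved. Where s has become 0, this
  -- reads as the updated leverage.
  record Leverages (σ : State) (N : ℕ) (τ : State) : Set where
    field
      balance : ∀ k → arrᴿ τ 5 k - varᴿ σ 8 * (arrᴿ τ 4 k * arrᴿ τ 4 k) ≈ arrᴿ σ 5 k - varᴿ σ 8 *
        (arrᴿ σ 4 k * arrᴿ σ 4 k)
      visited : ∀ e → e ℕ.< N → arrᴿ τ 4 (arrᴺ σ 0 e) ≈ 0#
      zeros   : ∀ k → arrᴿ σ 4 k ≈ 0# → arrᴿ τ 4 k ≈ 0#

  leverages-spec : ∀ {σ N} → varᴺ σ 2 ≡ N → varᴺ σ 3 ≡ 1 → Run leverages σ (2 ℕ.+ N ℕ.* 11) (Leverages σ N)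
  leverages-spec {σ₀} eqb eq3 = run-for (Leverages σ₀) ≡.refl ≡.refl ≡.refl eqb eq3
    (record { balance = λ _ → refl ; visited = λ _ () ; zeros = λ _ z → z })
    λ {i} {σ} i<N eqc fr inv → let open Leverages inv
                                   r = arrᴺ σ 0 (varᴺ σ 4)
                                   ℓ = arrᴿ σ 5
                                   s = arrᴿ σ 4
                                   c≈ = ≡⇒≈ (fr (rv 8) ≡.refl) in
      run-block _ (record
      { balance = λ k → bal ℓ s r (varᴿ σ 8) (varᴿ σ₀ 8) c≈ k (balance k)
      ; visited = λ e e<1+i → upd {P = _≈ 0#} s r 0# (arrᴺ σ₀ 0 e) (λ _ → refl)
          (λ r≢ → <-suc-cases e<1+i (visited e) (λ { ≡.refl → ⊥-elim (r≢ (fr (na 0) ≡.refl ⟨$⟩ eqc)) }))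
      ; zeros = λ k z → upd {P = _≈ 0#} s r 0# k (λ _ → refl) (λ _ → zeros k z)
      })
    where
    bal : ∀ (ℓ s : ℕ → ℝ) r c c₀ → c ≈ c₀ → ∀ k {x} → ℓ k - c₀ * (s k * s k) ≈ x →
      (ℓ [ r ≔ ℓ r - c * (s r * s r) ]) k - c₀ * ((s [ r ≔ 0# ]) k * (s [ r ≔ 0# ]) k) ≈ x
    bal ℓ s r c c₀ c≈ k eq with r ℕ.≡ᵇ k in r≡ᵇk
    ... | false = eq
    ... | true with ℕ.≡ᵇ⇒≡ r k (≡.subst T (≡.sym r≡ᵇk) _)
    ...   | ≡.refl = trans (trans (solve 2 (λ a b → a :- b :* (:0 :* :0) := a) refl _ c₀)
      (+-congˡ (-‿cong (*-congʳ c≈)))) eq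

  matrix-update : Program
  matrix-update = For 4 5 (block
    ( loadᴺ 9 2 4 ∷ loadᴺ 10 3 4 ∷ loadᴿ 5 2 9 ∷ loadᴿ 6 2 10 ∷ mulᴿ 5 5 6 ∷ mulᴿ 5 8 5
    ∷ loadᴿ 6 1 4 ∷ subᴿ 6 6 5 ∷ storeᴿ 1 4 6 ∷ []))

  matrix-update-spec : ∀ {σ N} → varᴺ σ 5 ≡ N → varᴺ σ 3 ≡ 1 → Run matrix-update σ (2 ℕ.+ N ℕ.* 11)
    (λ τ → ∀ p → p ℕ.< N →
    arrᴿ τ 1 p ≡ arrᴿ σ 1 p - varᴿ σ 8 * (arrᴿ σ 2 (arrᴺ σ 2 p) * arrᴿ σ 2 (arrᴺ σ 3 p)))
  matrix-update-spec {σ₀} {N} eqb eq3 = run-map (λ _ inv p → proj₁ (inv p))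
    (run-for (λ i τ → ∀ p → (p ℕ.< i → arrᴿ τ 1 p ≡ new p) × (i ℕ.≤ p → arrᴿ τ 1 p ≡ arrᴿ σ₀ 1 p)) ≡.refl ≡.refl
      ≡.refl eqb eq3
      (λ p → (λ ()) , (λ _ → ≡.refl))
      λ {i} {σ} i<N eqc fr inv → let val = ≡.cong₂ _-_ (≡.trans (≡.cong (arrᴿ σ 1) eqc) (proj₂ (inv i) ℕ.≤-refl))
                                            (≡.cong₂ _*_ (fr (rv 8) ≡.refl)
                                            (≡.cong₂ _*_ (fr (ra 2) ≡.refl ⟨$⟩ (fr (na 2) ≡.refl ⟨$⟩ eqc))
                                              (fr (ra 2) ≡.refl ⟨$⟩ (fr (na 3) ≡.refl ⟨$⟩ eqc)))) in
        run-block _ λ p →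
          (λ p<1+i → upd {P = _≡ new p} (arrᴿ σ 1) (varᴺ σ 4) _ p
            (λ c≡p → ≡.trans val (≡.cong new (≡.trans (≡.sym eqc) c≡p)))
            (λ c≢p → proj₁ (inv p) (ℕ.≤∧≢⇒< (ℕ.≤-pred p<1+i) λ { ≡.refl → c≢p eqc }))) ,
          (λ i<p → upd {P = _≡ arrᴿ σ₀ 1 p} (arrᴿ σ 1) (varᴺ σ 4) _ p
            (λ c≡p → ⊥-elim (ℕ.<-irrefl (≡.trans (≡.sym eqc) c≡p) i<p))
            (λ _ → proj₂ (inv p) (ℕ.<⇒≤ i<p))))
    where
    new : ℕ → ℝ
    new p = arrᴿ σ₀ 1 p - varᴿ σ₀ 8 * (arrᴿ σ₀ 2 (arrᴺ σ₀ 2 p) * arrᴿ σ₀ 2 (arrᴺ σ₀ 3 p))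

  -- The search also clears array 4 for the next update. A cleared cell yields the square 0, which
  -- never beats the current best, so repeated visits of a row are harmless; a row is selected only
  -- if its square is positive.
  largest : Program
  largest = For 4 2 (block (loadᴺ 9 0 4 ∷ loadᴿ 5 4 9 ∷ mulᴿ 5 5 5 ∷ zeroᴿ 6 ∷ storeᴿ 4 9 6 ∷ []) ︔
    -- There is no instruction that copies a variable; adding a variable that holds zero does it.
    If leqᴿ 5 4 Then skip Else block (addᴿ 4 5 6 ∷ addᴺ 7 9 12 ∷ constᴺ 8 1 ∷ []))

  record Largest (σ : State) (N i : ℕ) (τ : State) : Set where
    field
      entries : ∀ k → arrᴿ τ 4 k ≈ arrᴿ σ 4 k ⊎ arrᴿ τ 4 k ≈ 0# × arrᴿ σ 4 k * arrᴿ σ 4 k ≤ varᴿ τ 4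
      visited : ∀ e → e ℕ.< i → arrᴿ τ 4 (arrᴺ σ 0 e) ≈ 0#
      bound   : ∀ e → e ℕ.< i → arrᴿ σ 4 (arrᴺ σ 0 e) * arrᴿ σ 4 (arrᴺ σ 0 e) ≤ varᴿ τ 4
      0≤best  : 0# ≤ varᴿ τ 4
      best    : varᴺ τ 8 ≡ 0 × varᴿ τ 4 ≈ 0# ⊎
                varᴺ τ 8 ≡ 1 × 0# < varᴿ τ 4 × Σ[ e ∈ ℕ ] e ℕ.< N × varᴺ τ 7 ≡ arrᴺ σ 0 e
                  × varᴿ τ 4 ≈ arrᴿ σ 4 (arrᴺ σ 0 e) * arrᴿ σ 4 (arrᴺ σ 0 e)

  largest-spec : ∀ {σ N} → varᴺ σ 2 ≡ N → varᴺ σ 3 ≡ 1 → varᴺ σ 12 ≡ 0 → varᴺ σ 8 ≡ 0 → varᴿ σ 4 ≡ 0# →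
    Run largest σ (2 ℕ.+ N ℕ.* 11) (Largest σ N N)
  largest-spec {σ₀} {N} eqb eq3 eq12 eq8 eqbest = run-for (Largest σ₀ N) ≡.refl ≡.refl ≡.refl eqb eq3
    (record { entries = λ _ → inj₁ refl ; visited = λ _ () ; bound = λ _ () ; 0≤best = ≤-reflexive
      (sym (≡⇒≈ eqbest)) ; best = inj₁ (eq8 , ≡⇒≈ eqbest) })
    λ {i} {σ} i<N eqc fr inv → let open Largest inv
                                   r = arrᴺ σ 0 (varᴺ σ 4)
                                   s = arrᴿ σ 4
                                   s₀ = arrᴿ σ₀ 4
                                   x = s r * s r
                                   r≡ = fr (na 0) ≡.refl ⟨$⟩ eqc
                                   visited′ : ∀ e → e ℕ.< suc i → (s [ r ≔ 0# ]) (arrᴺ σ₀ 0 e) ≈ 0#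
                                   visited′ = λ e e<1+i → upd {P = _≈ 0#} s r 0# (arrᴺ σ₀ 0 e) (λ _ → refl)
                                     (λ r≢ → <-suc-cases e<1+i (visited e) (λ { ≡.refl → ⊥-elim (r≢ r≡) }))
                                   entries′ : ∀ b → varᴿ σ 4 ≤ b → x ≤ b → ∀ k → (s [ r ≔ 0# ]) k ≈ s₀ k ⊎
                                     (s [ r ≔ 0# ]) k ≈ 0# × s₀ k * s₀ k ≤ b
                                   entries′ = λ b old≤ x≤ k → upd {P = λ y → y ≈ s₀ k ⊎ y ≈ 0# × s₀ k * s₀ k ≤
                                     b} s r 0# k
                                     (λ { ≡.refl → inj₂ (refl , old-bound (entries r) old≤ x≤) })
                                     (λ _ → weaken old≤ (entries k))
                                   bound′ : ∀ b → varᴿ σ 4 ≤ b → x ≤ b → ∀ e → e ℕ.< suc i → s₀ (arrᴺ σ₀ 0 e) *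
                                     s₀ (arrᴺ σ₀ 0 e) ≤ b
                                   bound′ = λ b old≤ x≤ e e<1+i → <-suc-cases e<1+i (λ e<i → ≤-trans
                                     (bound e e<i) old≤)
                                     (λ { ≡.refl → ≡.subst (λ r → s₀ r * s₀ r ≤ b) r≡ (old-bound (entries r)
                                       old≤ x≤) }) in
      run-block-then (loadᴺ 9 0 4 ∷ loadᴿ 5 4 9 ∷ mulᴿ 5 5 5 ∷ zeroᴿ 6 ∷ storeᴿ 4 9 6 ∷ []) (run-if
        (λ t → let x≤ = does-true (x ≤? varᴿ σ 4) t in run-skip (record
          { entries = entries′ (varᴿ σ 4) ≤-refl x≤ ; visited = visited′ ; bound = bound′ (varᴿ σ 4) ≤-refl x≤
          ; 0≤best = 0≤best ; best = best }))
        (λ t → let <x = ≰⇒> (does-false (x ≤? varᴿ σ 4) t)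
                   x≤ = ≤-reflexive (sym (+-identityʳ x))
                   old≤ = ≤-trans (proj₁ <x) x≤
                   0<x = ≤-<-trans 0≤best <x in run-block _ (record
          { entries = entries′ (x + 0#) old≤ x≤ ; visited = visited′ ; bound = bound′ (x + 0#) old≤ x≤
          ; 0≤best = ≤-trans 0≤best old≤
          ; best = inj₂ (≡.refl , <-respʳ-≈ (sym (+-identityʳ x)) 0<x , i , i<N ,
              ≡.trans (≡.cong₂ ℕ._+_ r≡ (≡.trans (fr (nv 12) ≡.refl) eq12)) (ℕ.+-identityʳ _) ,
              trans (+-identityʳ x) (trans (old-entry (entries r) 0<x) (≡⇒≈ (≡.cong (λ r → s₀ r * s₀ r) r≡)))) })))
    where
    old-bound : ∀ {a b c x} → a ≈ b ⊎ a ≈ 0# × b * b ≤ c → c ≤ x → a * a ≤ x → b * b ≤ x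
    old-bound (inj₁ a≈b) _ le = ≤-trans (≤-reflexive (*-cong (sym a≈b) (sym a≈b))) le
    old-bound (inj₂ (_ , le)) c≤x _ = ≤-trans le c≤x
    weaken : ∀ {a b c x} → c ≤ x → a ≈ b ⊎ a ≈ 0# × b * b ≤ c → a ≈ b ⊎ a ≈ 0# × b * b ≤ x
    weaken _ (inj₁ eq) = inj₁ eq
    weaken c≤x (inj₂ (z , le)) = inj₂ (z , ≤-trans le c≤x)
    old-entry : ∀ {a b c} → a ≈ b ⊎ a ≈ 0# × b * b ≤ c → 0# < a * a → a * a ≈ b * b
    old-entry (inj₁ a≈b) _ = *-cong a≈b a≈b
    old-entry (inj₂ (a≈0 , _)) 0<a² = ⊥-elim (<⇒≉ 0<a² (trans (*-congʳ a≈0) (zeroˡ _)))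

  -- Rows are scanned through the nonzero entries, at a cost of nnz(A) instead of `n`. A row without
  -- entries is zero, and so is its leverage.
  search-large : Program
  search-large = For 4 2 (block (loadᴺ 9 0 4 ∷ loadᴿ 5 5 9 ∷ []) ︔
    If leqᴿ 5 1 Then skip Else block (addᴺ 7 9 12 ∷ constᴺ 8 1 ∷ []))

  SearchLarge : State → ℕ → ℕ → State → Set
  SearchLarge σ N i τ =
    varᴺ τ 8 ≡ 0 × (∀ e → e ℕ.< i → arrᴿ σ 5 (arrᴺ σ 0 e) ≤ varᴿ σ 1) ⊎
    varᴺ τ 8 ≡ 1 × Σ[ e ∈ ℕ ] e ℕ.< N × varᴺ τ 7 ≡ arrᴺ σ 0 e × varᴿ σ 1 < arrᴿ σ 5 (arrᴺ σ 0 e)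

  search-large-spec : ∀ {σ N} → varᴺ σ 2 ≡ N → varᴺ σ 3 ≡ 1 → varᴺ σ 12 ≡ 0 → varᴺ σ 8 ≡ 0 →
    Run search-large σ (2 ℕ.+ N ℕ.* 7) (SearchLarge σ N N)
  search-large-spec {σ₀} {N} eqb eq3 eq12 eq8 = run-for (SearchLarge σ₀ N) ≡.refl ≡.refl ≡.refl eqb eq3
    (inj₁ (eq8 , λ _ ()))
    λ {i} {σ} i<N eqc fr inv → let r≡ = fr (na 0) ≡.refl ⟨$⟩ eqc
                                   ℓ≡ = fr (ra 5) ≡.refl ⟨$⟩ r≡
                                   one≡ = fr (rv 1) ≡.refl in
      run-block-then (loadᴺ 9 0 4 ∷ loadᴿ 5 5 9 ∷ []) (run-if
        (λ t → run-skip (extend {σ = σ} inv (≡.subst₂ _≤_ ℓ≡ one≡ (does-true (arrᴿ σ 5 (arrᴺ σ 0 (varᴺ σ 4)) ≤?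
          varᴿ σ 1) t))))
        (λ t → run-block _ (inj₂ (≡.refl , i , i<N ,
          ≡.trans (≡.cong₂ ℕ._+_ r≡ (≡.trans (fr (nv 12) ≡.refl) eq12)) (ℕ.+-identityʳ _) ,
          ≡.subst₂ _<_ one≡ ℓ≡ (≰⇒> (does-false (arrᴿ σ 5 (arrᴺ σ 0 (varᴺ σ 4)) ≤? varᴿ σ 1) t))))))
    where
    extend : ∀ {i σ} → SearchLarge σ₀ N i σ → arrᴿ σ₀ 5 (arrᴺ σ₀ 0 i) ≤ varᴿ σ₀ 1 → SearchLarge σ₀ N (suc i) σ
    extend (inj₁ (eq , all)) le = inj₁ (eq , λ e e<1+i → <-suc-cases e<1+i (all e) λ { ≡.refl → le })
    extend (inj₂ found) _ = inj₂ found

  search-small : Program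
  search-small = For 4 2 (block (loadᴺ 9 0 4 ∷ loadᴿ 5 5 9 ∷ loadᴺ 10 4 9 ∷ []) ︔
    If lessᴺ 12 10 Then If leqᴿ 5 2 Then block (addᴺ 7 9 12 ∷ constᴺ 8 1 ∷ []) Else skip Else skip)

  SearchSmall : State → ℕ → ℕ → State → Set
  SearchSmall σ N i τ =
    varᴺ τ 8 ≡ 0 × (∀ e → e ℕ.< i → 0 ℕ.< arrᴺ σ 4 (arrᴺ σ 0 e) → varᴿ σ 2 ≤ arrᴿ σ 5 (arrᴺ σ 0 e)) ⊎
    varᴺ τ 8 ≡ 1 × Σ[ e ∈ ℕ ] e ℕ.< N × varᴺ τ 7 ≡ arrᴺ σ 0 e × 0 ℕ.< arrᴺ σ 4 (arrᴺ σ 0 e) × arrᴿ σ 5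
      (arrᴺ σ 0 e) ≤ varᴿ σ 2

  search-small-spec : ∀ {σ N} → varᴺ σ 2 ≡ N → varᴺ σ 3 ≡ 1 → varᴺ σ 12 ≡ 0 → varᴺ σ 8 ≡ 0 →
    Run search-small σ (2 ℕ.+ N ℕ.* 9) (SearchSmall σ N N)
  search-small-spec {σ₀} {N} eqb eq3 eq12 eq8 = run-for (SearchSmall σ₀ N) ≡.refl ≡.refl ≡.refl eqb eq3
    (inj₁ (eq8 , λ _ ()))
    λ {i} {σ} i<N eqc fr inv → let r≡ = fr (na 0) ≡.refl ⟨$⟩ eqc
                                   ℓ≡ = fr (ra 5) ≡.refl ⟨$⟩ r≡
                                   in≡ = fr (na 4) ≡.refl ⟨$⟩ r≡
                                   zero≡ = ≡.trans (fr (nv 12) ≡.refl) eq12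
                                   ¼≡ = fr (rv 2) ≡.refl
                                   ℓ = arrᴿ σ 5 (arrᴺ σ 0 (varᴺ σ 4))
                                   mem = arrᴺ σ 4 (arrᴺ σ 0 (varᴺ σ 4)) in
      run-block-then (loadᴺ 9 0 4 ∷ loadᴿ 5 5 9 ∷ loadᴺ 10 4 9 ∷ []) (run-if
        (λ t → run-if
          (λ t′ → run-block _ (inj₂ (≡.refl , i , i<N ,
            ≡.trans (≡.cong₂ ℕ._+_ r≡ zero≡) (ℕ.+-identityʳ _) ,
            ≡.subst₂ ℕ._<_ zero≡ in≡ (does-true (varᴺ σ 12 ℕ.<? mem) t) ,
            ≡.subst₂ _≤_ ℓ≡ ¼≡ (does-true (ℓ ≤? varᴿ σ 2) t′))))
          (λ t′ → run-skip (extend {σ = σ} inv λ _ → ≡.subst₂ _≤_ ¼≡ ℓ≡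
            (proj₁ (≰⇒> (does-false (ℓ ≤? varᴿ σ 2) t′))))))
        (λ t → run-skip (extend {σ = σ} inv λ pos → ⊥-elim (does-false (varᴺ σ 12 ℕ.<? mem) t (≡.subst₂ ℕ._<_
          (≡.sym zero≡) (≡.sym in≡) pos)))))
    where
    extend : ∀ {i σ} → SearchSmall σ₀ N i σ → (0 ℕ.< arrᴺ σ₀ 4 (arrᴺ σ₀ 0 i) → varᴿ σ₀ 2 ≤ arrᴿ σ₀ 5
      (arrᴺ σ₀ 0 i)) → SearchSmall σ₀ N (suc i) σ
    extend (inj₁ (eq , all)) le = inj₁ (eq , λ e e<1+i → <-suc-cases e<1+i (all e) λ { ≡.refl → le })
    extend (inj₂ found) _ = inj₂ found

  -- Initialisation and output

  -- Naturals cannot be multiplied or divided, so the row and the column of each position of `W` in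
  -- row-major order are tabulated once. The running count ends up as d² in variable 5.
  indices : Program
  indices = instr (constᴺ 5 0) ︔ For 6 1 (For 4 1 (block (storeᴺ 2 5 6 ∷ storeᴺ 3 5 4 ∷ addᴺ 5 5 3 ∷ [])))

  -- Stated as division with remainder by `d`, which determines row and column by `flat-injective`.
  record Indices (d p : ℕ) (τ : State) : Set where
    field
      count  : varᴺ τ 5 ≡ p
      column : ∀ q → q ℕ.< p → arrᴺ τ 3 q ℕ.< d
      decode : ∀ q → q ℕ.< p → arrᴺ τ 2 q ℕ.* d ℕ.+ arrᴺ τ 3 q ≡ q

  indices-spec : ∀ {σ d} → varᴺ σ 1 ≡ d → varᴺ σ 3 ≡ 1 →
    Run indices σ (1 ℕ.+ (2 ℕ.+ d ℕ.* (2 ℕ.+ (2 ℕ.+ d ℕ.* 5)))) (Indices d (d ℕ.* d))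
  indices-spec {σ₀} {d} eq1 eq3 = run-seq {Q = _≡ exec (constᴺ 5 0) σ₀} (run ⇓-instr ℕ.≤-refl ≡.refl) λ { _ ≡.refl →
    run-for (λ i τ → Indices d (i ℕ.* d) τ) ≡.refl ≡.refl ≡.refl eq1 eq3
      (record { count = ≡.refl ; column = λ _ () ; decode = λ _ () })
      λ {i} {σ} i<d eqc fr inv → run-map (λ { _ (_ , P) → record
          { count = ≡.trans (Indices.count P) (ℕ.+-comm (i ℕ.* d) d)
          ; column = λ q lt → Indices.column P q (ℕ.≤-trans lt (ℕ.≤-reflexive (ℕ.+-comm d (i ℕ.* d))))
          ; decode = λ q lt → Indices.decode P q (ℕ.≤-trans lt (ℕ.≤-reflexive (ℕ.+-comm d (i ℕ.* d)))) } })
        (run-for (λ j τ → varᴺ τ 6 ≡ i × Indices d (i ℕ.* d ℕ.+ j) τ) ≡.refl ≡.refl ≡.refl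
          (≡.trans (fr (nv 1) ≡.refl) eq1) (≡.trans (fr (nv 3) ≡.refl) eq3)
          (eqc , ≡.subst (λ p → Indices d p (exec (constᴺ 4 0) σ)) (≡.sym (ℕ.+-identityʳ (i ℕ.* d)))
            (record { count = Indices.count inv ; column = Indices.column inv ; decode = Indices.decode inv }))
          λ { {j} {τ} j<d eqj fr′ (eq6 , P) → run-block _ (eq6 , advance i j τ j<d (≡.trans (fr′ (nv 3) ≡.refl)
            (≡.trans (fr (nv 3) ≡.refl) eq3)) eq6 eqj P) }) }
    where
    advance : ∀ i j τ → j ℕ.< d → varᴺ τ 3 ≡ 1 → varᴺ τ 6 ≡ i → varᴺ τ 4 ≡ j → Indices d (i ℕ.* d ℕ.+ j) τ →
      Indices d (i ℕ.* d ℕ.+ suc j) (execs (storeᴺ 2 5 6 ∷ storeᴺ 3 5 4 ∷ addᴺ 5 5 3 ∷ addᴺ 4 4 3 ∷ []) τ)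
    advance i j τ j<d eq3 eq6 eq4 P = record
      { count = ≡.trans (≡.cong₂ ℕ._+_ count eq3) (≡.trans (ℕ.+-comm _ 1) (≡.sym next))
      ; column = λ q lt → <-suc-cases (ℕ.≤-trans lt (ℕ.≤-reflexive next)) (λ q<p → ≡.subst (ℕ._< d)
        (≡.sym (≔-there (arrᴺ τ 3) p q _ (other q<p))) (column q q<p))
          (λ q≡ → ≡.subst (ℕ._< d) (≡.sym (≡.trans (≔-here (arrᴺ τ 3) p q _ (≡.trans count (≡.sym q≡))) eq4)) j<d)
      ; decode = λ q lt → <-suc-cases (ℕ.≤-trans lt (ℕ.≤-reflexive next)) (λ q<p → ≡.trans
        (≡.cong₂ (λ a b → a ℕ.* d ℕ.+ b) (≔-there (arrᴺ τ 2) p q _ (other q<p)) (≔-there (arrᴺ τ 3) p q _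
        (other q<p))) (decode q q<p))
          (λ q≡ → ≡.trans (≡.cong₂ (λ a b → a ℕ.* d ℕ.+ b)
             (≡.trans (≔-here (arrᴺ τ 2) p q _ (≡.trans count (≡.sym q≡))) eq6) (≡.trans (≔-here (arrᴺ τ 3) p q
               _ (≡.trans count (≡.sym q≡))) eq4)) (≡.sym q≡)) }
      where
      open Indices P
      p = varᴺ τ 5
      next : i ℕ.* d ℕ.+ suc j ≡ suc (i ℕ.* d ℕ.+ j)
      next = ℕ.+-suc (i ℕ.* d) j
      other : ∀ {q} → q ℕ.< i ℕ.* d ℕ.+ j → p ≢ q
      other q<p p≡q = ℕ.<-irrefl (≡.trans (≡.sym p≡q) count) q<p

  flat-< : ∀ {d a b i j} → a ℕ.< i → b ℕ.< d → a ℕ.* d ℕ.+ b ℕ.< i ℕ.* d ℕ.+ j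
  flat-< {d} {a} {j = j} a<i b<d = ℕ.<-≤-trans (ℕ.+-monoʳ-< (a ℕ.* d) b<d)
    (ℕ.≤-trans (ℕ.≤-reflexive (ℕ.+-comm (a ℕ.* d) d)) (ℕ.≤-trans (ℕ.*-monoˡ-≤ d a<i) (ℕ.m≤m+n _ j)))

  flat-injective : ∀ {d a b i j} → a ℕ.* d ℕ.+ b ≡ i ℕ.* d ℕ.+ j → b ℕ.< d → j ℕ.< d → a ≡ i × b ≡ j
  flat-injective {d} {a} {b} {i} {j} eq b<d j<d with ℕ.<-cmp a i
  ... | tri≈ _ ≡.refl _ = ≡.refl , ℕ.+-cancelˡ-≡ (a ℕ.* d) b j eq
  ... | tri< a<i _ _ = ⊥-elim (ℕ.<-irrefl eq (flat-< {d} a<i b<d))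
  ... | tri> _ _ i<a = ⊥-elim (ℕ.<-irrefl (≡.sym eq) (flat-< {d} i<a j<d))

  indices-exact : ∀ {d τ} → Indices d (d ℕ.* d) τ → ∀ {i j} → i ℕ.< d → j ℕ.< d →
    i ℕ.* d ℕ.+ j ℕ.< d ℕ.* d × arrᴺ τ 2 (i ℕ.* d ℕ.+ j) ≡ i × arrᴺ τ 3 (i ℕ.* d ℕ.+ j) ≡ j
  indices-exact {d} I {i} {j} i<d j<d = lt , flat-injective (decode _ lt) (column _ lt) j<d
    where
    open Indices I
    lt : i ℕ.* d ℕ.+ j ℕ.< d ℕ.* d
    lt = ℕ.<-≤-trans (ℕ.+-monoʳ-< (i ℕ.* d) j<d) (ℕ.≤-trans (ℕ.≤-reflexive (ℕ.+-comm (i ℕ.* d) d))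
      (ℕ.*-monoˡ-≤ d i<d))

  -- Array 1 is initially zero, so only the diagonal is written. Equality of two naturals is the
  -- failure of both strict comparisons.
  identity : Program
  identity = For 4 5 (block (loadᴺ 9 2 4 ∷ loadᴺ 10 3 4 ∷ []) ︔
    If lessᴺ 9 10 Then skip Else If lessᴺ 10 9 Then skip Else block (storeᴿ 1 4 1 ∷ []))

  record Identity (σ : State) (i : ℕ) (τ : State) : Set where
    field
      diagonal : ∀ p → p ℕ.< i → arrᴺ σ 2 p ≡ arrᴺ σ 3 p → arrᴿ τ 1 p ≡ varᴿ σ 1
      off      : ∀ p → arrᴺ σ 2 p ≢ arrᴺ σ 3 p → arrᴿ τ 1 p ≡ arrᴿ σ 1 p

  identity-spec : ∀ {σ N} → varᴺ σ 5 ≡ N → varᴺ σ 3 ≡ 1 → Run identity σ (2 ℕ.+ N ℕ.* 7) (Identity σ N)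
  identity-spec {σ₀} {N} eqb eq3 = run-for (Identity σ₀) ≡.refl ≡.refl ≡.refl eqb eq3
    (record { diagonal = λ _ () ; off = λ _ _ → ≡.refl })
    λ {i} {σ} i<N eqc fr inv → let r≡ = ≡.cong₂ (λ f x → f x) (fr (na 2) ≡.refl) eqc
                                   c≡ = ≡.cong₂ (λ f x → f x) (fr (na 3) ≡.refl) eqc
                                   r = arrᴺ σ 2 (varᴺ σ 4)
                                   c = arrᴺ σ 3 (varᴺ σ 4) in
      run-block-then (loadᴺ 9 2 4 ∷ loadᴺ 10 3 4 ∷ []) (run-if
        (λ t → run-skip (keep {σ = σ} ≡.refl inv (λ r≡c → ℕ.<-irrefl (≡.trans r≡ (≡.trans r≡c (≡.sym c≡)))
          (does-true (r ℕ.<? c) t))))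
        (λ t → run-if
          (λ t′ → run-skip (keep {σ = σ} ≡.refl inv (λ r≡c → ℕ.<-irrefl (≡.trans c≡ (≡.trans (≡.sym r≡c)
            (≡.sym r≡))) (does-true (c ℕ.<? r) t′))))
          (λ t′ → run-block _ (write {σ = σ} ≡.refl inv eqc (fr (rv 1) ≡.refl)
            (≡.trans (≡.sym r≡) (≡.trans (ℕ.≤-antisym (ℕ.≮⇒≥ (does-false (c ℕ.<? r) t′))
              (ℕ.≮⇒≥ (does-false (r ℕ.<? c) t))) c≡))))))
    where
    keep : ∀ {i σ τ} → arrᴿ τ 1 ≡ arrᴿ σ 1 → Identity σ₀ i σ → arrᴺ σ₀ 2 i ≢ arrᴺ σ₀ 3 i → Identity σ₀ (suc i) τ
    keep same I neq = record
      { diagonal = λ p lt eq → <-suc-cases lt (λ p<i → ≡.trans (≡.cong (λ f → f p) same) (diagonal p p<i eq))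
        (λ { ≡.refl → ⊥-elim (neq eq) })
      ; off = λ p neq → ≡.trans (≡.cong (λ f → f p) same) (off p neq) }
      where open Identity I
    write : ∀ {i σ τ} → arrᴿ τ 1 ≡ arrᴿ σ 1 [ varᴺ σ 4 ≔ varᴿ σ 1 ] → Identity σ₀ i σ → varᴺ σ 4 ≡ i → varᴿ σ 1
      ≡ varᴿ σ₀ 1 → arrᴺ σ₀ 2 i ≡ arrᴺ σ₀ 3 i →
      Identity σ₀ (suc i) τ
    write {i} {σ} same I eqc one≡ eq = record
      { diagonal = λ p lt eq′ → <-suc-cases lt
          (λ p<i → ≡.trans (≡.cong (λ f → f p) same) (≡.trans (≔-there (arrᴿ σ 1) (varᴺ σ 4) p _
            (λ c≡p → ℕ.<-irrefl (≡.trans (≡.sym c≡p) eqc) p<i)) (diagonal p p<i eq′)))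
          (λ p≡i → ≡.trans (≡.cong (λ f → f p) same) (≡.trans (≔-here (arrᴿ σ 1) (varᴺ σ 4) p _
            (≡.trans eqc (≡.sym p≡i))) one≡))
      ; off = λ p neq → ≡.trans (≡.cong (λ f → f p) same) (≡.trans (≔-there (arrᴿ σ 1) (varᴺ σ 4) p _
        (λ c≡p → neq (≡.subst (λ p → arrᴺ σ₀ 2 p ≡ arrᴺ σ₀ 3 p) (≡.trans (≡.sym eqc) c≡p) eq))) (off p neq)) }
      where open Identity I

  -- Erasing the mark of a row as it is emitted prevents its repetition when another entry of the
  -- same row is met.
  output : Program
  output = instr (constᴺ 0 0) ︔ For 4 2 (block (loadᴺ 9 0 4 ∷ loadᴺ 10 4 9 ∷ []) ︔
    If lessᴺ 12 10 Then block (storeᴺ 0 0 9 ∷ addᴺ 0 0 3 ∷ storeᴺ 4 9 12 ∷ []) Else skip)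

  -- The output overwrites the part of array 0 that has already been read.
  record Output (σ : State) (i : ℕ) (τ : State) : Set where
    field
      count≤   : varᴺ τ 0 ℕ.≤ i
      unread   : ∀ e → i ℕ.≤ e → arrᴺ τ 0 e ≡ arrᴺ σ 0 e
      erased   : ∀ e → e ℕ.< i → arrᴺ τ 4 (arrᴺ σ 0 e) ≡ 0
      sound    : ∀ x → x ℕ.< varᴺ τ 0 → 0 ℕ.< arrᴺ σ 4 (arrᴺ τ 0 x) × arrᴺ τ 4 (arrᴺ τ 0 x) ≡ 0 ×
                   (Σ[ e ∈ ℕ ] e ℕ.< i × arrᴺ τ 0 x ≡ arrᴺ σ 0 e)
      distinct : ∀ {x y} → x ℕ.< y → y ℕ.< varᴺ τ 0 → arrᴺ τ 0 x ≢ arrᴺ τ 0 y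
      complete : ∀ k → arrᴺ τ 4 k ≡ arrᴺ σ 4 k ⊎ (Σ[ x ∈ ℕ ] x ℕ.< varᴺ τ 0 × arrᴺ τ 0 x ≡ k)

  output-spec : ∀ {σ N} → varᴺ σ 2 ≡ N → varᴺ σ 3 ≡ 1 → varᴺ σ 12 ≡ 0 →
    Run output σ (1 ℕ.+ (2 ℕ.+ N ℕ.* 8)) (Output σ N)
  output-spec {σ₀} {N} eq2 eq3 eq12 = run-seq {Q = _≡ exec (constᴺ 0 0) σ₀} (run ⇓-instr ℕ.≤-refl ≡.refl)
    λ { _ ≡.refl →
    run-for (Output σ₀) ≡.refl ≡.refl ≡.refl eq2 eq3
      (record { count≤ = z≤n ; unread = λ _ _ → ≡.refl ; erased = λ _ () ; sound = λ _ () ; distinct = λ _ () ;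
        complete = λ _ → inj₁ ≡.refl })
      λ {i} {σ} i<N eqc fr inv → let open Output inv
                                     r = arrᴺ σ 0 (varᴺ σ 4)
                                     r≡ = ≡.trans (≡.cong (arrᴺ σ 0) eqc) (unread i ℕ.≤-refl)
                                     zero≡ = ≡.trans (fr (nv 12) ≡.refl) eq12 in
        run-block-then (loadᴺ 9 0 4 ∷ loadᴺ 10 4 9 ∷ []) (run-if {t = 3}
          (λ t → run-block _ (emit {i} {σ} inv eqc r≡ (≡.trans (fr (nv 3) ≡.refl) eq3) zero≡
                   (≡.subst (ℕ._< arrᴺ σ 4 r) zero≡ (does-true (varᴺ σ 12 ℕ.<? arrᴺ σ 4 r) t))))
          (λ t → run-skip (record
            { count≤ = ℕ.m≤n⇒m≤1+n count≤ ; unread = λ e le → unread e (ℕ.<⇒≤ le)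
            ; erased = λ e lt → <-suc-cases lt (erased e) (λ { ≡.refl → ≡.trans (≡.cong (arrᴺ σ 4) (≡.sym r≡))
                (ℕ.n≤0⇒n≡0 (≡.subst (arrᴺ σ 4 r ℕ.≤_) zero≡ (ℕ.≮⇒≥ (does-false (varᴺ σ 12 ℕ.<? arrᴺ σ 4 r) t)))) })
            ; sound = λ x lt → let (a , b , e , e<i , eq) = sound x lt in a , b , e , ℕ.m≤n⇒m≤1+n e<i , eq
            ; distinct = distinct ; complete = complete }))) }
    where
    emit : ∀ {i σ} → Output σ₀ i σ → varᴺ σ 4 ≡ i → arrᴺ σ 0 (varᴺ σ 4) ≡ arrᴺ σ₀ 0 i → varᴺ σ 3 ≡ 1 → varᴺ σ 12
      ≡ 0 →
      0 ℕ.< arrᴺ σ 4 (arrᴺ σ 0 (varᴺ σ 4)) →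
      Output σ₀ (suc i) (execs (loadᴺ 9 0 4 ∷ loadᴺ 10 4 9 ∷ storeᴺ 0 0 9 ∷ addᴺ 0 0 3 ∷ storeᴺ 4 9 12 ∷ addᴺ 4
        4 3 ∷ []) σ)
    emit {i} {σ} O eqc r≡ eq3 zero≡ pos = record
      { count≤ = ℕ.≤-trans (ℕ.≤-reflexive m′≡) (s≤s count≤)
      -- The write position `m` is at most the read position `i`, so cells beyond `i` are intact.
      ; unread = λ e i<e → ≡.trans (≔-there a m e r (λ m≡e → ℕ.<-irrefl m≡e (ℕ.<-≤-trans (s≤s count≤) i<e)))
        (unread e (ℕ.<⇒≤ i<e))
      ; erased = λ e e<1+i → <-suc-cases e<1+i (λ e<i → erase (arrᴺ σ₀ 0 e) (erased e e<i))
          (λ { ≡.refl → ≡.trans (≔-here b r (arrᴺ σ₀ 0 e) _ r≡) zero≡ })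
      ; sound = λ x x<m′ → <-suc-cases (below x<m′)
          (λ x<m → let (p , z , e , e<i , eq) = sound x x<m in
            ≡.subst (λ k → 0 ℕ.< arrᴺ σ₀ 4 k) (≡.sym (old x<m)) p ,
            ≡.trans (≡.cong b′ (old x<m)) (erase (a x) z) ,
            e , ℕ.m≤n⇒m≤1+n e<i , ≡.trans (old x<m) eq)
          (λ x≡m → ≡.subst (λ k → 0 ℕ.< arrᴺ σ₀ 4 k) (≡.sym (new x≡m)) pos₀ ,
            ≡.trans (≡.cong b′ (new x≡m)) (≡.trans (≔-here b r r _ ≡.refl) zero≡) ,
            i , ℕ.≤-refl , ≡.trans (new x≡m) r≡)
      ; distinct = λ {x} {y} x<y y<m′ → <-suc-cases (below y<m′)
          (λ y<m eq → distinct x<y y<m (≡.trans (≡.sym (old (ℕ.<-trans x<y y<m))) (≡.trans eq (old y<m))))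
          (λ y≡m eq → fresh (≡.subst (x ℕ.<_) y≡m x<y)
            (≡.trans (≡.sym (old (≡.subst (x ℕ.<_) y≡m x<y))) (≡.trans eq (new y≡m))))
      ; complete = λ k → comp k (complete k)
      }
      where
      open Output O
      a = arrᴺ σ 0
      b = arrᴺ σ 4
      m = varᴺ σ 0
      r = a (varᴺ σ 4)
      a′ = a [ m ≔ r ]
      b′ = b [ r ≔ varᴺ σ 12 ]
      m′≡ : m ℕ.+ varᴺ σ 3 ≡ suc m
      m′≡ = ≡.trans (≡.cong (m ℕ.+_) eq3) (ℕ.+-comm m 1)
      below : ∀ {x} → x ℕ.< m ℕ.+ varᴺ σ 3 → x ℕ.< suc m
      below lt = ℕ.≤-trans lt (ℕ.≤-reflexive m′≡)
      above : ∀ {x} → x ℕ.< suc m → x ℕ.< m ℕ.+ varᴺ σ 3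
      above lt = ℕ.≤-trans lt (ℕ.≤-reflexive (≡.sym m′≡))
      old : ∀ {x} → x ℕ.< m → a′ x ≡ a x
      old {x} x<m = ≔-there a m x r (λ m≡x → ℕ.<-irrefl (≡.sym m≡x) x<m)
      new : ∀ {x} → x ≡ m → a′ x ≡ r
      new {x} x≡m = ≔-here a m x r (≡.sym x≡m)
      erase : ∀ k → b k ≡ 0 → b′ k ≡ 0
      erase k z with r ℕ.≡ᵇ k
      ... | true = zero≡
      ... | false = z
      fresh : ∀ {x} → x ℕ.< m → a x ≢ r
      fresh {x} x<m eq = ℕ.<-irrefl (≡.sym (≡.trans (≡.cong b (≡.sym eq)) (proj₁ (proj₂ (sound x x<m))))) pos
      pos₀ : 0 ℕ.< arrᴺ σ₀ 4 r
      pos₀ with complete r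
      ... | inj₁ eq = ≡.subst (0 ℕ.<_) eq pos
      ... | inj₂ (x , x<m , eq) = ⊥-elim (fresh x<m eq)
      comp : ∀ k → b k ≡ arrᴺ σ₀ 4 k ⊎ (Σ[ x ∈ ℕ ] x ℕ.< m × a x ≡ k) →
        b′ k ≡ arrᴺ σ₀ 4 k ⊎ (Σ[ x ∈ ℕ ] x ℕ.< m ℕ.+ varᴺ σ 3 × a′ x ≡ k)
      comp k (inj₂ (x , x<m , eq)) = inj₂ (x , above (ℕ.m≤n⇒m≤1+n x<m) , ≡.trans (old x<m) eq)
      comp k (inj₁ eq) with r ℕ.≟ k
      ... | yes r≡k = inj₂ (m , above ℕ.≤-refl , ≡.trans (new ≡.refl) r≡k)
      ... | no r≢k = inj₁ (≡.trans (≔-there b r k _ r≢k) eq)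

  -- Sums over the nonzero entries

  open Spanning R using
    ( Matrix; nonzeros; nnz; array; input; Outputs; timeBound; sizeBound; _≤Õ[_,_]_
    ; IsWellConditionedSpanningSet )

  ∑-cong : ∀ N {f g : ℕ → ℝ} → (∀ e → e ℕ.< N → f e ≈ g e) → ∑ N f ≈ ∑ N g
  ∑-cong zero _ = refl
  ∑-cong (suc N) f≈g = +-cong (∑-cong N λ e e<N → f≈g e (ℕ.m≤n⇒m≤1+n e<N)) (f≈g N ℕ.≤-refl)

  ∑-cons : ∀ N (f : ℕ → ℝ) → ∑ (suc N) f ≈ f 0 + ∑ N (f ∘ suc)
  ∑-cons zero f = +-comm 0# (f 0)
  ∑-cons (suc N) f = trans (+-congʳ (∑-cons N f)) (+-assoc (f 0) _ _)

  ∑≈sum : ∀ N (f : ℕ → ℝ) → ∑ N f ≈ sum {N} (f ∘ toℕ)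
  ∑≈sum zero f = refl
  ∑≈sum (suc N) f = trans (∑-cons N f) (+-congˡ (∑≈sum N (f ∘ suc)))

  ∑-+ : ∀ a b (f : ℕ → ℝ) → ∑ (a ℕ.+ b) f ≈ ∑ a f + ∑ b (λ k → f (a ℕ.+ k))
  ∑-+ zero b f = sym (+-identityˡ _)
  ∑-+ (suc a) b f = trans (∑-cons (a ℕ.+ b) f) (trans (+-congˡ (∑-+ a b (f ∘ suc)))
    (trans (sym (+-assoc (f 0) _ _)) (+-congʳ (sym (∑-cons a f)))))

  ∑-flat : ∀ m d (f : ℕ → ℝ) → ∑ (m ℕ.* d) f ≈ sum {m} (λ i → sum {d} (λ j → f (toℕ i ℕ.* d ℕ.+ toℕ j)))
  ∑-flat zero d f = refl
  ∑-flat (suc m) d f = trans (∑-+ d (m ℕ.* d) f) (+-cong (∑≈sum d f) (trans (∑-flat m d (λ k → f (d ℕ.+ k)))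
    (sum-cong {m} λ i → sum-cong {d} λ j → reflexive (≡.cong f (≡.sym (ℕ.+-assoc d _ _))))))

  hit-cong : ∀ i j {x y} → x ≈ y → hit i j x ≈ hit i j y
  hit-cong i j x≈y with i ℕ.≡ᵇ j
  ... | true = x≈y
  ... | false = refl

  hit-≡ : ∀ {i j} x → i ≡ j → hit i j x ≈ x
  hit-≡ {i} {j} x i≡j = reflexive (≡.cong (λ b → if b then x else 0#) (dec-true (i ℕ.≟ j) i≡j))

  hit-≢ : ∀ {i j} x → i ≢ j → hit i j x ≈ 0#
  hit-≢ {i} {j} x i≢j = reflexive (≡.cong (λ b → if b then x else 0#) (dec-false (i ℕ.≟ j) i≢j))

  hit-zero : ∀ i j {x} → x ≈ 0# → hit i j x ≈ 0#
  hit-zero i j x≈0 with i ℕ.≡ᵇ j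
  ... | true = x≈0
  ... | false = refl

  sum-hit : ∀ {n} (r : Fin n) (f : Fin n → ℝ) → sum (λ i → hit (toℕ i) (toℕ r) (f i)) ≈ f r
  sum-hit r f = trans (sum-single r λ i i≢r → hit-≢ (f i) (i≢r ∘ Fin.toℕ-injective)) (hit-≡ {toℕ r} (f r) ≡.refl)

  sumᴸ : ∀ {X : Set} → (X → ℝ) → List X → ℝ
  sumᴸ f [] = 0#
  sumᴸ f (x ∷ xs) = f x + sumᴸ f xs

  sumᴸ-++ : ∀ {X : Set} (f : X → ℝ) xs ys → sumᴸ f (xs ++ ys) ≈ sumᴸ f xs + sumᴸ f ys
  sumᴸ-++ f [] ys = sym (+-identityˡ _)
  sumᴸ-++ f (x ∷ xs) ys = trans (+-congˡ (sumᴸ-++ f xs ys)) (sym (+-assoc _ _ _))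

  sumᴸ-map : ∀ {X Y : Set} (f : Y → ℝ) (g : X → Y) xs → sumᴸ f (List.map g xs) ≈ sumᴸ (f ∘ g) xs
  sumᴸ-map f g [] = refl
  sumᴸ-map f g (x ∷ xs) = +-congˡ (sumᴸ-map f g xs)

  sumᴸ-tabulate : ∀ {X : Set} (f : X → ℝ) {n} (g : Fin n → X) → sumᴸ f (tabulate g) ≈ sum (f ∘ g)
  sumᴸ-tabulate f {zero} g = refl
  sumᴸ-tabulate f {suc n} g = +-congˡ (sumᴸ-tabulate f (g ∘ suc))

  sumᴸ-filter : ∀ {X : Set} {P : X → Set} (P? : ∀ x → Dec (P x)) (f : X → ℝ) xs →
    sumᴸ f (filter P? xs) ≈ sumᴸ (λ x → if does (P? x) then f x else 0#) xs
  sumᴸ-filter P? f [] = refl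
  sumᴸ-filter P? f (x ∷ xs) with does (P? x)
  ... | true = +-congˡ (sumᴸ-filter P? f xs)
  ... | false = trans (sumᴸ-filter P? f xs) (sym (+-identityˡ _))

  sumᴸ-cong : ∀ {X : Set} {f g : X → ℝ} → (∀ x → f x ≈ g x) → ∀ xs → sumᴸ f xs ≈ sumᴸ g xs
  sumᴸ-cong f≈g [] = refl
  sumᴸ-cong f≈g (x ∷ xs) = +-cong (f≈g x) (sumᴸ-cong f≈g xs)

  sumᴸ-cartesianProduct : ∀ {X Y : Set} (f : X × Y → ℝ) xs ys →
    sumᴸ f (cartesianProduct xs ys) ≈ sumᴸ (λ x → sumᴸ (λ y → f (x , y)) ys) xs
  sumᴸ-cartesianProduct f [] ys = refl
  sumᴸ-cartesianProduct f (x ∷ xs) ys = trans (sumᴸ-++ f (List.map (x ,_) ys) _)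
    (+-cong (sumᴸ-map f (x ,_) ys) (sumᴸ-cartesianProduct f xs ys))

  module _ {X : Set} (f g : X → ℕ) (h : X → ℝ) where

    ∑-array : (F : ℕ → ℕ → ℝ → ℝ) → ∀ L →
      ∑ (length L) (λ e → F (array 0 (List.map f L) e) (array 0 (List.map g L) e) (array 0# (List.map h L) e))
        ≈ sumᴸ (λ x → F (f x) (g x) (h x)) L
    ∑-array F [] = refl
    ∑-array F (x ∷ L) = trans (∑-cons (length L) _) (+-congˡ (∑-array F L))

    array-∈ : ∀ {x L} → x List.∈ L → Σ[ e ∈ ℕ ] e ℕ.< length L × array 0 (List.map f L) e ≡ f x
    array-∈ (here ≡.refl) = 0 , s≤s z≤n , ≡.refl
    array-∈ (there x∈L) with array-∈ x∈L
    ... | e , e< , eq = suc e , s≤s e< , eq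

    array-< : ∀ L {e} → e ℕ.< length L → Σ[ x ∈ X ] array 0 (List.map f L) e ≡ f x
    array-< (x ∷ L) {zero} _ = x , ≡.refl
    array-< (x ∷ L) {suc e} (s≤s lt) = array-< L lt

  module Sparse {n d : ℕ} (A : Matrix n d) where

    rowA colA : ℕ → ℕ
    rowA = array 0 (List.map (λ (i , j) → toℕ i) (nonzeros A))
    colA = array 0 (List.map (λ (i , j) → toℕ j) (nonzeros A))

    valA : ℕ → ℝ
    valA = array 0# (List.map (λ (i , j) → A i j) (nonzeros A))

    -- The positions missing from `nonzeros` contribute nothing, as `F` vanishes at zero values.
    ∑-entries : (F : ℕ → ℕ → ℝ → ℝ) → (∀ i j {x} → x ≈ 0# → F i j x ≈ 0#) →
      ∑ (nnz A) (λ e → F (rowA e) (colA e) (valA e)) ≈ sum (λ i → sum (λ j → F (toℕ i) (toℕ j) (A i j)))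
    ∑-entries F F-zero = begin
      ∑ (nnz A) (λ e → F (rowA e) (colA e) (valA e))
        ≈⟨ ∑-array (toℕ ∘ proj₁) (toℕ ∘ proj₂) (λ (i , j) → A i j) F (nonzeros A) ⟩
      sumᴸ G (nonzeros A)
        ≈⟨ sumᴸ-filter (λ (i , j) → ¬? (A i j ≟ 0#)) G (cartesianProduct (allFin n) (allFin d)) ⟩
      sumᴸ (λ (i , j) → if does (¬? (A i j ≟ 0#)) then G (i , j) else 0#) (cartesianProduct (allFin n) (allFin d))
        ≈⟨ sumᴸ-cong (λ (i , j) → restore i j) (cartesianProduct (allFin n) (allFin d)) ⟩
      sumᴸ G (cartesianProduct (allFin n) (allFin d))
        ≈⟨ sumᴸ-cartesianProduct G (allFin n) (allFin d) ⟩
      sumᴸ (λ i → sumᴸ (λ j → G (i , j)) (allFin d)) (allFin n)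
        ≈⟨ sumᴸ-tabulate {Fin n} _ (λ i → i) ⟩
      sum (λ i → sumᴸ (λ j → G (i , j)) (allFin d))
        ≈⟨ sum-cong {n} (λ i → sumᴸ-tabulate (λ j → G (i , j)) (λ j → j)) ⟩
      sum (λ i → sum (λ j → G (i , j))) ∎
      where
      open SetoidReasoning setoid
      G : Fin n × Fin d → ℝ
      G (i , j) = F (toℕ i) (toℕ j) (A i j)
      restore : ∀ i j → (if does (¬? (A i j ≟ 0#)) then G (i , j) else 0#) ≈ G (i , j)
      restore i j with A i j ≟ 0#
      ... | yes z = sym (F-zero (toℕ i) (toℕ j) z)
      ... | no _ = refl

    entry-of : ∀ {i j} → ¬ (A i j ≈ 0#) → Σ[ e ∈ ℕ ] e ℕ.< nnz A × rowA e ≡ toℕ i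
    entry-of {i} {j} nz = array-∈ (toℕ ∘ proj₁) (toℕ ∘ proj₂) (λ (i , j) → A i j)
      (∈-filter⁺ (λ (i , j) → ¬? (A i j ≟ 0#)) (∈-cartesianProduct⁺ (∈-allFin i) (∈-allFin j)) nz)

    row-of : ∀ {e} → e ℕ.< nnz A → Σ[ i ∈ Fin n ] rowA e ≡ toℕ i
    row-of e< with array-< (toℕ ∘ proj₁) (toℕ ∘ proj₂) (λ (i , j) → A i j) (nonzeros A) e<
    ... | (i , _) , eq = i , eq

    ∑-row : (f : ℕ → ℝ → ℝ) → (∀ j {x} → x ≈ 0# → f j x ≈ 0#) → ∀ r →
      ∑ (nnz A) (λ e → hit (rowA e) (toℕ r) (f (colA e) (valA e))) ≈ sum (λ j → f (toℕ j) (A r j))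
    ∑-row f f-zero r = trans (∑-entries (λ i j x → hit i (toℕ r) (f j x)) (λ i j z → hit-zero i (toℕ r)
      (f-zero j z)))
      (trans (sum-cong {n} λ i → out i) (sum-hit r (λ i → sum (λ j → f (toℕ j) (A i j)))))
      where
      out : ∀ i → sum {d} (λ j → hit (toℕ i) (toℕ r) (f (toℕ j) (A i j))) ≈ hit (toℕ i) (toℕ r)
        (sum (λ j → f (toℕ j) (A i j)))
      out i with toℕ i ℕ.≡ᵇ toℕ r
      ... | true = refl
      ... | false = sum-zero {d} (λ _ → refl)

    ∑-column : (X : ℕ → ℝ) → ∀ c →
      ∑ (nnz A) (λ e → hit (colA e) (toℕ c) (valA e * X (rowA e))) ≈ sum (λ i → A i c * X (toℕ i))
    ∑-column X c = trans (∑-entries (λ i j x → hit j (toℕ c) (x * X i)) (λ i j z → hit-zero j (toℕ c)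
      (trans (*-congʳ z) (zeroˡ _))))
      (sum-cong {n} λ i → sum-hit c (λ j → A i j * X (toℕ i)))

  -- Rank-one updates

  -- Congruence of the inverse is not among the field axioms. Away from zero it follows from
  -- uniqueness of inverses, and at zero from `0⁻¹≈0`.
  x⁻¹-cong : ∀ {x y} → x ≈ y → x ⁻¹ ≈ y ⁻¹
  x⁻¹-cong {x} {y} x≈y with x ≟ 0#
  ... | yes x≈0 = trans (0⁻¹≈0 x x≈0) (sym (0⁻¹≈0 y (trans (sym x≈y) x≈0)))
  ... | no x≉0 = begin
    x ⁻¹                ≈⟨ *-identityʳ _ ⟨
    x ⁻¹ * 1#           ≈⟨ *-congˡ (*-inverseʳ y (λ y≈0 → x≉0 (trans x≈y y≈0))) ⟨
    x ⁻¹ * (y * y ⁻¹)   ≈⟨ *-assoc _ _ _ ⟨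
    x ⁻¹ * y * y ⁻¹     ≈⟨ *-congʳ (trans (*-comm _ _) (trans (*-congʳ (sym x≈y)) (*-inverseʳ x x≉0))) ⟩
    1# * y ⁻¹           ≈⟨ *-identityˡ _ ⟩
    y ⁻¹                ∎
    where open SetoidReasoning setoid

  at : ∀ {f g : ℕ → ℝ} {x : ℕ} → f ≡ g → f x ≈ g x
  at {x = x} f≡g = reflexive (≡.cong (λ f → f x) f≡g)

  apply : Program
  apply = clear 1 2 ︔ scatter 5 2 3 1 3 2 ︔ scatter 2 0 1 0 2 4

  update : Program
  -- `dot` leaves `quad W v` in variable 4; the three scalar instructions then form the
  -- Sherman-Morrison coefficient in variable 8.
  update = apply ︔ instr (zeroᴿ 4) ︔ dot ︔ block (mulᴿ 5 3 4 ∷ addᴿ 5 1 5 ∷ divᴿ 8 3 5 ∷ []) ︔ leverages ︔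
    matrix-update

  -- The coordinate form gives no direct access to a row. It is computed as the product of the
  -- transpose of `A` with an indicator vector, of which one cell is set before and reset
  -- afterwards.
  load-row : Program
  load-row = clear 1 3 ︔ block (oneᴿ 5 ∷ storeᴿ 6 7 5 ∷ []) ︔ scatter 2 1 0 0 6 3 ︔ block (zeroᴿ 5 ∷ storeᴿ 6 7
    5 ∷ [])

  load-unit : Program
  load-unit = clear 1 3 ︔ block (oneᴿ 5 ∷ storeᴿ 3 6 5 ∷ [])

  -- Correctness and cost of the matrix procedures

  module Verified {n d : ℕ} (A : Matrix n d) where
    open Sparse A public

    -- `X` is the unit of time: it exceeds the length of every loop except the `While` loop, and it
    -- is positive, so constant costs are multiples of it too.
    D X : ℕ
    D = d ℕ.* d
    X = suc (nnz A ℕ.+ D)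

    flat : Fin d → Fin d → ℕ
    flat i j = toℕ i ℕ.* d ℕ.+ toℕ j

    flat< : ∀ i j → flat i j ℕ.< D
    flat< i j = ℕ.<-≤-trans (ℕ.+-monoʳ-< (toℕ i ℕ.* d) (Fin.toℕ<n j))
      (ℕ.≤-trans (ℕ.≤-reflexive (ℕ.+-comm (toℕ i ℕ.* d) d)) (ℕ.*-monoˡ-≤ d (Fin.toℕ<n i)))

    nnz<X : nnz A ℕ.< X
    nnz<X = s≤s (ℕ.m≤m+n (nnz A) D)

    D<X : D ℕ.< X
    D<X = s≤s (ℕ.m≤n+m D (nnz A))

    d<X : d ℕ.< X
    d<X = ℕ.≤-<-trans (d≤d² d) D<X
      where
      d≤d² : ∀ d → d ℕ.≤ d ℕ.* d
      d≤d² zero = z≤n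
      d≤d² d@(suc _) = ℕ.m≤m*n d d

    -- A record, so that the cost and its coefficient can be inferred from the type when bounds are
    -- added up.
    record _Within_ (s a : ℕ) : Set where
      constructor within
      field bound : s ℕ.≤ a ℕ.* X

    run-within : ∀ {p σ s a Q} b → a ≡ b → s Within a → Run p σ s Q → Run p σ (b ℕ.* X) Q
    run-within b ≡.refl (within s≤) = run-weaken s≤

    loop≤ : ∀ {N} → N ℕ.< X → ∀ K → (2 ℕ.+ N ℕ.* K) Within (2 ℕ.+ K)
    loop≤ {N} N<X K = within (ℕ.≤-trans (ℕ.+-mono-≤ (ℕ.m≤m*n 2 X) (ℕ.≤-trans (ℕ.*-monoˡ-≤ K (ℕ.<⇒≤ N<X))
      (ℕ.≤-reflexive (ℕ.*-comm X K))))
      (ℕ.≤-reflexive (≡.sym (ℕ.*-distribʳ-+ X 2 K))))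

    const≤ : ∀ c → c Within c
    const≤ c = within (ℕ.m≤m*n c X)

    procedure≤ : ∀ c → (c ℕ.* X) Within c
    procedure≤ c = within ℕ.≤-refl

    infixr 6 _+≤_
    _+≤_ : ∀ {s t a b} → s Within a → t Within b → (s ℕ.+ t) Within (a ℕ.+ b)
    _+≤_ {a = a} {b} (within p) (within q) = within (ℕ.≤-trans (ℕ.+-mono-≤ p q) (ℕ.≤-reflexive
      (≡.sym (ℕ.*-distribʳ-+ X a b))))

    record Static (σ : State) : Set where
      field
        dim    : varᴺ σ 1 ≡ d
        size   : varᴺ σ 2 ≡ nnz A
        one    : varᴺ σ 3 ≡ 1
        square : varᴺ σ 5 ≡ D
        zeroᵛ  : varᴺ σ 12 ≡ 0
        oneᵛ   : varᴿ σ 1 ≡ 1#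
        quart  : varᴿ σ 2 ≡ ¼
        rows   : arrᴺ σ 0 ≡ rowA
        cols   : arrᴺ σ 1 ≡ colA
        vals   : arrᴿ σ 0 ≡ valA
        index₁ : ∀ i j → arrᴺ σ 2 (flat i j) ≡ toℕ i
        index₂ : ∀ i j → arrᴺ σ 3 (flat i j) ≡ toℕ j

    persistent : List Loc
    persistent = nv 1 ∷ nv 2 ∷ nv 3 ∷ nv 5 ∷ nv 12 ∷ rv 1 ∷ rv 2 ∷ na 0 ∷ na 1 ∷ ra 0 ∷ na 2 ∷ na 3 ∷ []

    keeps : List Loc → Program → Bool
    keeps [] p = true
    keeps (l ∷ ls) p = avoids l p ∧ keeps ls p

    kept : ∀ {p σ τ} ls → keeps ls p ≡ true → Frame p σ τ → All (λ l → get l τ ≡ get l σ) ls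
    kept [] _ _ = []
    kept {p} (l ∷ ls) k fr with avoids l p in eq
    ... | true = fr l eq ∷ kept ls k fr

    static-frame : ∀ {p σ τ} → keeps persistent p ≡ true → Frame p σ τ → Static σ → Static τ
    static-frame {p} k fr S with kept {p} persistent k fr
    ... | n1 ∷ n2 ∷ n3 ∷ n5 ∷ n12 ∷ r1 ∷ r2 ∷ a0 ∷ a1 ∷ b0 ∷ a2 ∷ a3 ∷ [] = record
      { dim = ≡.trans n1 dim ; size = ≡.trans n2 size ; one = ≡.trans n3 one ; square = ≡.trans n5 square ;
        zeroᵛ = ≡.trans n12 zeroᵛ
      ; oneᵛ = ≡.trans r1 oneᵛ ; quart = ≡.trans r2 quart ; rows = ≡.trans a0 rows ; cols = ≡.trans a1 cols ;
        vals = ≡.trans b0 vals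
      ; index₁ = λ i j → ≡.trans (≡.cong (λ f → f (flat i j)) a2) (index₁ i j)
      ; index₂ = λ i j → ≡.trans (≡.cong (λ f → f (flat i j)) a3) (index₂ i j) }
      where open Static S

    -- Arrays 4 and 6 are indexed by rows, and clearing them would cost `n` steps. They are zero by
    -- invariant instead, and each procedure restores the cells that it touched.
    record Represents (W : Square d) (σ : State) : Set where
      field
        static : Static σ
        matrix : ∀ i j → arrᴿ σ 1 (flat i j) ≈ W i j
        levs   : ∀ r → arrᴿ σ 5 (toℕ r) ≈ quad W (A r)
        s-zero : ∀ (r : Fin n) → arrᴿ σ 4 (toℕ r) ≈ 0#
        x-zero : ∀ k → arrᴿ σ 6 k ≡ 0#
      open Static static public

    represents-frame : ∀ {p σ τ W} → keeps persistent p ≡ true → keeps (ra 1 ∷ ra 5 ∷ ra 4 ∷ ra 6 ∷ []) p ≡ true →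
      Frame p σ τ → Represents W σ → Represents W τ
    represents-frame {p} k k′ fr P with kept {p} (ra 1 ∷ ra 5 ∷ ra 4 ∷ ra 6 ∷ []) k′ fr
    ... | r1 ∷ r5 ∷ r4 ∷ r6 ∷ [] = record
      { static = static-frame {p} k fr static
      ; matrix = λ i j → trans (at r1) (matrix i j)
      ; levs = λ r → trans (at r5) (levs r)
      ; s-zero = λ r → trans (at r4) (s-zero r)
      ; x-zero = λ m → ≡.trans (≡.cong (λ f → f m) r6) (x-zero m) }
      where
      open Represents P

    apply-spec : ∀ {σ W v} → Represents W σ → (∀ i → arrᴿ σ 3 (toℕ i) ≈ v i) →
      Run apply σ (30 ℕ.* X) (λ τ → (∀ i → arrᴿ τ 2 (toℕ i) ≈ (W $$ v) i) × (∀ r → arrᴿ τ 4 (toℕ r) ≈ A r ∙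
        (W $$ v)))
    apply-spec {σ} {W} {v} P V≈ = run-within 30 ≡.refl (loop≤ d<X 4 +≤ loop≤ D<X 10 +≤ loop≤ nnz<X 10)
      (run-seq (clear-spec 1 2 ≡.refl dim one) λ {τ₁} f₁ clr →
      run-seq (scatter-spec 5 2 3 1 3 2 ≡.refl ≡.refl ≡.refl (≡.trans (f₁ (nv 5) ≡.refl) square)
        (≡.trans (f₁ (nv 3) ≡.refl) one)) λ {τ₂} f₂ U≈ →
      let U′ : ∀ i → arrᴿ τ₂ 2 (toℕ i) ≈ (W $$ v) i
          U′ = λ i → trans (U≈ (toℕ i)) (trans (+-cong (reflexive (clr (toℕ i) (Fin.toℕ<n i))) (matvec f₁ i))
            (+-identityˡ _)) in
      run-map (λ f₃ s≈ → (λ i → trans (at (f₃ (ra 2) ≡.refl)) (U′ i)) , λ r → trans (s≈ (toℕ r))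
          (trans (+-cong (trans (at (≡.trans (f₂ (ra 4) ≡.refl) (f₁ (ra 4) ≡.refl))) (s-zero r))
            (rowvec (static-frame {scatter 5 2 3 1 3 2} ≡.refl f₂ (static-frame {clear 1 2} ≡.refl f₁ static))
            U′ r)) (+-identityˡ _)))
        (scatter-spec 2 0 1 0 2 4 ≡.refl ≡.refl ≡.refl (≡.trans (f₂ (nv 2) ≡.refl) (≡.trans (f₁ (nv 2) ≡.refl)
          size))
          (≡.trans (f₂ (nv 3) ≡.refl) (≡.trans (f₁ (nv 3) ≡.refl) one))))
      where
      open Represents P
      matvec : ∀ {τ} → Frame (clear 1 2) σ τ → ∀ r → ∑ D (λ p → hit (arrᴺ τ 2 p) (toℕ r) (arrᴿ τ 1 p * arrᴿ τ 3
        (arrᴺ τ 3 p))) ≈ (W $$ v) r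
      matvec {τ} f r = trans (∑-flat d d _) (trans (sum-cong {d} inner) (sum-hit r (λ i → (W $$ v) i)))
        where
        inner : ∀ i → sum {d} (λ j → hit (arrᴺ τ 2 (flat i j)) (toℕ r) (arrᴿ τ 1 (flat i j) * arrᴿ τ 3
          (arrᴺ τ 3 (flat i j)))) ≈ hit (toℕ i) (toℕ r) ((W $$ v) i)
        inner i = trans (sum-cong {d} λ j → trans
            (reflexive (≡.cong (λ k → hit k (toℕ r) (arrᴿ τ 1 (flat i j) * arrᴿ τ 3 (arrᴺ τ 3 (flat i j))))
              (≡.trans (≡.cong (λ f → f (flat i j)) (f (na 2) ≡.refl)) (index₁ i j))))
            (hit-cong (toℕ i) (toℕ r) (*-cong (trans (at (f (ra 1) ≡.refl)) (matrix i j))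
              (trans (reflexive (≡.cong₂ (λ f k → f k) (f (ra 3) ≡.refl) (≡.trans (≡.cong (λ f → f (flat i j))
                (f (na 3) ≡.refl)) (index₂ i j)))) (V≈ j))))) out
          where
          out : sum {d} (λ j → hit (toℕ i) (toℕ r) (W i j * v j)) ≈ hit (toℕ i) (toℕ r) ((W $$ v) i)
          out with toℕ i ℕ.≡ᵇ toℕ r
          ... | true = refl
          ... | false = sum-zero {d} (λ _ → refl)
      rowvec : ∀ {τ u} → Static τ → (∀ i → arrᴿ τ 2 (toℕ i) ≈ u i) → ∀ r →
        ∑ (nnz A) (λ e → hit (arrᴺ τ 0 e) (toℕ r) (arrᴿ τ 0 e * arrᴿ τ 2 (arrᴺ τ 1 e))) ≈ A r ∙ u
      rowvec {τ} {u} S U≈ r = trans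
        (∑-cong (nnz A) (λ e _ → reflexive (≡.cong₂ (λ f g → hit (f e) (toℕ r) (g e * arrᴿ τ 2 (arrᴺ τ 1 e)))
          (Static.rows S) (Static.vals S))))
        (trans (∑-cong (nnz A) (λ e _ → reflexive (≡.cong (λ f → hit (rowA e) (toℕ r) (valA e * arrᴿ τ 2 (f e)))
          (Static.cols S))))
        (trans (∑-row (λ j x → x * arrᴿ τ 2 j) (λ j z → trans (*-congʳ z) (zeroˡ _)) r)
          (∙-cong {a = A r} (λ _ → refl) U≈)))

    update-spec : ∀ {σ W v} → Symmetric W → Represents W σ → (∀ i → arrᴿ σ 3 (toℕ i) ≈ v i) →
      Run update σ (68 ℕ.* X) (Represents (rankOne W (varᴿ σ 3) v))
    update-spec {σ} {W} {v} symm P V≈ = run-within 68 ≡.refl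
      (procedure≤ 30 +≤ const≤ 1 +≤ loop≤ d<X 6 +≤ const≤ 3 +≤ loop≤ nnz<X 11 +≤ loop≤ D<X 11)
      (run-seq (apply-spec P V≈) λ {τ₁} f₁ (U≈ , s≈) →
       let P₁ = static-frame {apply} ≡.refl f₁ static in
       run-seq {Q = _≡ exec (zeroᴿ 4) τ₁} (run ⇓-instr ℕ.≤-refl ≡.refl) λ { {_} _ ≡.refl →
       run-seq (dot-spec {exec (zeroᴿ 4) τ₁} (Static.dim P₁) (Static.one P₁)) λ {τ₂} f₂ λ≈ →
       let P₂ = static-frame {instr (zeroᴿ 4) ︔ dot} ≡.refl (frame-seq {instr (zeroᴿ 4)} {dot} (exec-frame (zeroᴿ 4) τ₁) f₂) P₁ in
       run-seq {Q = _≡ execs scalars τ₂} (run-block scalars ≡.refl) λ { {_} _ ≡.refl →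
       let τ₃ = execs scalars τ₂
           P₃ = static-frame {block scalars} ≡.refl (block-frame scalars τ₂) P₂
           U₃ : ∀ i → arrᴿ τ₂ 2 (toℕ i) ≈ u i
           U₃ = λ i → trans (at (f₂ (ra 2) ≡.refl)) (U≈ i)
           w₂≡ = ≡.trans (f₂ (rv 3) ≡.refl) (f₁ (rv 3) ≡.refl)
           coeff : varᴿ τ₃ 8 ≈ c
           coeff = *-cong (reflexive w₂≡) (x⁻¹-cong (+-cong (reflexive (Static.oneᵛ P₂)) (*-cong (reflexive w₂≡)
               (trans λ≈ (trans (+-identityˡ _) (trans (∑≈sum d (λ i → arrᴿ τ₁ 3 i * arrᴿ τ₁ 2 i))
                 (∙-cong {d} (λ i → trans (at (f₁ (ra 3) ≡.refl)) (V≈ i)) U≈))))))) in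
       run-seq (leverages-spec {τ₃} (Static.size P₃) (Static.one P₃)) λ {τ₄} f₄ L →
       let P₄ = static-frame {leverages} ≡.refl f₄ P₃
           open Leverages L
           s₃ : ∀ r → arrᴿ τ₃ 4 (toℕ r) ≈ A r ∙ u
           s₃ = λ r → trans (at (f₂ (ra 4) ≡.refl)) (s≈ r)
           s₄ : ∀ r → arrᴿ τ₄ 4 (toℕ r) ≈ 0#
           s₄ = λ r → clean {τ₃} {τ₄} (Static.rows P₃) L r (s₃ r)
           -- Since array 4 has become zero on the rows, `balance` now is the formula
           -- `quad-rankOne`.
           ℓ₄ : ∀ r → arrᴿ τ₄ 5 (toℕ r) ≈ quad (rankOne W w v) (A r)
           ℓ₄ = λ r → trans (solve 2 (λ l x → l := l :- x :* (:0 :* :0)) refl (arrᴿ τ₄ 5 (toℕ r)) (varᴿ τ₃ 8))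
              (trans (+-congˡ (-‿cong (*-congˡ (*-cong (sym (s₄ r)) (sym (s₄ r))))))
              (trans (balance (toℕ r)) (trans
                (+-cong (trans (at (≡.trans (f₂ (ra 5) ≡.refl) (f₁ (ra 5) ≡.refl))) (levs r))
                (-‿cong (*-cong coeff (*-cong (s₃ r) (s₃ r)))))
                (sym (quad-rankOne W symm w v (A r)))))) in
       run-map (λ {τ₅} f₅ M → record
         { static = static-frame {matrix-update} ≡.refl f₅ P₄
         ; matrix = λ i j → trans (reflexive (M (flat i j) (flat< i j)))
             (+-cong (trans (at (≡.trans (f₄ (ra 1) ≡.refl) (≡.trans (f₂ (ra 1) ≡.refl) (f₁ (ra 1) ≡.refl))))
               (matrix i j))
               (-‿cong (*-cong (trans (reflexive (f₄ (rv 8) ≡.refl)) coeff)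
                 (*-cong (trans (reflexive (≡.cong₂ (λ f k → f k) (f₄ (ra 2) ≡.refl) (Static.index₁ P₄ i j)))
                   (U₃ i))
                         (trans (reflexive (≡.cong₂ (λ f k → f k) (f₄ (ra 2) ≡.refl) (Static.index₂ P₄ i j)))
                           (U₃ j))))))
         ; levs = λ r → trans (at (f₅ (ra 5) ≡.refl)) (ℓ₄ r)
         ; s-zero = λ r → trans (at (f₅ (ra 4) ≡.refl)) (s₄ r)
         ; x-zero = λ k → ≡.trans (≡.cong (λ f → f k) (≡.trans (f₅ (ra 6) ≡.refl) (≡.trans (f₄ (ra 6) ≡.refl)
           (≡.trans (f₂ (ra 6) ≡.refl) (f₁ (ra 6) ≡.refl))))) (x-zero k) })
         (matrix-update-spec {τ₄} (Static.square P₄) (Static.one P₄)) } })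
      where
      open Represents P
      w = varᴿ σ 3
      u = W $$ v
      c = w * (1# + w * quad W v) ⁻¹
      scalars : List Instr
      scalars = mulᴿ 5 3 4 ∷ addᴿ 5 1 5 ∷ divᴿ 8 3 5 ∷ []
      -- A row with a nonzero entry has been visited; for a zero row the scalar product was zero
      -- from the beginning.
      clean : ∀ {τ τ′} → arrᴺ τ 0 ≡ rowA → Leverages τ (nnz A) τ′ → ∀ r → arrᴿ τ 4 (toℕ r) ≈ A r ∙ u → arrᴿ τ′ 4
        (toℕ r) ≈ 0#
      clean {τ} {τ′} rows≡ L r s≈ with Fin.any? (λ j → ¬? (A r j ≟ 0#))
      ... | yes (j , nz) = let (e , e< , eq) = entry-of nz in
        trans (reflexive (≡.cong (arrᴿ τ′ 4) (≡.sym (≡.trans (≡.cong (λ f → f e) rows≡) eq))))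
          (Leverages.visited L e e<)
      ... | no ¬nz = Leverages.zeros L (toℕ r) (trans s≈ (sum-zero {d} λ j → trans (*-congʳ (zero-entry j))
        (zeroˡ _)))
        where
        zero-entry : ∀ j → A r j ≈ 0#
        zero-entry j with A r j ≟ 0#
        ... | yes z = z
        ... | no nz = ⊥-elim (¬nz (j , nz))

    load-row-spec : ∀ {σ W} r → Represents W σ → varᴺ σ 7 ≡ toℕ r →
      Run load-row σ (22 ℕ.* X) (λ τ → Represents W τ × (∀ i → arrᴿ τ 3 (toℕ i) ≈ A r i))
    load-row-spec {σ} {W} r P eq7 = run-within 22 ≡.refl (loop≤ d<X 4 +≤ const≤ 2 +≤ loop≤ nnz<X 10 +≤ const≤ 2)
      (run-seq (clear-spec 1 3 ≡.refl dim one) λ {τ₁} f₁ clr →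
       run-block-then mark (
       run-seq (scatter-spec {execs mark τ₁} 2 1 0 0 6 3 ≡.refl ≡.refl ≡.refl (≡.trans (f₁ (nv 2) ≡.refl) size)
         (≡.trans (f₁ (nv 3) ≡.refl) one)) λ {τ₂} f₂ V≈ →
       run-block unmark {τ₂} (record
         { static = static-frame {block unmark} ≡.refl (block-frame unmark τ₂) (static-frame {scatter 2 1 0 0 6
           3} ≡.refl f₂ (static-frame {block mark} ≡.refl (block-frame mark τ₁) (static-frame {clear 1 3} ≡.refl
           f₁ static)))
         ; matrix = λ i j → trans (at (≡.trans (f₂ (ra 1) ≡.refl) (f₁ (ra 1) ≡.refl))) (matrix i j)
         ; levs = λ r → trans (at (≡.trans (f₂ (ra 5) ≡.refl) (f₁ (ra 5) ≡.refl))) (levs r)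
         ; s-zero = λ r → trans (at (≡.trans (f₂ (ra 4) ≡.refl) (f₁ (ra 4) ≡.refl))) (s-zero r)
         ; x-zero = λ k → reset (arrᴿ τ₂ 6) (f₂ (nv 7) ≡.refl) (f₂ (ra 6) ≡.refl) k (≡.trans (≡.cong (λ f → f k)
           (f₁ (ra 6) ≡.refl)) (x-zero k))
         } , λ i → trans (V≈ (toℕ i)) (trans (+-cong (reflexive (clr (toℕ i) (Fin.toℕ<n i))) (column f₁ i))
           (+-identityˡ _)))))
      where
      open Represents P
      mark unmark : List Instr
      mark = oneᴿ 5 ∷ storeᴿ 6 7 5 ∷ []
      unmark = zeroᴿ 5 ∷ storeᴿ 6 7 5 ∷ []
      reset : ∀ (f : ℕ → ℝ) {g : ℕ → ℝ} {a b} → a ≡ b → f ≡ g [ b ≔ 1# ] → ∀ k → g k ≡ 0# → (f [ a ≔ 0# ]) k ≡ 0#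
      reset f {g} {a} ≡.refl ≡.refl k z with a ℕ.≡ᵇ k
      ... | true = ≡.refl
      ... | false = z
      column : ∀ {τ} → Frame (clear 1 3) σ τ → ∀ c →
        ∑ (nnz A) (λ e → hit (arrᴺ τ 1 e) (toℕ c) (arrᴿ τ 0 e * (arrᴿ τ 6 [ varᴺ τ 7 ≔ 1# ]) (arrᴺ τ 0 e))) ≈ A r c
      column {τ} f c = trans
        (∑-cong (nnz A) λ e _ → reflexive (≡.cong₂ (λ f g → hit (f e) (toℕ c) (g e * Y (arrᴺ τ 0 e)))
          (≡.trans (f (na 1) ≡.refl) cols) (≡.trans (f (ra 0) ≡.refl) vals)))
        (trans (∑-cong (nnz A) λ e _ → reflexive (≡.cong (λ g → hit (colA e) (toℕ c) (valA e * Y (g e)))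
          (≡.trans (f (na 0) ≡.refl) rows)))
        (trans (∑-column Y c) (trans (sum-single r off)
          (trans (*-congˡ (reflexive (≔-here (arrᴿ τ 6) _ (toℕ r) 1# eq7′))) (*-identityʳ _)))))
        where
        Y = arrᴿ τ 6 [ varᴺ τ 7 ≔ 1# ]
        eq7′ : varᴺ τ 7 ≡ toℕ r
        eq7′ = ≡.trans (f (nv 7) ≡.refl) eq7
        off : ∀ i → i ≢ r → A i c * Y (toℕ i) ≈ 0#
        off i i≢r = trans (*-congˡ (reflexive (≡.trans (≔-there (arrᴿ τ 6) _ (toℕ i) 1#
          (λ eq → i≢r (Fin.toℕ-injective (≡.trans (≡.sym eq) eq7′))))
          (≡.trans (≡.cong (λ g → g (toℕ i)) (f (ra 6) ≡.refl)) (x-zero (toℕ i)))))) (zeroʳ _)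

    load-unit-spec : ∀ {σ W} k → Represents W σ → varᴺ σ 6 ≡ toℕ k →
      Run load-unit σ (8 ℕ.* X) (λ τ → Represents W τ × (∀ i → arrᴿ τ 3 (toℕ i) ≈ δ k i))
    load-unit-spec {σ} {W} k P eq6 = run-within 8 ≡.refl (loop≤ d<X 4 +≤ const≤ 2)
      (run-seq (clear-spec 1 3 ≡.refl dim one) λ {τ} f clr →
       run-block (oneᴿ 5 ∷ storeᴿ 3 6 5 ∷ []) {τ} (
         represents-frame {block (oneᴿ 5 ∷ storeᴿ 3 6 5 ∷ [])} ≡.refl ≡.refl (block-frame (oneᴿ 5 ∷ storeᴿ 3 6 5
           ∷ []) τ) (represents-frame {clear 1 3} ≡.refl ≡.refl f P) ,
         λ i → entry τ i (≡.trans (f (nv 6) ≡.refl) eq6) (clr (toℕ i) (Fin.toℕ<n i))))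
      where
      open Represents P
      entry : ∀ τ i → varᴺ τ 6 ≡ toℕ k → arrᴿ τ 3 (toℕ i) ≡ 0# → (arrᴿ τ 3 [ varᴺ τ 6 ≔ 1# ]) (toℕ i) ≈ δ k i
      entry τ i eq z with k Fin.≟ i
      ... | yes ≡.refl = reflexive (≔-here (arrᴿ τ 3) (varᴺ τ 6) (toℕ i) 1# eq)
      ... | no k≢i = reflexive (≡.trans (≔-there (arrᴿ τ 3) (varᴺ τ 6) (toℕ i) 1# (λ e → k≢i (Fin.toℕ-injective
        (≡.trans (≡.sym eq) e)))) z)

  -- The algorithm

  setup : Program
  setup = block (constᴺ 3 1 ∷ oneᴿ 1 ∷ addᴿ 5 1 1 ∷ addᴿ 5 5 5 ∷ divᴿ 2 1 5 ∷ []) ︔ indices ︔ identity ︔ squares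

  -- The insertion has to come before the removal: the unit vector has leverage 1, and without it
  -- the Gram matrix would be singular.
  swap : Program
  swap = block (storeᴺ 4 7 3 ∷ oneᴿ 3 ∷ []) ︔ (load-row ︔ update) ︔ block (zeroᴿ 3 ∷ subᴿ 3 3 1 ∷ []) ︔
    (load-unit ︔ update)

  -- Applied to the unit vector, `apply` leaves `g` in array 2 and its values on all rows in array
  -- 4, where `largest` looks for them.
  pivot : Program
  pivot = load-unit ︔ apply ︔ block (zeroᴿ 4 ∷ constᴺ 8 0 ∷ []) ︔ largest ︔ If lessᴺ 12 8 Then swap Else skip

  find : Program
  find = block (constᴺ 8 0 ∷ []) ︔ search-large

  remove : Program
  remove = block (storeᴺ 4 7 12 ∷ zeroᴿ 3 ∷ subᴿ 3 3 1 ∷ []) ︔ load-row ︔ update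

  -- The closing `find` prepares variables 7 and 8 for the next test of the loop and the next round.
  improve : Program
  improve = block (storeᴺ 4 7 3 ∷ oneᴿ 3 ∷ []) ︔ (load-row ︔ update) ︔ block (constᴺ 8 0 ∷ []) ︔ search-small ︔
    (If lessᴺ 12 8 Then remove Else skip) ︔ find

  algorithm : Program
  algorithm = setup ︔ For 6 1 pivot ︔ find ︔ (While lessᴺ 12 8 Do improve) ︔ output

  -- The two phases as invariants of the program

  module Correctness {n d : ℕ} (A : Matrix n d) where
    open Verified A
    open Stages A

    bit : Bool → ℕ
    bit b = if b then 1 else 0

    Occurs : Fin n → Set
    Occurs r = Σ[ e ∈ ℕ ] e ℕ.< nnz A × rowA e ≡ toℕ r

    -- By `occupied`, each row in the set has a nonzero entry, so that scans of the entries, in the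
    -- search for small leverages and in the output, meet every member.
    record Config (χ : Fin (n ℕ.+ d) → Bool) (W : Square d) (σ : State) : Set where
      field
        rep      : Represents W σ
        flags    : ∀ r → arrᴺ σ 4 (toℕ r) ≡ bit (χ (row r))
        occupied : ∀ r → χ (row r) ≡ true → Occurs r
      open Represents rep public

    occurs-or-zero : ∀ r {P : Set} → (Occurs r → P) → ((∀ j → A r j ≈ 0#) → P) → P
    occurs-or-zero r f g with Fin.any? (λ j → ¬? (A r j ≟ 0#))
    ... | yes (j , nz) = f (entry-of nz)
    ... | no ¬nz = g zero-entry
      where
      zero-entry : ∀ j → A r j ≈ 0#
      zero-entry j with A r j ≟ 0#
      ... | yes z = z
      ... | no nz = ⊥-elim (¬nz (j , nz))

    config-frame : ∀ {p σ τ χ W} → keeps persistent p ≡ true → keeps (ra 1 ∷ ra 5 ∷ ra 4 ∷ ra 6 ∷ []) p ≡ true →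
      avoids (na 4) p ≡ true → Frame p σ τ → Config χ W σ → Config χ W τ
    config-frame {p} k k′ a fr C = record
      { rep = represents-frame {p} k k′ fr rep ; occupied = occupied
      ; flags = λ r → ≡.trans (≡.cong (λ f → f (toℕ r)) (fr (na 4) a)) (flags r) }
      where open Config C

    set-flag : ∀ {χ} {f : ℕ → ℕ} {a v} r b → (∀ r → f (toℕ r) ≡ bit (χ (row r))) → a ≡ toℕ r → v ≡ bit b →
      ∀ r′ → (f [ a ≔ v ]) (toℕ r′) ≡ bit (updateAt χ (row r) (const b) (row r′))
    set-flag {χ} {f} {a} {v} r b flags a≡ v≡ r′ with r′ Fin.≟ r
    ... | yes ≡.refl = ≡.trans (≔-here f a (toℕ r′) v a≡)
      (≡.trans v≡ (≡.cong bit (≡.sym (updateAt-updates (row r) χ))))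
    ... | no r′≢r = ≡.trans (≔-there f a (toℕ r′) v (λ eq → r′≢r (Fin.toℕ-injective (≡.trans (≡.sym eq) a≡))))
          (≡.trans (flags r′) (≡.cong bit (≡.sym (updateAt-minimal (row r′) (row r) χ (r′≢r ∘ row-injective)))))

    occupied-insert : ∀ {χ} r → Occurs r → (∀ r → χ (row r) ≡ true → Occurs r) →
      ∀ r′ → updateAt χ (row r) (const true) (row r′) ≡ true → Occurs r′
    occupied-insert {χ} r occ old r′ eq with r′ Fin.≟ r
    ... | yes ≡.refl = occ
    ... | no r′≢r = old r′ (≡.trans (≡.sym (updateAt-minimal (row r′) (row r) χ (r′≢r ∘ row-injective))) eq)

    occupied-remove : ∀ {χ} k → (∀ r → χ (row r) ≡ true → Occurs r) →
      ∀ r′ → updateAt χ k (const false) (row r′) ≡ true → Occurs r′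
    occupied-remove {χ} k old r′ eq with row r′ Fin.≟ k
    ... | yes ≡.refl = ⊥-elim (contra (≡.trans (≡.sym (updateAt-updates (row r′) χ)) eq))
      where
      contra : false ≢ true
      contra ()
    ... | no r′≢k = old r′ (≡.trans (≡.sym (updateAt-minimal (row r′) k χ r′≢k)) eq)

    exchange-row : ∀ {σ W} r → Symmetric W → Represents W σ → varᴺ σ 7 ≡ toℕ r →
      Run (load-row ︔ update) σ (90 ℕ.* X) (Represents (rankOne W (varᴿ σ 3) (A r)))
    exchange-row {σ} {W} r symm P eq7 = run-within 90 ≡.refl (procedure≤ 22 +≤ procedure≤ 68)
      (run-seq (load-row-spec r P eq7) λ {τ} f (P′ , V≈) →
        ≡.subst (λ w → Run update τ (68 ℕ.* X) (Represents (rankOne W w (A r)))) (f (rv 3) ≡.refl)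
          (update-spec symm P′ V≈))

    exchange-unit : ∀ {σ W} k → Symmetric W → Represents W σ → varᴺ σ 6 ≡ toℕ k →
      Run (load-unit ︔ update) σ (76 ℕ.* X) (Represents (rankOne W (varᴿ σ 3) (δ k)))
    exchange-unit {σ} {W} k symm P eq6 = run-within 76 ≡.refl (procedure≤ 8 +≤ procedure≤ 68)
      (run-seq (load-unit-spec k P eq6) λ {τ} f (P′ , V≈) →
        ≡.subst (λ w → Run update τ (68 ℕ.* X) (Represents (rankOne W w (δ k)))) (f (rv 3) ≡.refl)
          (update-spec symm P′ V≈))

    rankOne-symm : ∀ {W : Square d} → Symmetric W → ∀ w v → Symmetric (rankOne W w v)
    rankOne-symm symm w v i j = +-cong (symm i j) (-‿cong (*-congˡ (*-comm _ _)))

    setup-spec : ∀ ε → Run setup (input A ε) (36 ℕ.* X) (Config χ₀ δ)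
    setup-spec ε = run-within 36 ≡.refl (const≤ 5 +≤ indices≤ +≤ loop≤ D<X 7 +≤ loop≤ nnz<X 8)
      (run-block-then consts (
       run-seq (indices-spec {execs consts σ₀} ≡.refl ≡.refl) λ {τ₁} f₁ I →
       run-seq (identity-spec {τ₁} {D} (Indices.count I) (f₁ (nv 3) ≡.refl)) λ {τ₂} f₂ Id →
       let f₁₂ = frame-seq {indices} {identity} f₁ f₂ in
       run-map (λ {τ₃} f₃ ℓ≈ →
         let f₂₃ = frame-seq {identity} {squares} f₂ f₃
             f = frame-seq {indices} {identity ︔ squares} f₁ f₂₃ in record
         { rep = record
           { static = record
             { dim = f (nv 1) ≡.refl
             ; size = f (nv 2) ≡.refl
             ; one = f (nv 3) ≡.refl
             ; square = ≡.trans (f₃ (nv 5) ≡.refl) (≡.trans (f₂ (nv 5) ≡.refl) (Indices.count I))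
             ; zeroᵛ = f (nv 12) ≡.refl
             ; oneᵛ = f (rv 1) ≡.refl
             ; quart = f (rv 2) ≡.refl
             ; rows = f (na 0) ≡.refl
             ; cols = f (na 1) ≡.refl
             ; vals = f (ra 0) ≡.refl
             ; index₁ = λ i j → ≡.trans (≡.cong (λ f → f (flat i j)) (f₂₃ (na 2) ≡.refl)) (proj₁ (exact I i j))
             ; index₂ = λ i j → ≡.trans (≡.cong (λ f → f (flat i j)) (f₂₃ (na 3) ≡.refl)) (proj₂ (exact I i j)) }
           ; matrix = λ i j → trans (at (f₃ (ra 1) ≡.refl)) (ident I Id (f₁ (rv 1) ≡.refl) (f₁ (ra 1) ≡.refl) i j)
           ; levs = λ r → trans (ℓ≈ (toℕ r)) (trans (+-cong (at (f₁₂ (ra 5) ≡.refl))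
               (trans (∑-cong (nnz A) λ e _ → reflexive (≡.cong₂ (λ f g → hit (f e) (toℕ r) (g e * g e))
                   (f₁₂ (na 0) ≡.refl) (f₁₂ (ra 0) ≡.refl)))
                 (trans (∑-row (λ _ x → x * x) (λ _ z → trans (*-congʳ z) (zeroˡ _)) r)
                   (∙-cong {a = A r} (λ _ → refl) (λ i → sym (δ-∙ i (A r))))))) (+-identityˡ _))
           ; s-zero = λ r → at (f (ra 4) ≡.refl)
           ; x-zero = λ k → ≡.cong (λ f → f k) (f (ra 6) ≡.refl) }
         ; flags = λ r → ≡.trans (≡.cong (λ f → f (toℕ r)) (f (na 4) ≡.refl))
             (≡.cong bit (≡.sym (χ₀-row r)))
         ; occupied = λ r eq → ⊥-elim (contra (≡.trans (≡.sym (χ₀-row r)) eq)) })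
         (squares-spec {τ₂} (f₁₂ (nv 2) ≡.refl) (f₁₂ (nv 3) ≡.refl))))
      where
      σ₀ = input A ε
      consts : List Instr
      consts = constᴺ 3 1 ∷ oneᴿ 1 ∷ addᴿ 5 1 1 ∷ addᴿ 5 5 5 ∷ divᴿ 2 1 5 ∷ []
      contra : false ≢ true
      contra ()
      indices≤ : (1 ℕ.+ (2 ℕ.+ d ℕ.* (2 ℕ.+ (2 ℕ.+ d ℕ.* 5)))) Within 12
      indices≤ = within (ℕ.≤-trans (ℕ.≤-reflexive rearrange) (_Within_.bound (const≤ 3 +≤ within {a = 4} d≤ +≤
        within {a = 5} D≤)))
        where
        rearrange : 1 ℕ.+ (2 ℕ.+ d ℕ.* (2 ℕ.+ (2 ℕ.+ d ℕ.* 5))) ≡ 3 ℕ.+ (4 ℕ.* d ℕ.+ 5 ℕ.* D)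
        rearrange = ≡.cong (3 ℕ.+_) (≡.trans (ℕ.*-distribˡ-+ d 4 (d ℕ.* 5)) (≡.cong₂ ℕ._+_ (ℕ.*-comm d 4)
          (≡.trans (≡.sym (ℕ.*-assoc d d 5)) (ℕ.*-comm D 5))))
        d≤ : 4 ℕ.* d ℕ.≤ 4 ℕ.* X
        d≤ = ℕ.*-monoʳ-≤ 4 (ℕ.<⇒≤ d<X)
        D≤ : 5 ℕ.* D ℕ.≤ 5 ℕ.* X
        D≤ = ℕ.*-monoʳ-≤ 5 (ℕ.<⇒≤ D<X)
      exact : ∀ {τ} → Indices d D τ → ∀ i j → arrᴺ τ 2 (flat i j) ≡ toℕ i × arrᴺ τ 3 (flat i j) ≡ toℕ j
      exact I i j = proj₂ (indices-exact I (Fin.toℕ<n i) (Fin.toℕ<n j))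
      ident : ∀ {τ τ′} → Indices d D τ → Identity τ D τ′ → varᴿ τ 1 ≡ 1# → arrᴿ τ 1 ≡ (λ _ → 0#) →
        ∀ i j → arrᴿ τ′ 1 (flat i j) ≈ δ i j
      ident {τ} {τ′} I Id one≡ zero≡ i j with i Fin.≟ j
      ... | yes ≡.refl = reflexive (≡.trans (Identity.diagonal Id (flat i i) (flat< i i)
        (≡.trans (proj₁ (exact I i i)) (≡.sym (proj₂ (exact I i i))))) one≡)
      ... | no i≢j = reflexive (≡.trans (Identity.off Id (flat i j) (λ eq → i≢j (Fin.toℕ-injective
            (≡.trans (≡.sym (proj₁ (exact I i j))) (≡.trans eq (proj₂ (exact I i j)))))))
              (≡.cong (λ f → f (flat i j)) zero≡))

    Phase₁ : ℕ → State → Set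
    Phase₁ K σ = Σ[ χ ∈ (Fin (n ℕ.+ d) → Bool) ] Σ[ W ∈ Square d ] Initial K χ W × Config χ W σ

    pivot-spec : ∀ {σ} k → varᴺ σ 6 ≡ toℕ k → Phase₁ (toℕ k) σ →
      Run pivot σ (224 ℕ.* X) (Phase₁ (suc (toℕ k)))
    pivot-spec {σ} k eq6 (χ , W , I , C) =
      run-within 224 ≡.refl (procedure≤ 8 +≤ procedure≤ 30 +≤ const≤ 2 +≤ loop≤ nnz<X 11 +≤ (const≤ 1 +≤ swap≤))
      (run-seq (load-unit-spec k rep eq6) λ {τ₁} f₁ (P₁ , V≈) →
       run-seq (apply-spec P₁ V≈) λ {τ₂} f₂ (U≈ , s≈) →
       let S₂ = static-frame {apply} ≡.refl f₂ (Represents.static P₁) in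
       run-block-then prepare (
       run-seq (largest-spec {execs prepare τ₂} (Static.size S₂) (Static.one S₂) (Static.zeroᵛ S₂) ≡.refl
         ≡.refl) λ {τ₃} f₃ L →
       let f₁₂ = frame-seq {load-unit} {apply} f₁ f₂
           f₁₂ₚ = frame-seq {load-unit ︔ apply} {block prepare} f₁₂ (block-frame prepare τ₂)
           f₁₃ = frame-seq {(load-unit ︔ apply) ︔ block prepare} {largest} f₁₂ₚ f₃
           f₂₃ = frame-seq {apply ︔ block prepare} {largest} (frame-seq {apply} {block prepare} f₂
             (block-frame prepare τ₂)) f₃
           C₃ : Config χ W τ₃
           C₃ = record
             { rep = record
               { static = static-frame {(apply ︔ block prepare) ︔ largest} ≡.refl f₂₃ (Represents.static P₁)
               ; matrix = λ i j → trans (at (f₂₃ (ra 1) ≡.refl)) (Represents.matrix P₁ i j)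
               ; levs = λ r → trans (at (f₂₃ (ra 5) ≡.refl)) (Represents.levs P₁ r)
               ; s-zero = cleaned S₂ s≈ L
               ; x-zero = λ m → ≡.trans (≡.cong (λ f → f m) (f₂₃ (ra 6) ≡.refl)) (Represents.x-zero P₁ m) }
             ; flags = λ r → ≡.trans (≡.cong (λ f → f (toℕ r)) (f₁₃ (na 4) ≡.refl)) (flags r)
             ; occupied = occupied } in
       decide C₃ (≡.trans (f₁₃ (nv 6) ≡.refl) eq6) S₂ s≈ L))
      where
      open Config C
      open Initial I using (inv)
      open Inverse inv using (symm)
      g = W $$ δ k
      prepare : List Instr
      prepare = zeroᴿ 4 ∷ constᴺ 8 0 ∷ []
      swap≤ : (2 ℕ.+ (90 ℕ.* X ℕ.+ (2 ℕ.+ 76 ℕ.* X))) Within 170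
      swap≤ = const≤ 2 +≤ procedure≤ 90 +≤ const≤ 2 +≤ procedure≤ 76

      cleaned : ∀ {τ τ′} → Static τ → (∀ r → arrᴿ τ 4 (toℕ r) ≈ A r ∙ g) → Largest (execs prepare τ) (nnz A)
        (nnz A) τ′ →
        ∀ r → arrᴿ τ′ 4 (toℕ r) ≈ 0#
      cleaned {τ} {τ′} S s≈ L r = occurs-or-zero r
        (λ (e , e< , eq) → trans (reflexive (≡.cong (arrᴿ τ′ 4)
          (≡.sym (≡.trans (≡.cong (λ f → f e) (Static.rows S)) eq)))) (Largest.visited L e e<))
        (λ z → from (trans (s≈ r) (sum-zero {d} λ j → trans (*-congʳ (z j)) (zeroˡ _))) (Largest.entries L (toℕ r)))
        where
        from : ∀ {a b P} → b ≈ 0# → a ≈ b ⊎ (a ≈ 0# × P) → a ≈ 0#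
        from b≈0 (inj₁ a≈b) = trans a≈b b≈0
        from _ (inj₂ (a≈0 , _)) = a≈0

      decide : ∀ {τ τ₃} → Config χ W τ₃ → varᴺ τ₃ 6 ≡ toℕ k → Static τ → (∀ r → arrᴿ τ 4 (toℕ r) ≈ A r ∙ g) →
        Largest (execs prepare τ) (nnz A) (nnz A) τ₃ →
        Run (If lessᴺ 12 8 Then swap Else skip) τ₃ (1 ℕ.+ (2 ℕ.+ (90 ℕ.* X ℕ.+ (2 ℕ.+ 76 ℕ.* X))))
          (Phase₁ (suc (toℕ k)))
      decide {τ} {τ₃} C₃ eq6₃ S s≈ L = run-if
        (λ t → found (Largest.best L) (does-true (varᴺ τ₃ 12 ℕ.<? varᴺ τ₃ 8) t))
        (λ t → run-skip (χ , W , skip-unit k I (none (Largest.best L) (does-false (varᴺ τ₃ 12 ℕ.<? varᴺ τ₃ 8)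
          t)) , C₃))
        where
        C₃z = Config.zeroᵛ C₃
        -- Rows met in the scan are bounded by the best value; for the others, which are zero, it
        -- suffices that the best value is nonnegative.
        square≤best : ∀ r → (A r ∙ g) * (A r ∙ g) ≤ varᴿ τ₃ 4
        square≤best r = occurs-or-zero r
          (λ (e , e< , eq) → ≤-trans (≤-reflexive (sym (sq e eq))) (Largest.bound L e e<))
          (λ z → ≤-trans (≤-reflexive (trans (*-congʳ (sum-zero {d} λ j → trans (*-congʳ (z j)) (zeroˡ _)))
            (zeroˡ _))) (Largest.0≤best L))
          where
          sq : ∀ e → rowA e ≡ toℕ r → arrᴿ τ 4 (arrᴺ τ 0 e) * arrᴿ τ 4 (arrᴺ τ 0 e) ≈ (A r ∙ g) * (A r ∙ g)
          sq e eq = *-cong s s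
            where s = trans (reflexive (≡.cong (arrᴿ τ 4) (≡.trans (≡.cong (λ f → f e) (Static.rows S)) eq))) (s≈ r)
        none : _ → ¬ (varᴺ τ₃ 12 ℕ.< varᴺ τ₃ 8) → ∀ r → A r ∙ g ≈ 0#
        none (inj₁ (_ , best≈0)) _ r = x²≈0⇒x≈0 (antisym (≤-trans (square≤best r) (≤-reflexive best≈0)) (0≤x² _))
        none (inj₂ (eq8 , _)) ¬lt r = ⊥-elim (¬lt (≡.subst₂ ℕ._<_ (≡.sym C₃z) (≡.sym eq8) (s≤s z≤n)))
        found : varᴺ τ₃ 8 ≡ 0 × varᴿ τ₃ 4 ≈ 0# ⊎
                varᴺ τ₃ 8 ≡ 1 × 0# < varᴿ τ₃ 4 × (Σ[ e ∈ ℕ ] e ℕ.< nnz A × varᴺ τ₃ 7 ≡ arrᴺ τ 0 e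
                  × varᴿ τ₃ 4 ≈ arrᴿ τ 4 (arrᴺ τ 0 e) * arrᴿ τ 4 (arrᴺ τ 0 e)) →
          varᴺ τ₃ 12 ℕ.< varᴺ τ₃ 8 → Run swap τ₃ (2 ℕ.+ (90 ℕ.* X ℕ.+ (2 ℕ.+ 76 ℕ.* X))) (Phase₁ (suc (toℕ k)))
        found (inj₁ (eq8 , _)) lt = ⊥-elim (ℕ.n≮0 (≡.subst (varᴺ τ₃ 12 ℕ.<_) eq8 lt))
        found (inj₂ (_ , 0<best , e , e< , eq7 , best≈)) _ =
          run-block-then mark (
          run-seq (exchange-row r symm P₄ eq7′) λ {τ₅} f₅ P₅ →
          run-block-then negate (
          run-map (λ {τ₇} f₇ P₇ →
            let f₄₇ = frame-seq {(load-row ︔ update) ︔ block negate} {load-unit ︔ update} (frame-seq {load-row ︔ update} {block negate} f₅ (block-frame negate τ₅)) f₇ in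
            _ , _ , swap-unit k I r nonzero biggest (λ _ _ → refl)
              (trans (+-congˡ (-‿cong (reflexive (Represents.oneᵛ P₅)))) (+-identityˡ _)) (λ _ _ → refl) ,
            record
              { rep = P₇
              ; flags = λ r′ → ≡.trans (≡.cong (λ f → f (toℕ r′)) (f₄₇ (na 4) ≡.refl))
                  (≡.trans (set-flag {f = arrᴺ τ₃ 4} r true (Config.flags C₃) eq7′ (Config.one C₃) r′)
                    (≡.cong bit (≡.sym (updateAt-minimal (row r′) (unit k) (updateAt χ (row r) (const true))
                      row≢unit))))
              ; occupied = occupied-remove (unit k) (occupied-insert r (e , e< , eqr) occupied) })
            (exchange-unit k (rankOne-symm symm 1# (A r))
              (represents-frame {block negate} ≡.refl ≡.refl (block-frame negate τ₅) P₅)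
              (≡.trans (f₅ (nv 6) ≡.refl) eq6₃))))
          where
          r = proj₁ (row-of e<)
          eqr = proj₂ (row-of e<)
          mark negate : List Instr
          mark = storeᴺ 4 7 3 ∷ oneᴿ 3 ∷ []
          negate = zeroᴿ 3 ∷ subᴿ 3 3 1 ∷ []
          row≡ : arrᴺ τ 0 e ≡ toℕ r
          row≡ = ≡.trans (≡.cong (λ f → f e) (Static.rows S)) eqr
          eq7′ : varᴺ τ₃ 7 ≡ toℕ r
          eq7′ = ≡.trans eq7 row≡
          best≈t² : varᴿ τ₃ 4 ≈ (A r ∙ g) * (A r ∙ g)
          best≈t² = trans best≈ (*-cong s s)
            where s = trans (reflexive (≡.cong (arrᴿ τ 4) row≡)) (s≈ r)
          nonzero : ¬ (A r ∙ g ≈ 0#)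
          nonzero z = <⇒≉ 0<best (trans best≈t² (trans (*-congʳ z) (zeroˡ _)))
          biggest : ∀ r′ → (A r′ ∙ g) * (A r′ ∙ g) ≤ (A r ∙ g) * (A r ∙ g)
          biggest r′ = ≤-trans (square≤best r′) (≤-reflexive best≈t²)
          P₄ : Represents W (execs mark τ₃)
          P₄ = represents-frame {block mark} ≡.refl ≡.refl (block-frame mark τ₃) (Config.rep C₃)

    phase₁-spec : ∀ {σ} → Phase₁ 0 σ → Run (For 6 1 pivot) σ (2 ℕ.+ d ℕ.* (2 ℕ.+ 224 ℕ.* X)) (Phase₁ d)
    phase₁-spec {σ} P@(_ , _ , _ , C) = run-for (λ K τ → Phase₁ K τ) ≡.refl ≡.refl ≡.refl (Config.dim C)
      (Config.one C)
      (move {instr (constᴺ 6 0)} ≡.refl ≡.refl ≡.refl (exec-frame (constᴺ 6 0) σ) P)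
      λ {i} {τ} i<d eqc fr inv → run-map (λ {υ} f Q → move {instr (addᴺ 6 6 3)} ≡.refl ≡.refl ≡.refl
        (exec-frame (addᴺ 6 6 3) υ)
          (≡.subst (λ k → Phase₁ (suc k) υ) (Fin.toℕ-fromℕ< i<d) Q))
        (pivot-spec {τ} (Fin.fromℕ< i<d) (≡.trans eqc (≡.sym (Fin.toℕ-fromℕ< i<d)))
          (≡.subst (λ k → Phase₁ k τ) (≡.sym (Fin.toℕ-fromℕ< i<d)) inv))
      where
      move : ∀ {p σ τ K} → keeps persistent p ≡ true → keeps (ra 1 ∷ ra 5 ∷ ra 4 ∷ ra 6 ∷ []) p ≡ true → avoids
        (na 4) p ≡ true →
        Frame p σ τ → Phase₁ K σ → Phase₁ K τ
      move {p} k k′ a f (χ , W , I , C) = χ , W , I , config-frame {p} k k′ a f C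

    Found : Square d → State → Set
    Found W τ = varᴺ τ 8 ≡ 0 × (∀ r → quad W (A r) ≤ 1#) ⊎
                varᴺ τ 8 ≡ 1 × Σ[ r ∈ Fin n ] varᴺ τ 7 ≡ toℕ r × Occurs r × 1# < quad W (A r)

    Phase₂ : ℕ → State → Set
    Phase₂ j σ = Σ[ χ ∈ (Fin (n ℕ.+ d) → Bool) ] Σ[ W ∈ Square d ] Main j χ W × Config χ W σ

    Phase₂F : ℕ → State → Set
    Phase₂F j σ = Σ[ χ ∈ (Fin (n ℕ.+ d) → Bool) ] Σ[ W ∈ Square d ] Main j χ W × Config χ W σ × Found W σ

    quad-zero : ∀ (W : Square d) r → (∀ j → A r j ≈ 0#) → quad W (A r) ≈ 0#
    quad-zero W r z = sum-zero {d} λ j → trans (*-congʳ (z j)) (zeroˡ _)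

    find-spec : ∀ {σ j} → Phase₂ j σ → Run find σ (10 ℕ.* X) (Phase₂F j)
    find-spec {σ} {j} (χ , W , M , C) = run-within 10 ≡.refl (const≤ 1 +≤ loop≤ nnz<X 7)
      (run-block-then reset (run-map (λ {τ} f S → χ , W , M ,
          config-frame {block reset ︔ search-large} ≡.refl ≡.refl ≡.refl (frame-seq {block reset} {search-large}
            (block-frame reset σ) f) C ,
          outcome {τ} S)
        (search-large-spec {execs reset σ} size one zeroᵛ ≡.refl)))
      where
      open Config C
      reset : List Instr
      reset = constᴺ 8 0 ∷ []
      lev : ∀ {e} r → rowA e ≡ toℕ r → arrᴿ σ 5 (arrᴺ σ 0 e) ≈ quad W (A r)
      lev {e} r eq = trans (reflexive (≡.cong (arrᴿ σ 5) (≡.trans (≡.cong (λ f → f e) rows) eq))) (levs r)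
      outcome : ∀ {τ} → SearchLarge (execs reset σ) (nnz A) (nnz A) τ → Found W τ
      outcome (inj₁ (eq8 , all)) = inj₁ (eq8 , λ r → occurs-or-zero r
        (λ (e , e< , eq) → ≤-trans (≤-reflexive (sym (lev r eq))) (≤-trans (all e e<)
          (≤-reflexive (reflexive oneᵛ))))
        (λ z → ≤-trans (≤-reflexive (quad-zero W r z)) (proj₁ 0<1)))
      outcome (inj₂ (eq8 , e , e< , eq7 , large)) = inj₂ (eq8 , r , ≡.trans eq7 (≡.trans (≡.cong (λ f → f e)
        rows) eq) , (e , e< , eq) ,
        <-≤-trans (≤-<-trans (≤-reflexive (sym (reflexive oneᵛ))) large) (≤-reflexive (lev r eq)))
        where
        r = proj₁ (row-of e<)
        eq = proj₂ (row-of e<)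

    improve-spec : ∀ {σ j χ W} → Main j χ W → Config χ W σ → ∀ r → varᴺ σ 7 ≡ toℕ r → Occurs r → 1# < quad W (A r) →
      Run improve σ (208 ℕ.* X) (Phase₂F (suc j))
    improve-spec {σ} {j} {χ} {W} M C r eq7 occ 1<λ =
      run-within 208 ≡.refl (const≤ 2 +≤ procedure≤ 90 +≤ const≤ 1 +≤ loop≤ nnz<X 9 +≤ (const≤ 1 +≤ const≤ 3 +≤
        procedure≤ 90) +≤ procedure≤ 10)
      (run-block-then mark (
       run-seq (exchange-row r symm (represents-frame {block mark} ≡.refl ≡.refl (block-frame mark σ) rep) eq7)
         λ {τ₂} f₂ P₂ →
       let C₂ : Config χ₁ W₁ τ₂
           C₂ = record
             { rep = P₂
             ; flags = λ r′ → ≡.trans (≡.cong (λ f → f (toℕ r′)) (f₂ (na 4) ≡.refl)) (set-flag {f = arrᴺ σ 4} r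
               true flags eq7 one r′)
             ; occupied = occupied-insert r occ occupied } in
       run-block-then reset (
       run-seq (search-small-spec {execs reset τ₂} (Config.size C₂) (Config.one C₂) (Config.zeroᵛ C₂) ≡.refl)
         λ {τ₃} f₃ S →
       let C₃ : Config χ₁ W₁ τ₃
           C₃ = config-frame {block reset ︔ search-small} ≡.refl ≡.refl ≡.refl (frame-seq {block reset}
             {search-small} (block-frame reset τ₂) f₃) C₂ in
       run-seq {Q = Phase₂ (suc j)} (run-if
         (λ t → shrink C₂ C₃ S (does-true (varᴺ τ₃ 12 ℕ.<? varᴺ τ₃ 8) t))
         (λ t → run-skip (χ₁ , W₁ , keep M r 1<λ (λ _ _ → refl) (stay C₂ C₃ S (does-false (varᴺ τ₃ 12 ℕ.<? varᴺ
           τ₃ 8) t)) , C₃)))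
       λ _ Q → find-spec Q)))
      where
      open Config C
      open Main M using (inv)
      open Inverse inv using (symm)
      χ₁ = updateAt χ (row r) (const true)
      W₁ = rankOne W 1# (A r)
      mark reset drop-flag : List Instr
      mark = storeᴺ 4 7 3 ∷ oneᴿ 3 ∷ []
      reset = constᴺ 8 0 ∷ []
      drop-flag = storeᴺ 4 7 12 ∷ zeroᴿ 3 ∷ subᴿ 3 3 1 ∷ []
      lev : ∀ {τ e} → Config χ₁ W₁ τ → ∀ r → rowA e ≡ toℕ r → arrᴿ τ 5 (arrᴺ τ 0 e) ≈ quad W₁ (A r)
      lev {τ} {e} C r eq = trans (reflexive (≡.cong (arrᴿ τ 5) (≡.trans (≡.cong (λ f → f e) (Config.rows C))
        eq))) (Config.levs C r)
      flag : ∀ {τ e} → Config χ₁ W₁ τ → ∀ r → rowA e ≡ toℕ r → arrᴺ τ 4 (arrᴺ τ 0 e) ≡ bit (χ₁ (row r))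
      flag {τ} {e} C r eq = ≡.trans (≡.cong (arrᴺ τ 4) (≡.trans (≡.cong (λ f → f e) (Config.rows C)) eq))
        (Config.flags C r)
      bit-pos : ∀ {b} → 0 ℕ.< bit b → b ≡ true
      bit-pos {true} _ = ≡.refl
      stay : ∀ {τ τ′} → Config χ₁ W₁ τ → Config χ₁ W₁ τ′ → SearchSmall (execs reset τ) (nnz A) (nnz A) τ′ → ¬
        (varᴺ τ′ 12 ℕ.< varᴺ τ′ 8) →
        ∀ r′ → χ₁ (row r′) ≡ true → ¼ ≤ quad W₁ (A r′)
      stay Cτ Cτ′ (inj₁ (_ , all)) _ r′ χr′ with occupied-insert r occ occupied r′ χr′
      ... | e , e< , eq = ≤-trans (≤-reflexive (sym (reflexive (Config.quart Cτ)))) (≤-trans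
            (all e e< (≡.subst (0 ℕ.<_) (≡.sym (≡.trans (flag Cτ r′ eq) (≡.cong bit χr′))) (s≤s z≤n)))
              (≤-reflexive (lev Cτ r′ eq)))
      stay Cτ Cτ′ (inj₂ (eq8 , _)) ¬lt r′ χr′ = ⊥-elim (¬lt (≡.subst₂ ℕ._<_ (≡.sym (Config.zeroᵛ Cτ′))
        (≡.sym eq8) (s≤s z≤n)))
      shrink : ∀ {τ τ′} → Config χ₁ W₁ τ → Config χ₁ W₁ τ′ → SearchSmall (execs reset τ) (nnz A) (nnz A) τ′ →
        varᴺ τ′ 12 ℕ.< varᴺ τ′ 8 →
        Run remove τ′ (3 ℕ.+ 90 ℕ.* X) (Phase₂ (suc j))
      shrink {τ} {τ′} Cτ Cτ′ (inj₁ (eq8 , _)) lt = ⊥-elim (ℕ.n≮0 (≡.subst (varᴺ τ′ 12 ℕ.<_) eq8 lt))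
      shrink {τ} {τ′} Cτ Cτ′ (inj₂ (_ , e , e< , eq7₃ , member , small)) _ =
        run-block-then drop-flag (run-map (λ {υ} f P → _ , _ ,
            drop M r 1<λ (λ _ _ → refl) r′ (bit-pos (≡.subst (0 ℕ.<_) (flag Cτ r′ eq) member))
              (≤-trans (≤-reflexive (sym (lev Cτ r′ eq))) (≤-trans small
                (≤-reflexive (reflexive (Config.quart Cτ)))))
              (trans (+-congˡ (-‿cong (reflexive (Config.oneᵛ Cτ′)))) (+-identityˡ _)) (λ _ _ → refl) ,
            record
              { rep = P
              ; flags = λ r″ → ≡.trans (≡.cong (λ f → f (toℕ r″)) (f (na 4) ≡.refl)) (set-flag {f = arrᴺ τ′ 4}
                r′ false (Config.flags Cτ′) eq7′ (Config.zeroᵛ Cτ′) r″)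
              ; occupied = occupied-remove (row r′) (Config.occupied Cτ′) })
          (exchange-row r′ (rankOne-symm symm 1# (A r)) (represents-frame {block drop-flag} ≡.refl ≡.refl
            (block-frame drop-flag τ′) (Config.rep Cτ′)) eq7′))
        where
        r′ = proj₁ (row-of e<)
        eq = proj₂ (row-of e<)
        eq7′ : varᴺ τ′ 7 ≡ toℕ r′
        eq7′ = ≡.trans eq7₃ (≡.trans (≡.cong (λ f → f e) (Config.rows Cτ)) eq)

    Solved : State → Set
    Solved σ = Σ[ j ∈ ℕ ] Σ[ χ ∈ (Fin (n ℕ.+ d) → Bool) ] Σ[ W ∈ Square d ] Main j χ W × Config χ W σ ×
      (∀ r → quad W (A r) ≤ 1#)

    improvements : ∀ {T} → (∀ {j χ W} → Main j χ W → j ℕ.< T) → ∀ k {j σ} → T ℕ.≤ j ℕ.+ k → Phase₂F j σ →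
      Run (While lessᴺ 12 8 Do improve) σ (suc (k ℕ.* suc (208 ℕ.* X))) Solved
    improvements bounded = run-while {p = improve} Phase₂F (λ (_ , _ , M , _) → bounded M) step
      where
      step : ∀ {j σ} → Phase₂F j σ → test (lessᴺ 12 8) σ ≡ false × Solved σ ⊎ test (lessᴺ 12 8) σ ≡ true × Run
        improve σ (208 ℕ.* X) (Phase₂F (suc j))
      step {j} {σ} (χ , W , M , C , inj₁ (eq8 , all)) = inj₁
        (dec-false (varᴺ σ 12 ℕ.<? varᴺ σ 8) (λ lt → ℕ.n≮0 (≡.subst (varᴺ σ 12 ℕ.<_) eq8 lt)) , (j , χ , W , M ,
          C , all))
      step {j} {σ} (χ , W , M , C , inj₂ (eq8 , r , eq7 , occ , 1<λ)) = inj₂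
        (dec-true (varᴺ σ 12 ℕ.<? varᴺ σ 8) (≡.subst₂ ℕ._<_ (≡.sym (Config.zeroᵛ C)) (≡.sym eq8) (s≤s z≤n)) ,
          improve-spec M C r eq7 occ 1<λ)

  -- Size, time and conditioning

  -- A norm has to be exhibited as a number; the root is the supremum of the numbers whose square is
  -- at most `y`. As `s` is at most 1, a step of a quarter of the gap changes the square by no more
  -- than the gap.
  sqrt : ∀ {y} → 0# ≤ y → y ≤ 1# → ∃[ s ] 0# ≤ s × s ≤ 1# × s * s ≈ y
  sqrt {y} 0≤y y≤1 = s , 0≤s , s≤1 , antisym (≮⇒≥ ¬above) (≮⇒≥ ¬below)
    where
    P : ℝ → Set
    P x = 0# ≤ x × x * x ≤ y
    ≮⇒≥ : ∀ {a b} → ¬ (a < b) → b ≤ a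
    ≮⇒≥ {a} {b} a≮b with b ≤? a
    ... | yes b≤a = b≤a
    ... | no b≰a = ⊥-elim (a≮b (≰⇒> b≰a))
    square-cancel : ∀ {x z} → 0# ≤ z → x * x ≤ z * z → x ≤ z
    square-cancel {x} {z} 0≤z x²≤z² = ≮⇒≥ λ z<x → <⇒≱ (<-by
      (*-pos (x<y⇒0<y-x z<x) (<-≤-trans (≤-<-trans 0≤z z<x) (≤-by 0≤z (solve 2 (λ x z → x :+ z :- x := z) refl x
        z))))
      (solve 2 (λ x z → x :* x :- z :* z := (x :- z) :* (x :+ z)) refl x z)) x²≤z²
    bounded : 1# IsUpperBoundOf P
    bounded x (_ , x²≤y) = square-cancel (proj₁ 0<1)
      (≤-trans x²≤y (≤-trans y≤1 (≤-reflexive (sym (*-identityˡ 1#)))))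
    sup = supremum P (0# , ≤-refl , ≤-trans (≤-reflexive (zeroˡ 0#)) 0≤y) (1# , bounded)
    s = proj₁ sup
    0≤s : 0# ≤ s
    0≤s = proj₁ (proj₂ sup) 0# (≤-refl , ≤-trans (≤-reflexive (zeroˡ 0#)) 0≤y)
    s≤1 : s ≤ 1#
    s≤1 = proj₂ (proj₂ sup) 1# bounded
    -- If s² < y, then (s + e)² ≤ y for e = (y − s²) / 4.
    ¬below : ¬ (s * s < y)
    ¬below lt = <⇒≱ (<-by 0<e (solve 2 (λ s e → s :+ e :- s := e) refl s e)) (proj₁ (proj₂ sup) (s + e)
      (+-nonneg 0≤s (proj₁ 0<e) , below))
      where
      gap = y - s * s
      0<gap : 0# < gap
      0<gap = x<y⇒0<y-x lt
      e = ¼ * gap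
      0<e : 0# < e
      0<e = *-pos 0<¼ 0<gap
      4e≈ : (1# + 1# + (1# + 1#)) * e ≈ gap
      4e≈ = trans (sym (*-assoc _ _ _)) (trans (*-congʳ 4*¼≈1) (*-identityˡ gap))
      e≤1 : e ≤ 1#
      e≤1 = ≤-trans (≤-by (*-nonneg (+-nonneg (proj₁ 0<1) (+-nonneg (proj₁ 0<1) (proj₁ 0<1))) (proj₁ 0<e))
          (trans (+-congʳ (sym 4e≈)) (solve 1 (λ e → :4 :* e :- e := (:1 :+ (:1 :+ :1)) :* e) refl e)))
        (≤-trans (≤-by (0≤x² s) (solve 2 (λ y s → y :- (y :- s :* s) := s :* s) refl y s)) y≤1)
      below : (s + e) * (s + e) ≤ y
      below = ≤-by (*-nonneg (proj₁ 0<e) (+-nonneg (+-nonneg (x≤y⇒0≤y-x s≤1) (x≤y⇒0≤y-x s≤1))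
        (+-nonneg (x≤y⇒0≤y-x e≤1) (proj₁ 0<1))))
        (trans (solve 3 (λ y s e → y :- (s :+ e) :* (s :+ e) := (y :- s :* s) :- :4 :* e
            :+ e :* (:1 :- s :+ (:1 :- s) :+ (:1 :- e :+ :1))) refl y s e)
          (trans (+-congʳ (trans (+-congˡ (-‿cong 4e≈)) (-‿inverseʳ gap))) (+-identityˡ _)))
    -- If s² > y, then (s − e)² ≥ y for e = (s² − y) / 4.
    ¬above : ¬ (y < s * s)
    ¬above lt = <⇒≱ (<-by 0<e (solve 2 (λ s e → s :- (s :- e) := e) refl s e))
      (proj₂ (proj₂ sup) (s - e) λ x (_ , x²≤y) → square-cancel 0≤s-e (≤-trans x²≤y above))
      where
      gap = s * s - y
      0<gap : 0# < gap
      0<gap = x<y⇒0<y-x lt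
      e = ¼ * gap
      0<e : 0# < e
      0<e = *-pos 0<¼ 0<gap
      4e≈ : (1# + 1# + (1# + 1#)) * e ≈ gap
      4e≈ = trans (sym (*-assoc _ _ _)) (trans (*-congʳ 4*¼≈1) (*-identityˡ gap))
      e≤gap : e ≤ gap
      e≤gap = ≤-by (*-nonneg (+-nonneg (proj₁ 0<1) (+-nonneg (proj₁ 0<1) (proj₁ 0<1))) (proj₁ 0<e))
          (trans (+-congʳ (sym 4e≈)) (solve 1 (λ e → :4 :* e :- e := (:1 :+ (:1 :+ :1)) :* e) refl e))
      0≤s-e : 0# ≤ s - e
      0≤s-e = x≤y⇒0≤y-x (≤-trans e≤gap (≤-trans (≤-by 0≤y (solve 2 (λ y s → s :* s :- (s :* s :- y) := y) refl y s))
        (≤-trans (*-monoˡ-≤ 0≤s s≤1) (≤-reflexive (*-identityʳ s)))))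
      above : y ≤ (s - e) * (s - e)
      above = ≤-by (+-nonneg (*-nonneg (proj₁ 0<e) (+-nonneg (+-nonneg (x≤y⇒0≤y-x s≤1) (x≤y⇒0≤y-x s≤1))
        (+-nonneg (proj₁ 0<1) (proj₁ 0<1)))) (0≤x² e))
        (trans (solve 3 (λ y s e → (s :- e) :* (s :- e) :- y := (s :* s :- y) :- :4 :* e
            :+ (e :* (:1 :- s :+ (:1 :- s) :+ (:1 :+ :1)) :+ e :* e)) refl y s e)
          (trans (+-congʳ (trans (+-congˡ (-‿cong 4e≈)) (-‿inverseʳ gap))) (+-identityˡ _)))

  -- Subsets given by flags, and sums over their elements

  subset : ∀ {n} → (Fin n → Bool) → Subset n
  subset = Vec.tabulate

  ∈-subset⁺ : ∀ {n} (f : Fin n → Bool) {r} → f r ≡ true → r ∈ subset f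
  ∈-subset⁺ f {r} eq = Vec.lookup⇒[]= r (subset f) (≡.trans (Vec.lookup∘tabulate f r) eq)

  ∈-subset⁻ : ∀ {n} (f : Fin n → Bool) {r} → r ∈ subset f → f r ≡ true
  ∈-subset⁻ f {r} r∈ = ≡.trans (≡.sym (Vec.lookup∘tabulate f r)) (Vec.[]=⇒lookup r∈)

  ∣subset∣ : ∀ {n} (f : Fin n → Bool) → fromℕ ∣ subset f ∣ ≈ sum (weight ∘ f)
  ∣subset∣ {zero} f = refl
  ∣subset∣ {suc n} f with f zero
  ... | true = +-congˡ (∣subset∣ (f ∘ suc))
  ... | false = trans (∣subset∣ (f ∘ suc)) (sym (+-identityˡ _))

  sum-lookup : ∀ {X : Set} (g : X → ℝ) xs → sum (λ k → g (List.lookup xs k)) ≈ sumᴸ g xs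
  sum-lookup g [] = refl
  sum-lookup g (x ∷ xs) = +-congˡ (sum-lookup g xs)

  -- Translates sums over the index set of ℝ^S into the weighted sums over all rows of
  -- `combination`.
  sum-elements : ∀ {n} (f : Fin n → Bool) (g : Fin n → ℝ) →
    sum (λ k → g (List.lookup (elements (subset f)) k)) ≈ sum (λ r → weight (f r) * g r)
  sum-elements {n} f g = trans (sum-lookup g (elements (subset f))) (trans (sumᴸ-filter (_∈? subset f) g (allFin n))
    (trans (sumᴸ-tabulate {Fin n} (λ r → if does (r ∈? subset f) then g r else 0#) (λ r → r)) (sum-cong {n} term)))
    where
    term : ∀ r → (if does (r ∈? subset f) then g r else 0#) ≈ weight (f r) * g r
    term r with f r in eq
    ... | true = trans (reflexive (≡.cong (λ b → if b then g r else 0#) (dec-true (r ∈? subset f)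
      (∈-subset⁺ f eq)))) (sym (*-identityˡ _))
    ... | false = trans (reflexive (≡.cong (λ b → if b then g r else 0#) (dec-false (r ∈? subset f) λ r∈ →
      false≢true (≡.trans (≡.sym eq) (∈-subset⁻ f r∈))))) (sym (zeroˡ _))
      where
      false≢true : false ≢ true
      false≢true ()

  -- Logarithms and the number of rounds

  log : ℕ → ℕ
  log zero = 0
  log (suc d) with suc d ℕ.≤? 2 ℕ.^ log d
  ... | yes _ = log d
  ... | no _ = suc (log d)

  n≤2^log : ∀ d → d ℕ.≤ 2 ℕ.^ log d
  n≤2^log zero = z≤n
  n≤2^log (suc d) with suc d ℕ.≤? 2 ℕ.^ log d
  ... | yes le = le
  ... | no _ = ℕ.≤-trans (ℕ.+-mono-≤ (ℕ.m^n>0 2 (log d)) (n≤2^log d)) (ℕ.≤-reflexive (≡.cong (2 ℕ.^ log d ℕ.+_)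
    (≡.sym (ℕ.+-identityʳ _))))

  -- The notion of Õ quantifies over all upper bounds `l` of a logarithm; leastness allows `log d`
  -- to be replaced by any of them.
  log-least : ∀ d {l} → d ℕ.≤ 2 ℕ.^ l → log d ℕ.≤ l
  log-least zero _ = z≤n
  log-least (suc d) {l} le with suc d ℕ.≤? 2 ℕ.^ log d
  ... | yes _ = log-least d (ℕ.<⇒≤ le)
  ... | no ¬le = ℕ.≤∧≢⇒< (log-least d (ℕ.<⇒≤ le)) λ { ≡.refl → ¬le le }

  fromℕ-^ : ∀ m k → fromℕ m ^ k ≈ fromℕ (m ℕ.^ k)
  fromℕ-^ m zero = sym (+-identityʳ 1#)
  fromℕ-^ m (suc k) = trans (*-congˡ (fromℕ-^ m k)) (sym (fromℕ-* m (m ℕ.^ k)))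

  2^m≤ρ^2m : ∀ m → fromℕ (2 ℕ.^ m) ≤ ρ ^ (m ℕ.* 2)
  2^m≤ρ^2m zero = ≤-reflexive (+-identityʳ 1#)
  2^m≤ρ^2m (suc m) = ≤-trans (≤-reflexive (trans (fromℕ-* 2 (2 ℕ.^ m)) (*-congʳ (+-congˡ (+-identityʳ 1#)))))
    (≤-trans (*-mono-≤ (+-nonneg (proj₁ 0<1) (proj₁ 0<1)) (fromℕ-nonneg (2 ℕ.^ m)) 2≤ρ² (2^m≤ρ^2m m))
      (≤-reflexive (*-assoc ρ ρ _)))

  ρ^-mono : ∀ {i j} → i ℕ.≤ j → ρ ^ i ≤ ρ ^ j
  ρ^-mono {j = zero} z≤n = ≤-refl
  ρ^-mono {zero} {suc j} z≤n = ≤-trans (ρ^-mono {0} {j} z≤n) (≤-by (*-nonneg (+-nonneg (proj₁ 0<¼) (proj₁ 0<¼))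
    (ρ^-nonneg j))
    (solve 2 (λ q p → (:1 :+ (q :+ q)) :* p :- p := (q :+ q) :* p) refl ¼ (ρ ^ j)))
  ρ^-mono (s≤s le) = *-monoˡ-≤ 0≤ρ (ρ^-mono le)

  -- Let e = d (3 + log d). Since 4d + 1 ≤ 8d for positive d, `potential-bound` gives ρ^j ≤ 2^e,
  -- whereas j = 2 (e + 1) rounds would give at least 2^(e + 1).
  steps : ℕ → ℕ
  steps d = suc (d ℕ.* (3 ℕ.+ log d)) ℕ.* 2

  1+4d≤ : ∀ d → suc (4 ℕ.* d) ℕ.≤ 2 ℕ.^ (3 ℕ.+ log d)
  1+4d≤ zero = s≤s z≤n
  1+4d≤ d@(suc _) = ℕ.≤-trans (ℕ.+-monoˡ-≤ (4 ℕ.* d) (ℕ.≤-trans (s≤s z≤n) (ℕ.m≤n*m d 4)))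
    (ℕ.≤-trans (ℕ.≤-reflexive (≡.sym (ℕ.*-distribʳ-+ d 4 4))) (ℕ.≤-trans (ℕ.*-monoʳ-≤ 8 (n≤2^log d))
      (ℕ.≤-reflexive (≡.sym (ℕ.^-distribˡ-+-* 2 3 (log d))))))

  scale : ∀ a b {t z y C} → t ℕ.≤ a ℕ.* z → z ℕ.≤ b ℕ.* y → a ℕ.* b ℕ.≤ C → t ℕ.≤ C ℕ.* y
  scale a b {y = y} t≤ z≤ ab≤C = ℕ.≤-trans t≤ (ℕ.≤-trans (ℕ.*-monoʳ-≤ a z≤)
    (ℕ.≤-trans (ℕ.≤-reflexive (≡.sym (ℕ.*-assoc a b y))) (ℕ.*-monoˡ-≤ y ab≤C)))

  total-time : ∀ d T X E → E ℕ.≤ X → 0 ℕ.< X →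
    36 ℕ.* X ℕ.+ ((2 ℕ.+ d ℕ.* (2 ℕ.+ 224 ℕ.* X)) ℕ.+ (10 ℕ.* X ℕ.+ (suc (T ℕ.* suc (208 ℕ.* X)) ℕ.+
      (1 ℕ.+ (2 ℕ.+ E ℕ.* 8)))))
      ℕ.≤ 495 ℕ.* ((1 ℕ.+ d ℕ.+ T) ℕ.* X)
  total-time d T X E E≤X 0<X = begin
    36 ℕ.* X ℕ.+ ((2 ℕ.+ d ℕ.* (2 ℕ.+ 224 ℕ.* X)) ℕ.+ (10 ℕ.* X ℕ.+ (suc (T ℕ.* suc (208 ℕ.* X)) ℕ.+
      (1 ℕ.+ (2 ℕ.+ E ℕ.* 8)))))
      ≡⟨ solveᴺ 4 (λ d T X E → conᴺ 36 ⊗ X ⊕ ((conᴺ 2 ⊕ d ⊗ (conᴺ 2 ⊕ conᴺ 224 ⊗ X)) ⊕ (conᴺ 10 ⊗ X ⊕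
        ((conᴺ 1 ⊕ T ⊗ (conᴺ 1 ⊕ conᴺ 208 ⊗ X)) ⊕ (conᴺ 1 ⊕ (conᴺ 2 ⊕ E ⊗ conᴺ 8)))))
           ⊜ (conᴺ 6 ⊕ d ⊗ conᴺ 2 ⊕ T) ⊗ conᴺ 1 ⊕ (conᴺ 46 ⊗ X ⊕ (conᴺ 224 ⊗ (d ⊗ X) ⊕ (conᴺ 208 ⊗ (T ⊗ X) ⊕
             conᴺ 8 ⊗ E)))) ≡.refl d T X E ⟩
    (6 ℕ.+ d ℕ.* 2 ℕ.+ T) ℕ.* 1 ℕ.+ (46 ℕ.* X ℕ.+ (224 ℕ.* (d ℕ.* X) ℕ.+ (208 ℕ.* (T ℕ.* X) ℕ.+ 8 ℕ.* E)))
      ≤⟨ ℕ.+-mono-≤ (ℕ.*-monoʳ-≤ (6 ℕ.+ d ℕ.* 2 ℕ.+ T) 0<X) (ℕ.+-monoʳ-≤ (46 ℕ.* X) (ℕ.+-monoʳ-≤ (224 ℕ.* (d ℕ.* X))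
           (ℕ.+-monoʳ-≤ (208 ℕ.* (T ℕ.* X)) (ℕ.*-monoʳ-≤ 8 E≤X)))) ⟩
    (6 ℕ.+ d ℕ.* 2 ℕ.+ T) ℕ.* X ℕ.+ (46 ℕ.* X ℕ.+ (224 ℕ.* (d ℕ.* X) ℕ.+ (208 ℕ.* (T ℕ.* X) ℕ.+ 8 ℕ.* X)))
      -- So far the coefficients of `X`, `d X` and `T X` are 60, 226 and 209; the added terms raise
      -- all three to 495.
      ≤⟨ ℕ.m≤m+n _ (435 ℕ.* X ℕ.+ 269 ℕ.* (d ℕ.* X) ℕ.+ 286 ℕ.* (T ℕ.* X)) ⟩
    (6 ℕ.+ d ℕ.* 2 ℕ.+ T) ℕ.* X ℕ.+ (46 ℕ.* X ℕ.+ (224 ℕ.* (d ℕ.* X) ℕ.+ (208 ℕ.* (T ℕ.* X) ℕ.+ 8 ℕ.* X)))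
      ℕ.+ (435 ℕ.* X ℕ.+ 269 ℕ.* (d ℕ.* X) ℕ.+ 286 ℕ.* (T ℕ.* X))
      ≡⟨ solveᴺ 3 (λ d T X → (conᴺ 6 ⊕ d ⊗ conᴺ 2 ⊕ T) ⊗ X ⊕ (conᴺ 46 ⊗ X ⊕ (conᴺ 224 ⊗ (d ⊗ X) ⊕
        (conᴺ 208 ⊗ (T ⊗ X) ⊕ conᴺ 8 ⊗ X)))
           ⊕ (conᴺ 435 ⊗ X ⊕ conᴺ 269 ⊗ (d ⊗ X) ⊕ conᴺ 286 ⊗ (T ⊗ X))
           ⊜ conᴺ 495 ⊗ ((conᴺ 1 ⊕ d ⊕ T) ⊗ X)) ≡.refl d T X ⟩
    495 ℕ.* ((1 ℕ.+ d ℕ.+ T) ℕ.* X) ∎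
    where
    open ℕ.≤-Reasoning
    open +-*-Solver using () renaming (solve to solveᴺ; con to conᴺ; _:+_ to _⊕_; _:*_ to _⊗_; _:=_ to _⊜_)

  -- Assembling the bounds

  module Result {n d : ℕ} (A : Matrix n d) where
    open Verified A
    open Stages A
    open Correctness A

    main-bounded : ∀ {j χ W} → Main j χ W → j ℕ.< steps d
    main-bounded {j} M with j ℕ.<? steps d
    ... | yes lt = lt
    ... | no ≮ = ⊥-elim (ℕ.<⇒≱ (ℕ.m<m+n (2 ℕ.^ e) {2 ℕ.^ e ℕ.+ 0} (ℕ.<-≤-trans (ℕ.m^n>0 2 e) (ℕ.m≤m+n _ 0)))
        (ℕ.≤-trans (fromℕ-cancel-≤ (≤-trans (2^m≤ρ^2m (suc e)) (≤-trans (ρ^-mono (ℕ.≮⇒≥ ≮))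
          (≤-trans (potential-bound M) (≤-reflexive (fromℕ-^ (suc (4 ℕ.* d)) d))))))
          (ℕ.≤-trans (ℕ.^-monoˡ-≤ d (1+4d≤ d)) (ℕ.≤-reflexive (≡.trans (ℕ.^-*-assoc 2 (3 ℕ.+ log d) d)
            (≡.cong (2 ℕ.^_) (ℕ.*-comm (3 ℕ.+ log d) d)))))))
      where e = d ℕ.* (3 ℕ.+ log d)

    Finished : State → Set
    Finished υ = Σ[ j ∈ ℕ ] Σ[ χ ∈ (Fin (n ℕ.+ d) → Bool) ] Σ[ W ∈ Square d ]
      Main j χ W × (∀ r → quad W (A r) ≤ 1#) × Outputs υ (subset (χ ∘ row))

    finish : ∀ {τ} → Solved τ → Run output τ (1 ℕ.+ (2 ℕ.+ nnz A ℕ.* 8)) Finished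
    finish {τ} (j , χ , W , M , C , all≤) = run-map (λ {υ} _ O → j , χ , W , M , all≤ , permutation O)
      (output-spec size one zeroᵛ)
      where
      open Config C
      S = subset (χ ∘ row)
      true≢ : ∀ {b} → 0 ℕ.< bit b → b ≡ true
      true≢ {true} _ = ≡.refl
      permutation : ∀ {υ} → Output τ (nnz A) υ → applyUpTo (arrᴺ υ 0) (varᴺ υ 0) ↭ List.map toℕ (elements S)
      -- Two lists without repetition that have the same members are permutations of each other.
      permutation {υ} O = ∼bag⇒↭ (unique∧set⇒bag
          (Unique.applyUpTo⁺₁ (arrᴺ υ 0) (varᴺ υ 0) distinct)
          (Unique.map⁺ Fin.toℕ-injective (Unique.filter⁺ (_∈? S) (Unique.allFin⁺ n)))
          (mk⇔ to from))
        where
        open Output O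
        to : ∀ {k} → k List.∈ applyUpTo (arrᴺ υ 0) (varᴺ υ 0) → k List.∈ List.map toℕ (elements S)
        to k∈ with ∈-applyUpTo⁻ (arrᴺ υ 0) k∈
        ... | x , x<m , ≡.refl with sound x x<m
        ...   | pos , _ , e , e< , eq with row-of e<
        ...     | r , eqr = ≡.subst (List._∈ List.map toℕ (elements S)) (≡.sym k≡)
                    (∈-map⁺ toℕ (∈-filter⁺ (_∈? S) (∈-allFin r) (∈-subset⁺ (χ ∘ row)
                      (true≢ (≡.subst (0 ℕ.<_) (≡.trans (≡.cong (arrᴺ τ 4) k≡) (flags r)) pos)))))
          where
          k≡ : arrᴺ υ 0 x ≡ toℕ r
          k≡ = ≡.trans eq (≡.trans (≡.cong (λ f → f e) rows) eqr)
        from : ∀ {k} → k List.∈ List.map toℕ (elements S) → k List.∈ applyUpTo (arrᴺ υ 0) (varᴺ υ 0)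
        from k∈ with ∈-map⁻ toℕ k∈
        ... | r , r∈ , ≡.refl with complete (toℕ r)
        ...   | inj₂ (x , x<m , eq) = ≡.subst (List._∈ applyUpTo (arrᴺ υ 0) (varᴺ υ 0)) eq
          (∈-applyUpTo⁺ (arrᴺ υ 0) x<m)
        ...   | inj₁ eq with occupied r χr
          where
          χr = ∈-subset⁻ (χ ∘ row) (proj₂ (∈-filter⁻ (_∈? S) {xs = allFin n} r∈))
        ...     | e , e< , eqr = ⊥-elim
          (zero≢one (≡.trans (≡.sym (≡.trans (≡.cong (arrᴺ υ 4) (≡.sym (≡.trans (≡.cong (λ f → f e) rows) eqr)))
          (erased e e<)))
                    (≡.trans eq (≡.trans (flags r) (≡.cong bit (∈-subset⁻ (χ ∘ row)
                      (proj₂ (∈-filter⁻ (_∈? S) {xs = allFin n} r∈))))))))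
          where
          zero≢one : 0 ≢ 1
          zero≢one ()

    algorithm-spec : ∀ ε → Run algorithm (input A ε) (495 ℕ.* ((1 ℕ.+ d ℕ.+ steps d) ℕ.* X)) Finished
    algorithm-spec ε = run-weaken (total-time d (steps d) X (nnz A) (ℕ.<⇒≤ nnz<X) (s≤s z≤n))
      (run-seq (setup-spec ε) λ _ C →
       run-seq (phase₁-spec (χ₀ , δ , initial (λ _ _ → refl) , C)) λ _ (χ , W , I , C) →
       run-seq (find-spec (χ , W , main₀ I , C)) λ _ P →
       run-seq (improvements main-bounded (steps d) ℕ.≤-refl P) λ _ → finish)

    empty-nnz : d ≡ 0 → nnz A ≡ 0
    empty-nnz ≡.refl with nnz A in eq
    ... | zero = ≡.refl
    ... | suc _ with array-< (toℕ ∘ proj₁) (toℕ ∘ proj₂) (λ (i , j) → A i j) (Spanning.nonzeros R A) {0}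
      (≡.subst (0 ℕ.<_) (≡.sym eq) (s≤s z≤n))
    ...   | (_ , ()) , _

    -- The 1 in `X` is absorbed by doubling nnz(A) + d², which is positive unless `d` is zero; in
    -- that case there are no entries and `X` is 1. The doubling turns the 10 of `left` into the
    -- constant 20.
    Z≤ : ∀ {l} → log d ℕ.≤ l → (1 ℕ.+ d ℕ.+ steps d) ℕ.* X ℕ.≤ 20 ℕ.* (suc (d ℕ.* (nnz A ℕ.+ d ℕ.* d)) ℕ.* suc l)
    Z≤ {l} log≤ = bound d (nnz A) (log d) log≤ empty-nnz
      where
      open ℕ.≤-Reasoning
      open +-*-Solver using () renaming (solve to solveᴺ; con to conᴺ; _:+_ to _⊕_; _:*_ to _⊗_; _:=_ to _⊜_)
      bound : ∀ d E L → L ℕ.≤ l → (d ≡ 0 → E ≡ 0) →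
        (1 ℕ.+ d ℕ.+ suc (d ℕ.* (3 ℕ.+ L)) ℕ.* 2) ℕ.* suc (E ℕ.+ d ℕ.* d) ℕ.≤ 20 ℕ.*
          (suc (d ℕ.* (E ℕ.+ d ℕ.* d)) ℕ.* suc l)
      bound zero E L _ E≡0 with E≡0 ≡.refl
      ... | ≡.refl = ℕ.≤-trans (ℕ.m≤m+n 3 17) (ℕ.*-monoʳ-≤ 20 (s≤s (z≤n {l ℕ.+ 0})))
      bound d@(suc d′) E L L≤l _ = begin
        (1 ℕ.+ d ℕ.+ suc (d ℕ.* (3 ℕ.+ L)) ℕ.* 2) ℕ.* suc Y
          ≤⟨ ℕ.*-mono-≤ left right ⟩
        (d ℕ.* (10 ℕ.+ 2 ℕ.* l)) ℕ.* (Y ℕ.+ Y)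
          ≡⟨ solveᴺ 3 (λ d l y → (d ⊗ (conᴺ 10 ⊕ conᴺ 2 ⊗ l)) ⊗ (y ⊕ y) ⊜ (d ⊗ y) ⊗ (conᴺ 20 ⊕ conᴺ 4 ⊗ l))
            ≡.refl d l Y ⟩
        (d ℕ.* Y) ℕ.* (20 ℕ.+ 4 ℕ.* l)
          ≤⟨ ℕ.*-mono-≤ (ℕ.n≤1+n (d ℕ.* Y)) (ℕ.+-monoʳ-≤ 20 (ℕ.*-monoˡ-≤ l (ℕ.m≤m+n 4 16))) ⟩
        suc (d ℕ.* Y) ℕ.* (20 ℕ.+ 20 ℕ.* l)
          ≡⟨ solveᴺ 2 (λ f l → f ⊗ (conᴺ 20 ⊕ conᴺ 20 ⊗ l) ⊜ conᴺ 20 ⊗ (f ⊗ (conᴺ 1 ⊕ l))) ≡.refl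
            (suc (d ℕ.* Y)) l ⟩
        20 ℕ.* (suc (d ℕ.* Y) ℕ.* suc l) ∎
        where
        Y = E ℕ.+ d ℕ.* d
        right : suc Y ℕ.≤ Y ℕ.+ Y
        right = ℕ.+-monoˡ-≤ Y (ℕ.≤-trans (s≤s z≤n) (ℕ.m≤n+m (d ℕ.* d) E))
        left : 1 ℕ.+ d ℕ.+ suc (d ℕ.* (3 ℕ.+ L)) ℕ.* 2 ℕ.≤ d ℕ.* (10 ℕ.+ 2 ℕ.* l)
        left = begin
          1 ℕ.+ d ℕ.+ suc (d ℕ.* (3 ℕ.+ L)) ℕ.* 2
            ≡⟨ solveᴺ 2 (λ d L → conᴺ 1 ⊕ d ⊕ (conᴺ 1 ⊕ d ⊗ (conᴺ 3 ⊕ L)) ⊗ conᴺ 2 ⊜ conᴺ 3 ⊗ conᴺ 1 ⊕ d ⊗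
              (conᴺ 7 ⊕ conᴺ 2 ⊗ L)) ≡.refl d L ⟩
          3 ℕ.* 1 ℕ.+ d ℕ.* (7 ℕ.+ 2 ℕ.* L)
            ≤⟨ ℕ.+-mono-≤ (ℕ.*-monoʳ-≤ 3 {1} {d} (s≤s z≤n)) (ℕ.*-monoʳ-≤ d (ℕ.+-monoʳ-≤ 7 (ℕ.*-monoʳ-≤ 2 L≤l))) ⟩
          3 ℕ.* d ℕ.+ d ℕ.* (7 ℕ.+ 2 ℕ.* l)
            ≡⟨ solveᴺ 2 (λ d l → conᴺ 3 ⊗ d ⊕ d ⊗ (conᴺ 7 ⊕ conᴺ 2 ⊗ l) ⊜ d ⊗ (conᴺ 10 ⊕ conᴺ 2 ⊗ l)) ≡.refl d l ⟩
          d ℕ.* (10 ℕ.+ 2 ℕ.* l) ∎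

    module _ {ε : ℝ} (0<ε : 0# < ε) where

      private
        clipped : 0# < ε ⊓ 1# × ε ⊓ 1# ≤ 1#
        clipped with total ε 1#
        ... | inj₁ ε≤1 = 0<ε , ε≤1
        ... | inj₂ 1≤ε = 0<1 , ≤-refl

        1≤clipped⁻¹ : 1# ≤ (ε ⊓ 1#) ⁻¹
        1≤clipped⁻¹ = *-cancelˡ-≤ (proj₁ clipped) (≤-trans (≤-reflexive (*-identityʳ _)) (≤-trans (proj₂ clipped)
          (≤-reflexive (sym (*-inverseʳ _ (<⇒≉ (proj₁ clipped)))))))

      -- The inverse of `ε ⊓ 1#` is at least 1.
      F≤timeBound : fromℕ (d ℕ.* (nnz A ℕ.+ d ℕ.* d)) ≤ timeBound A ε
      F≤timeBound = ≤-trans (≤-reflexive (fromℕ-* d (nnz A ℕ.+ d ℕ.* d)))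
        (*-monoʳ-≤ (fromℕ-nonneg (nnz A ℕ.+ d ℕ.* d))
        (≤-trans (≤-reflexive (sym (*-identityʳ _))) (*-monoˡ-≤ (fromℕ-nonneg d) 1≤clipped⁻¹)))

      time-bound : ∀ C {t} → 495 ℕ.* 20 ℕ.≤ C → t ℕ.≤ 495 ℕ.* ((1 ℕ.+ d ℕ.+ steps d) ℕ.* X) → t ≤Õ[ C , 1 ]
        timeBound A ε
      time-bound C {t} le t≤ l f≤ = begin
        fromℕ t                                                    ≤⟨ fromℕ-mono-≤ t≤C ⟩
        fromℕ (C ℕ.* (suc F ℕ.* suc l))                            ≈⟨ trans (fromℕ-* C (suc F ℕ.* suc l))
          (*-congˡ (fromℕ-* (suc F) (suc l))) ⟩
        fromℕ C * (fromℕ (suc F) * fromℕ (suc l))                  ≈⟨ *-assoc _ _ _ ⟨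
        fromℕ C * fromℕ (suc F) * fromℕ (suc l)                    ≤⟨ *-monoʳ-≤ (fromℕ-nonneg (suc l))
          (*-monoˡ-≤ (fromℕ-nonneg C) (+-monoʳ-≤ 1# F≤timeBound)) ⟩
        fromℕ C * (1# + timeBound A ε) * fromℕ (suc l)             ≈⟨ *-congˡ (*-identityʳ _) ⟨
        fromℕ C * (1# + timeBound A ε) * fromℕ (suc l) ^ 1 ∎
        where
        open ≤-Reasoning
        F = d ℕ.* (nnz A ℕ.+ d ℕ.* d)
        d≤F : d ℕ.≤ F
        d≤F = below d (nnz A)
          where
          below : ∀ d E → d ℕ.≤ d ℕ.* (E ℕ.+ d ℕ.* d)
          below zero E = z≤n
          below d@(suc _) E = ℕ.≤-trans (ℕ.≤-reflexive (≡.sym (ℕ.*-identityʳ d))) (ℕ.*-monoʳ-≤ d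
            (ℕ.≤-trans (s≤s z≤n) (ℕ.m≤n+m (d ℕ.* d) E)))
        -- Every admissible `l` is at least `log d`, because d ≤ d (nnz(A) + d²) ≤ `timeBound A ε`.
        d≤2^l : d ℕ.≤ 2 ℕ.^ l
        d≤2^l = ℕ.≤-trans d≤F (fromℕ-cancel-≤ (≤-trans F≤timeBound (≤-trans f≤ (≤-reflexive (fromℕ-^ 2 l)))))
        t≤C : t ℕ.≤ C ℕ.* (suc F ℕ.* suc l)
        t≤C = scale 495 20 t≤ (Z≤ (log-least d d≤2^l)) le

      size-bound : ∀ C → 4 ℕ.≤ C → fromℕ (4 ℕ.* d) ≤ fromℕ C * sizeBound d ε
      size-bound C 4≤C = begin
        fromℕ (4 ℕ.* d)                              ≤⟨ fromℕ-mono-≤ (ℕ.*-mono-≤ 4≤C d≤) ⟩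
        fromℕ (C ℕ.* (d ℕ.* loglog d))               ≈⟨ fromℕ-* C (d ℕ.* loglog d) ⟩
        fromℕ C * fromℕ (d ℕ.* loglog d)             ≤⟨ *-monoˡ-≤ (fromℕ-nonneg C)
          (≤-by (*-nonneg (fromℕ-nonneg d) (proj₁ (x⁻¹-pos 0<ε)))
                                                           (solve 2 (λ a b → a :+ b :- a := b) refl _ _)) ⟩
        fromℕ C * sizeBound d ε                      ∎
        where
        open ≤-Reasoning
        d≤ : d ℕ.≤ d ℕ.* loglog d
        d≤ = ℕ.≤-trans (ℕ.≤-reflexive (≡.sym (ℕ.*-identityʳ d))) (ℕ.*-monoʳ-≤ d (ℕ.m≤n⊔m _ 1))

    well-conditioned : ∀ {j χ W c} → Main j χ W → (∀ r → quad W (A r) ≤ 1#) → 1# ≤ c →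
      IsWellConditionedSpanningSet A (subset (χ ∘ row)) c
    well-conditioned {χ = χ} {W} {c} M all≤ 1≤c i = x ,
        (λ j → trans (proj₁ comb j) (sym (sum-elements (χ ∘ row) (λ r → A r j * (A r ∙ y))))) ,
        (proj₁ root , (proj₁ (proj₂ root) , proj₂ (proj₂ (proj₂ root))) , ≤-trans (proj₁ (proj₂ (proj₂ root))) 1≤c)
      where
      y = W $$ A i
      comb = combination M i
      x = λ k → A (List.lookup (elements (subset (χ ∘ row))) k) ∙ y
      root = sqrt {sum (λ k → x k * x k)} (sum-nonneg (λ k → 0≤x² (x k)))
        (≤-trans (≤-reflexive (sum-elements (χ ∘ row) (λ r → (A r ∙ y) * (A r ∙ y)))) (≤-trans (proj₂ comb)
          (all≤ i)))

  -- The constant is kept abstract, with one inequality for the size and one for the running time.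
  module _ (C : ℕ) (4≤C : 4 ℕ.≤ C) (9900≤C : 495 ℕ.* 20 ℕ.≤ C) {n d : ℕ} (A : Matrix n d) {ε : ℝ} (0<ε : 0# < ε) where
    open Result A
    open Stages A using (row; module Main)

    conclusion : Run algorithm (input A ε) (495 ℕ.* ((1 ℕ.+ d ℕ.+ steps d) ℕ.* Verified.X A)) Finished →
      Σ[ S ∈ Subset n ] (fromℕ ∣ S ∣ ≤ fromℕ C * sizeBound d ε)
        × (Σ[ t ∈ ℕ ] Σ[ σ ∈ State ] (⟨ algorithm , input A ε ⟩⇓[ t ] σ) × Outputs σ S × (t ≤Õ[ C , 1 ]
          timeBound A ε))
        × IsWellConditionedSpanningSet A S (1# + ε)
    conclusion (run halts t≤ (j , χ , W , M , all≤ , out)) = subset (χ ∘ row) ,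
      ≤-trans (≤-trans (≤-reflexive (∣subset∣ (χ ∘ row))) (Main.size M)) (size-bound 0<ε C 4≤C) ,
      (_ , _ , halts , out , time-bound 0<ε C 9900≤C t≤) ,
      well-conditioned M all≤ (≤-by (proj₁ 0<ε) (solve 1 (λ e → :1 :+ e :- :1 := e) refl ε))

corollary3p5 : (R : CompleteOrderedField) → let open Spanning R in
    Σ[ C ∈ ℕ ] Σ[ k ∈ ℕ ] Σ[ P ∈ Program ]
    ((n d : ℕ) (A : Matrix n d) (ε : ℝ) → 0# < ε →
    Σ[ S ∈ Subset n ] (fromℕ ∣ S ∣ ≤ fromℕ C * sizeBound d ε)
    × (Σ[ t ∈ ℕ ] Σ[ σ ∈ State ] (⟨ P , input A ε ⟩⇓[ t ] σ)
    × Outputs σ S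
    × (t ≤Õ[ C , k ] timeBound A ε))
    × IsWellConditionedSpanningSet A S (1# + ε))
-- 9900 is 495 · 20, from `total-time` and `Z≤`. The exponent 1 stands for the single logarithm in
-- the number of rounds.
corollary3p5 R = 9900 , 1 , algorithm , λ n d A ε 0<ε →
  conclusion 9900 (ℕ.≤ᵇ⇒≤ 4 9900 tt) ℕ.≤-refl A 0<ε (Result.algorithm-spec A ε)
  where open SpanningSubset R
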